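{- The periodic+finite vertex prediction problem on $\mathbb Z^3$ is undecidable. That is, there is no algorithm (Turing machine) which, given as input a finite encoding of an arbitrary periodic+finite sandpile configuration $S_0:\mathbb Z^3\to\mathbb Z$, always halts and correctly decides whether the origin topples at least once in the sandpile process started from $S_0$, i.e. whether $N(\vec 0)\ge 1$, where $N$ is the odometer function of $S_0$.
   Context: Sandpile process. Let $\mathbb Z^3$ be the cubic lattice graph in which each vertex has six neighbours $v\pm e_i$. A configuration is a function $S_0:\mathbb Z^3\to\mathbb Z$ ($S_0(v)$ is the number of chips initially on $v$). A vertex is unstable if it currently has at least $6$ chips (its degree). Toppling a vertex removes $6$ chips from it and adds one chip to each of its six neighbours. A toppling sequence is a finite (possibly empty) or infinite sequence of vertices, toppled in order starting from $S_0$. It is legal if each vertex toppled is unstable at the moment just before it is toppled, and complete if every vertex that is unstable at some step (including the start) is toppled at some later step. The odometer function $N:\mathbb Z^3\to\mathbb Z_{\ge0}\cup\{\infty\}$ of $S_0$ is: $N(v)$ is the number of times $v$ occurs in a legal complete toppling sequence; such sequences exist and the number does not depend on which one is chosen. Periodic+finite configurations. A configuration $P:\mathbb Z^3\to\mathbb Z$ is periodic if there are integers $n_x,n_y,n_z\ge1$ such that $P(x,y,z)=P(x',y',z')$ whenever $x\equiv x' \bmod n_x$, $y\equiv y'\bmod n_y$, $z\equiv z'\bmod n_z$. A periodic+finite configuration is $S_0=P+F$ with $P$ periodic and $F:\mathbb Z^3\to\mathbb Z_{\ge0}$ of finite support (finitely many added chips). Its finite encoding consists of $n_x,n_y,n_z$,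 the values of $P$ on $\{0,\dots,n_x-1\}\times\{0,\dots,n_y-1\}\times\{0,\dots,n_z-1\}$, and the finite list of pairs $(v,F(v))$ with $F(v)\neq0$. -}

module Defs where

open import Data.Bool using (Bool; true; if_then_else_)
open import Data.Fin using (Fin)
open import Data.Integer as ℤ using (ℤ; +_; -[1+_])
import Data.Integer.Divisibility as ℤ∣
open import Data.List
  using (List; []; _∷_; _++_; map; concatMap; replicate; upTo; cartesianProduct; head; drop)
open import Data.List.Membership.Propositional using (_∈_)
open import Data.List.Relation.Unary.Unique.Propositional using (Unique)
import Data.List.Membership.DecPropositional as DecMembership
open import Data.Maybe using (Maybe; just; nothing; maybe′)
open import Data.Nat using (ℕ; zero; suc; _+_; _≤_)
open import Data.Product using (∃-syntax; _×_; _,_)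
open import Data.Product.Properties using (≡-dec)
open import Function using (_⇔_; id)
open import Relation.Binary.Definitions using (DecidableEquality)
open import Relation.Binary.PropositionalEquality using (_≡_; _≢_)
open import Relation.Nullary using (does)

Vertex : Set
Vertex = ℤ × ℤ × ℤ

origin : Vertex
origin = + 0 , + 0 , + 0

_≟ᵛ_ : DecidableEquality Vertex
_≟ᵛ_ = ≡-dec ℤ._≟_ (≡-dec ℤ._≟_ ℤ._≟_)

open DecMembership _≟ᵛ_ using (_∈?_)

neighbours : Vertex → List Vertex
neighbours (x , y , z) =
  (ℤ.suc x , y , z) ∷ (ℤ.pred x , y , z) ∷
  (x , ℤ.suc y , z) ∷ (x , ℤ.pred y , z) ∷
  (x , y , ℤ.suc z) ∷ (x , y , ℤ.pred z) ∷ []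

Sandpile : Set
Sandpile = Vertex → ℤ

Unstable : Sandpile → Vertex → Set
Unstable S v = + 6 ℤ.≤ S v

topple : Vertex → Sandpile → Sandpile
topple v S w =
  if does (w ≟ᵛ v) then S w ℤ.- + 6
  else if does (w ∈? neighbours v) then S w ℤ.+ + 1
  else S w

data TopplingSequence : Set where
  finite   : List Vertex → TopplingSequence
  infinite : (ℕ → Vertex) → TopplingSequence

-- The term at (zero-based) index t; nothing past the end of a finite sequence.
term : TopplingSequence → ℕ → Maybe Vertex
term (finite vs)  t = head (drop t vs)
term (infinite f) t = just (f t)

-- The chips after the first t topplings, constant once a finite sequence ends.
after : Sandpile → TopplingSequence → ℕ → Sandpile
after S s zero    = S
after S s (suc t) = maybe′ topple id (term s t) (after S s t)

Legal : Sandpile → TopplingSequence → Set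
Legal S s = ∀ t v → term s t ≡ just v → Unstable (after S s t) v

-- The toppling at index t′ acts on  after S s t′ , so t′ = t is already
-- later than the moment at which v is seen to be unstable.
Complete : Sandpile → TopplingSequence → Set
Complete S s =
  ∀ t v → Unstable (after S s t) v → ∃[ t′ ] t ≤ t′ × term s t′ ≡ just v

occurrences : TopplingSequence → Vertex → ℕ → ℕ
occurrences s v zero    = 0
occurrences s v (suc t) =
  maybe′ (λ w → if does (w ≟ᵛ v) then 1 else 0) 0 (term s t) + occurrences s v t

-- The number of occurrences of v in s is the supremum in ℕ ∪ {∞} of the
-- numbers of occurrences in its initial segments.  Since it cannot be decided
-- whether this supremum is finite, it is given by its natural lower bounds.
infix 4 _≤#[_∈_]
_≤#[_∈_] : ℕ → Vertex → TopplingSequence → Set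
k ≤#[ v ∈ s ] = ∃[ t ] k ≤ occurrences s v t

-- k ≤Odometer[ S , v ]  is  k ≤ N v , where N is the odometer function of S.
infix 4 _≤Odometer[_,_]
_≤Odometer[_,_] : ℕ → Sandpile → Vertex → Set
k ≤Odometer[ S , v ] = ∃[ s ] Legal S s × Complete S s × k ≤#[ v ∈ s ]

infix 4 _≡_mod_
_≡_mod_ : ℤ → ℤ → ℕ → Set
x ≡ x′ mod n = + n ℤ∣.∣ x ℤ.- x′

record PeriodicFinite : Set where
  field
    nx ny nz : ℕ
    1≤nx     : 1 ≤ nx
    1≤ny     : 1 ≤ ny
    1≤nz     : 1 ≤ nz
    P        : Vertex → ℤ
    periodic : ∀ x y z x′ y′ z′ →
               x ≡ x′ mod nx → y ≡ y′ mod ny → z ≡ z′ mod nz →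
               P (x , y , z) ≡ P (x′ , y′ , z′)
    F        : Vertex → ℕ
    -- The vertices with F v ≢ 0, in the order in which the encoding lists them.
    support  : List Vertex
    unique   : Unique support
    supports : ∀ v → v ∈ support ⇔ F v ≢ 0

  S₀ : Sandpile
  S₀ v = P v ℤ.+ + F v

  box : List Vertex
  box = map (λ (i , j , k) → + i , + j , + k)
            (cartesianProduct (upTo nx) (cartesianProduct (upTo ny) (upTo nz)))

-- Integers are written in unary, preceded by a sign if negative.
data Letter : Set where
  one minus end : Letter

encodeℕ : ℕ → List Letter
encodeℕ n = replicate n one ++ end ∷ []

encodeℤ : ℤ → List Letter
encodeℤ (+ n)    = encodeℕ n
encodeℤ -[1+ n ] = minus ∷ encodeℕ (suc n)

encodeVertex : Vertex → List Letter
encodeVertex (x , y , z) = encodeℤ x ++ encodeℤ y ++ encodeℤ z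

-- The code of P consists of nx * ny * nz numbers, so no separator is needed.
encode : PeriodicFinite → List Letter
encode c =
  encodeℕ nx ++ encodeℕ ny ++ encodeℕ nz ++
  concatMap (λ v → encodeℤ (P v)) box ++
  concatMap (λ v → encodeVertex v ++ encodeℕ (F v)) support
  where open PeriodicFinite c

data Symbol (A : Set) (m : ℕ) : Set where
  blank : Symbol A m
  input : A → Symbol A m
  work  : Fin m → Symbol A m

data Control (k : ℕ) : Set where
  state  : Fin k → Control k
  halted : Bool → Control k

data Direction : Set where
  left right : Direction

-- A deterministic machine with a single tape, infinite in both directions.
-- A must be finite for δ to be a finite table.
record TuringMachine (A : Set) : Set where
  field
    #states       : ℕ
    #work-symbols : ℕ
    start         : Control #states
    δ             : Fin #states → Symbol A #work-symbols →
                    Control #states × Symbol A #work-symbols × Direction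

-- Both sides are listed outwards from the head; unlisted cells are blank.
record Tape (A : Set) (m : ℕ) : Set where
  constructor ⟨_,_,_⟩
  field
    leftward  : List (Symbol A m)
    scanned   : Symbol A m
    rightward : List (Symbol A m)

focus : ∀ {A m} → List (Symbol A m) → Symbol A m × List (Symbol A m)
focus []       = blank , []
focus (a ∷ as) = a , as

move : ∀ {A m} → Direction → Tape A m → Tape A m
move left  ⟨ ls , a , rs ⟩ = let b , ls′ = focus ls in ⟨ ls′ , b , a ∷ rs ⟩
move right ⟨ ls , a , rs ⟩ = let b , rs′ = focus rs in ⟨ a ∷ ls , b , rs′ ⟩

module _ {A : Set} (M : TuringMachine A) where
  open TuringMachine M

  Configuration : Set
  Configuration = Control #states × Tape A #work-symbols

  step : Configuration → Configuration
  step (halted b , tape)           = halted b , tape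
  step (state q , ⟨ ls , a , rs ⟩) =
    let q′ , a′ , d = δ q a in q′ , move d ⟨ ls , a′ , rs ⟩

  initial : List A → Configuration
  initial w = let a , rs = focus (map input w) in start , ⟨ [] , a , rs ⟩

  run : List A → ℕ → Configuration
  run w zero    = initial w
  run w (suc t) = step (run w t)

  HaltsWith : List A → Bool → Set
  HaltsWith w b = ∃[ t ] ∃[ tape ] run w t ≡ (halted b , tape)

Decides : {A X : Set} → TuringMachine A → (X → List A) → (X → Set) → Set
Decides M code Q = ∀ x → ∃[ b ] HaltsWith M (code x) b × (b ≡ true ⇔ Q x)

{-# OPTIONS --safe #-}
module Submission where

-- Every vertex of the piles below topples at most once, as soon as 0, 1 or 2 of
-- its neighbours have toppled, or never: toppling is the evaluation of a circuit
-- of wires, gates and walls.  A periodic circuit that has the y-axis as time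
-- simulates a one-tape machine, whose input is injected by added chips, one at a
-- time; if the machine rejects, a wire that runs through the whole lattice makes
-- the origin topple.  Given a decider M, take the machine that on input h
-- writes down h followed by the code of the chips that inject h, and then runs M.
-- If h is the code of its own periodic background, then M is run on the code of
-- the very pile that simulates it, and the origin topples if and only if M
-- denies that it does.

-- Toppling is monotone and undirected: there is no negation, and a wire conducts both ways.
-- Monotonicity is met by giving every state of every cell an atom of its own and turning each
-- transition into a Horn clause, so that conjunction is the only operation. Backward flow does no
-- harm along a row, because a row carries the conjunction of what it has read so far and a longer
-- conjunction implies the shorter ones. It would do harm from an atom into the several rows that
-- can write it; there a gate of threshold two acts as a diode. Correctness becomes a pair of
-- closure statements: whatever topples in a legal sequence lies in every set closed under the
-- threshold rules, and what topples in a complete sequence is itself closed under them. The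
-- self-reference is that of Kleene's recursion theorem. It is possible because the background
-- depends on `M` alone, while `h` enters only through the added chips: `h` can be chosen after the
-- background is fixed.

open import Algebra.Properties.AbelianGroup using (∙-cancelʳ)
open import Data.Bool using (Bool; true; false; if_then_else_)
open import Data.Empty using (⊥; ⊥-elim)
open import Data.Fin using (Fin)
open import Data.Integer as ℤ using (ℤ; +_; -[1+_])
open import Data.Integer.Divisibility.Signed using (divides; ∣ᵤ⇒∣)
open import Data.Integer.DivMod using (_%ℕ_; _/ℕ_; n%ℕd<d; a≡a%ℕn+[a/ℕn]*n)
import Data.Integer.Properties as ℤₚ
import Data.Integer.Tactic.RingSolver as ℤ-solver
open import Data.List
  using (List; []; _∷_; _++_; _ʳ++_; map; concatMap; replicate; length; upTo; allFin; cartesianProduct)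
import Data.List.Membership.DecPropositional as DecMembership
open import Data.List.Membership.Propositional using (_∈_; _∉_; lose; find)
import Data.List.Membership.Propositional.Properties as ∈ₚ
import Data.List.Properties as Lₚ
open import Data.List.Relation.Unary.All as All using (All; []; _∷_)
import Data.List.Relation.Unary.All.Properties as Allₚ
open import Data.List.Relation.Unary.AllPairs using ([]; _∷_)
open import Data.List.Relation.Unary.Any using (here; there)
open import Data.List.Relation.Unary.Unique.Propositional using (Unique)
open import Data.Maybe using (Maybe; just; nothing; maybe′)
open import Data.Maybe.Properties using (just-injective)
open import Data.Nat as ℕ using (ℕ; zero; suc; NonZero; _+_; _*_; _≤_; _<_; z≤n; s≤s; _⊔_)
import Data.Nat.DivMod as ℕ%
import Data.Nat.Properties as ℕₚ
import Data.Nat.Tactic.RingSolver as ℕ-solver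
open import Data.Product using (∃-syntax; _×_; _,_; proj₁; proj₂; uncurry)
open import Data.Sum using (_⊎_; inj₁; inj₂)
open import Data.Sum.Properties using (inj₂-injective)
open import Data.Unit using (⊤)
open import Function using (_∘_; id; _⇔_; mk⇔; Equivalence)
open import Relation.Binary.Definitions using (tri<; tri≈; tri>)
open import Relation.Binary.PropositionalEquality
open import Relation.Nullary using (¬_; Dec; yes; no; does; contradiction)
open import Relation.Nullary.Decidable using (dec-true; dec-false)
open import Defs

open DecMembership _≟ᵛ_ using (_∈?_)

-- Counting chips

data Dir : Set where
  x⁺ x⁻ y⁺ y⁻ z⁺ z⁻ : Dir

nbr : Dir → Vertex → Vertex
nbr x⁺ (x , y , z) = ℤ.suc x , y , z
nbr x⁻ (x , y , z) = ℤ.pred x , y , z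
nbr y⁺ (x , y , z) = x , ℤ.suc y , z
nbr y⁻ (x , y , z) = x , ℤ.pred y , z
nbr z⁺ (x , y , z) = x , y , ℤ.suc z
nbr z⁻ (x , y , z) = x , y , ℤ.pred z

op : Dir → Dir
op x⁺ = x⁻
op x⁻ = x⁺
op y⁺ = y⁻
op y⁻ = y⁺
op z⁺ = z⁻
op z⁻ = z⁺

nbr-op : ∀ d v → nbr (op d) (nbr d v) ≡ v
nbr-op x⁺ (x , _) = cong (_, _) (ℤₚ.pred-suc x)
nbr-op x⁻ (x , _) = cong (_, _) (ℤₚ.suc-pred x)
nbr-op y⁺ (_ , y , _) = cong (λ a → _ , a , _) (ℤₚ.pred-suc y)
nbr-op y⁻ (_ , y , _) = cong (λ a → _ , a , _) (ℤₚ.suc-pred y)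
nbr-op z⁺ (_ , _ , z) = cong (λ a → _ , _ , a) (ℤₚ.pred-suc z)
nbr-op z⁻ (_ , _ , z) = cong (λ a → _ , _ , a) (ℤₚ.suc-pred z)

-- A left inverse of `nbr` on the difference of the two vertices. It settles that the six neighbours
-- are distinct by one computation per direction instead of one per pair.
direction : Vertex → Maybe Dir
direction (+ 1      , _        , _       ) = just x⁺
direction (-[1+ 0 ] , _        , _       ) = just x⁻
direction (_        , + 1      , _       ) = just y⁺
direction (_        , -[1+ 0 ] , _       ) = just y⁻
direction (_        , _        , + 1     ) = just z⁺
direction (_        , _        , -[1+ 0 ]) = just z⁻
direction _                                = nothing

difference : Vertex → Vertex → Vertex
difference (x , y , z) (x′ , y′ , z′) = x ℤ.- x′ , y ℤ.- y′ , z ℤ.- z′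

private
  suc-x-x : ∀ x → ℤ.suc x ℤ.- x ≡ + 1
  suc-x-x x = trans (ℤₚ.+-assoc (+ 1) x (ℤ.- x)) (cong (ℤ._+_ (+ 1)) (ℤₚ.+-inverseʳ x))

  pred-x-x : ∀ x → ℤ.pred x ℤ.- x ≡ -[1+ 0 ]
  pred-x-x x = trans (ℤₚ.+-assoc -[1+ 0 ] x (ℤ.- x)) (cong (ℤ._+_ -[1+ 0 ]) (ℤₚ.+-inverseʳ x))

direction-nbr : ∀ d v → direction (difference (nbr d v) v) ≡ just d
direction-nbr x⁺ (x , y , z) rewrite suc-x-x x = refl
direction-nbr x⁻ (x , y , z) rewrite pred-x-x x = refl
direction-nbr y⁺ (x , y , z) rewrite ℤₚ.+-inverseʳ x | suc-x-x y = refl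
direction-nbr y⁻ (x , y , z) rewrite ℤₚ.+-inverseʳ x | pred-x-x y = refl
direction-nbr z⁺ (x , y , z) rewrite ℤₚ.+-inverseʳ x | ℤₚ.+-inverseʳ y | suc-x-x z = refl
direction-nbr z⁻ (x , y , z) rewrite ℤₚ.+-inverseʳ x | ℤₚ.+-inverseʳ y | pred-x-x z = refl

direction-self : ∀ v → direction (difference v v) ≡ nothing
direction-self (x , y , z)
  rewrite ℤₚ.+-inverseʳ x | ℤₚ.+-inverseʳ y | ℤₚ.+-inverseʳ z = refl

nbr-injective : ∀ {d d′} v → nbr d v ≡ nbr d′ v → d ≡ d′
nbr-injective {d} {d′} v eq
  with refl ← trans (sym (direction-nbr d v))
                (trans (cong (λ w → direction (difference w v)) eq) (direction-nbr d′ v)) = refl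

nbr-≢ : ∀ d v → nbr d v ≢ v
nbr-≢ d v eq
  with () ← trans (sym (direction-nbr d v))
              (trans (cong (λ w → direction (difference w v)) eq) (direction-self v))

∈-neighbours⁺ : ∀ d v → nbr d v ∈ neighbours v
∈-neighbours⁺ x⁺ v = here refl
∈-neighbours⁺ x⁻ v = there (here refl)
∈-neighbours⁺ y⁺ v = there (there (here refl))
∈-neighbours⁺ y⁻ v = there (there (there (here refl)))
∈-neighbours⁺ z⁺ v = there (there (there (there (here refl))))
∈-neighbours⁺ z⁻ v = there (there (there (there (there (here refl)))))

∈-neighbours⁻ : ∀ {w v} → w ∈ neighbours v → ∃[ d ] w ≡ nbr d v
∈-neighbours⁻ (here e) = x⁺ , e
∈-neighbours⁻ (there (here e)) = x⁻ , e
∈-neighbours⁻ (there (there (here e))) = y⁺ , e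
∈-neighbours⁻ (there (there (there (here e)))) = y⁻ , e
∈-neighbours⁻ (there (there (there (there (here e))))) = z⁺ , e
∈-neighbours⁻ (there (there (there (there (there (here e)))))) = z⁻ , e

∑ : (Dir → ℕ) → ℕ
∑ f = f x⁺ + (f x⁻ + (f y⁺ + (f y⁻ + (f z⁺ + f z⁻))))

∑-cong : ∀ {f g} → (∀ d → f d ≡ g d) → ∑ f ≡ ∑ g
∑-cong eq = cong₂ _+_ (eq x⁺) (cong₂ _+_ (eq x⁻) (cong₂ _+_ (eq y⁺)
  (cong₂ _+_ (eq y⁻) (cong₂ _+_ (eq z⁺) (eq z⁻)))))

∑-+ : ∀ f g → ∑ (λ d → f d + g d) ≡ ∑ f + ∑ g
∑-+ f g = lemma (f x⁺) (g x⁺) (f x⁻) (g x⁻) (f y⁺) (g y⁺) (f y⁻) (g y⁻) (f z⁺) (g z⁺) (f z⁻) (g z⁻)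
  where
  lemma : ∀ a a′ b b′ c c′ d d′ e e′ f f′ →
    (a + a′) + ((b + b′) + ((c + c′) + ((d + d′) + ((e + e′) + (f + f′))))) ≡
    (a + (b + (c + (d + (e + f))))) + (a′ + (b′ + (c′ + (d′ + (e′ + f′)))))
  lemma = ℕ-solver.solve-∀

infix 4 _≟ᵈ_
_≟ᵈ_ : (d d′ : Dir) → Dec (d ≡ d′)
d ≟ᵈ d′ with nbr d origin ≟ᵛ nbr d′ origin
... | yes e = yes (nbr-injective origin e)
... | no ¬e = no λ e → ¬e (cong (λ d → nbr d origin) e)

update : Dir → (Dir → ℕ) → Dir → ℕ
update d f e = if does (d ≟ᵈ e) then 0 else f e

∑-update : ∀ d f → ∑ f ≡ f d + ∑ (update d f)
∑-update x⁺ f = refl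
∑-update x⁻ f = lemma (f x⁺) (f x⁻) _
  where lemma : ∀ a b c → a + (b + c) ≡ b + (a + c)
        lemma = ℕ-solver.solve-∀
∑-update y⁺ f = lemma (f x⁺) (f x⁻) (f y⁺) _
  where lemma : ∀ a b c d → a + (b + (c + d)) ≡ c + (a + (b + d))
        lemma = ℕ-solver.solve-∀
∑-update y⁻ f = lemma (f x⁺) (f x⁻) (f y⁺) (f y⁻) _
  where lemma : ∀ a b c d e → a + (b + (c + (d + e))) ≡ d + (a + (b + (c + e)))
        lemma = ℕ-solver.solve-∀
∑-update z⁺ f = lemma (f x⁺) (f x⁻) (f y⁺) (f y⁻) (f z⁺) (f z⁻)
  where lemma : ∀ a b c d e g → a + (b + (c + (d + (e + g)))) ≡ e + (a + (b + (c + (d + g))))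
        lemma = ℕ-solver.solve-∀
∑-update z⁻ f = lemma (f x⁺) (f x⁻) (f y⁺) (f y⁻) (f z⁺) (f z⁻)
  where lemma : ∀ a b c d e g → a + (b + (c + (d + (e + g)))) ≡ g + (a + (b + (c + (d + (e + 0)))))
        lemma = ℕ-solver.solve-∀

term≤∑ : ∀ f d → f d ≤ ∑ f
term≤∑ f d = subst (f d ≤_) (sym (∑-update d f)) (ℕₚ.m≤m+n (f d) _)

update-same : ∀ d f → update d f d ≡ 0
update-same d f rewrite dec-true (d ≟ᵈ d) refl = refl

update-other : ∀ {d e} f → d ≢ e → update d f e ≡ f e
update-other {d} {e} f d≢e rewrite dec-false (d ≟ᵈ e) d≢e = refl

∑-zero : ∀ {f} → (∀ d → f d ≡ 0) → ∑ f ≡ 0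
∑-zero = ∑-cong

1≤∑⇒ : ∀ f → 1 ≤ ∑ f → ∃[ d ] 1 ≤ f d
1≤∑⇒ f 1≤ with f x⁺ in e₁ | f x⁻ in e₂ | f y⁺ in e₃ | f y⁻ in e₄ | f z⁺ in e₅ | f z⁻ in e₆
... | suc _ | _ | _ | _ | _ | _ = x⁺ , subst (1 ≤_) (sym e₁) (s≤s z≤n)
... | zero | suc _ | _ | _ | _ | _ = x⁻ , subst (1 ≤_) (sym e₂) (s≤s z≤n)
... | zero | zero | suc _ | _ | _ | _ = y⁺ , subst (1 ≤_) (sym e₃) (s≤s z≤n)
... | zero | zero | zero | suc _ | _ | _ = y⁻ , subst (1 ≤_) (sym e₄) (s≤s z≤n)
... | zero | zero | zero | zero | suc _ | _ = z⁺ , subst (1 ≤_) (sym e₅) (s≤s z≤n)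
... | zero | zero | zero | zero | zero | suc _ = z⁻ , subst (1 ≤_) (sym e₆) (s≤s z≤n)
1≤∑⇒ f () | zero | zero | zero | zero | zero | zero

2≤∑⇒ : ∀ f → (∀ d → f d ≤ 1) → 2 ≤ ∑ f → ∃[ d ] ∃[ d′ ] d ≢ d′ × 1 ≤ f d × 1 ≤ f d′
2≤∑⇒ f f≤1 2≤ with 1≤∑⇒ f (ℕₚ.≤-trans (s≤s z≤n) 2≤)
... | d , 1≤fd with 1≤∑⇒ (update d f)
      (ℕₚ.+-cancelˡ-≤ 1 1 _ (ℕₚ.≤-trans 2≤ (ℕₚ.≤-trans (ℕₚ.≤-reflexive (∑-update d f))
        (ℕₚ.+-monoˡ-≤ _ (f≤1 d)))))
... | d′ , 1≤ with d ≟ᵈ d′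
... | yes refl = contradiction 1≤ λ ()
... | no d≢d′ = d , d′ , d≢d′ , 1≤fd , 1≤

∑≤6 : ∀ f → (∀ d → f d ≤ 1) → ∑ f ≤ 6
∑≤6 f f≤1 = ℕₚ.+-mono-≤ (f≤1 x⁺) (ℕₚ.+-mono-≤ (f≤1 x⁻) (ℕₚ.+-mono-≤ (f≤1 y⁺)
  (ℕₚ.+-mono-≤ (f≤1 y⁻) (ℕₚ.+-mono-≤ (f≤1 z⁺) (f≤1 z⁻)))))

-- Raising the value at `d` from 0 to 1 keeps every term at most one and adds one to the sum, to
-- which `∑≤6` applies.
∑≤5 : ∀ f d → (∀ d → f d ≤ 1) → f d ≡ 0 → ∑ f ≤ 5
∑≤5 f d f≤1 fd≡0 = ℕₚ.+-cancelˡ-≤ 1 _ _ (begin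
  1 + ∑ f                ≡⟨ cong suc (trans (∑-update d f) (cong (_+ ∑ (update d f)) fd≡0)) ⟩
  1 + ∑ (update d f)     ≡⟨ cong₂ _+_ (sym g-d) (∑-cong upd) ⟩
  g d + ∑ (update d g)   ≡⟨ ∑-update d g ⟨
  ∑ g                    ≤⟨ ∑≤6 g g≤1 ⟩
  6                      ∎)
  where
  open ℕₚ.≤-Reasoning
  g : Dir → ℕ
  g e = if does (d ≟ᵈ e) then 1 else f e
  g≤1 : ∀ e → g e ≤ 1
  g≤1 e with does (d ≟ᵈ e)
  ... | true = ℕₚ.≤-refl
  ... | false = f≤1 e
  g-d : g d ≡ 1
  g-d rewrite dec-true (d ≟ᵈ d) refl = refl
  upd : ∀ e → update d f e ≡ update d g e
  upd e with does (d ≟ᵈ e)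
  ... | true = refl
  ... | false = refl

two≤∑ : ∀ f {d d′} → d ≢ d′ → 1 ≤ f d → 1 ≤ f d′ → 2 ≤ ∑ f
two≤∑ f {d} {d′} d≢d′ 1≤ 1≤′ = ℕₚ.≤-trans
  (ℕₚ.+-mono-≤ 1≤ (ℕₚ.≤-trans (subst (1 ≤_) (sym (update-other f d≢d′)) 1≤′) (term≤∑ (update d f) d′)))
  (ℕₚ.≤-reflexive (sym (∑-update d f)))

δᵛ : Vertex → Vertex → ℕ
δᵛ w v = if does (w ≟ᵛ v) then 1 else 0

δᵛ-≡ : ∀ {w v} → w ≡ v → δᵛ w v ≡ 1
δᵛ-≡ {w} {v} e rewrite dec-true (w ≟ᵛ v) e = refl

δᵛ-≢ : ∀ {w v} → w ≢ v → δᵛ w v ≡ 0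
δᵛ-≢ {w} {v} e rewrite dec-false (w ≟ᵛ v) e = refl

topple-self : ∀ w S → topple w S w ≡ S w ℤ.- + 6
topple-self w S rewrite dec-true (w ≟ᵛ w) refl = refl

topple-near : ∀ {v w} S → v ≢ w → v ∈ neighbours w → topple w S v ≡ S v ℤ.+ + 1
topple-near {v} {w} S v≢w v∈
  rewrite dec-false (v ≟ᵛ w) v≢w | dec-true (v ∈? neighbours w) v∈ = refl

topple-far : ∀ {v w} S → v ≢ w → v ∉ neighbours w → topple w S v ≡ S v
topple-far {v} {w} S v≢w v∉
  rewrite dec-false (v ≟ᵛ w) v≢w | dec-false (v ∈? neighbours w) v∉ = refl

-- The Laplacian of one toppling. Loss and gain stand on opposite sides, so that both are natural
-- numbers and the three cases of `topple` become one equation that can be summed.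
topple-chips : ∀ w S v →
  topple w S v ℤ.+ + (6 * δᵛ w v) ≡ S v ℤ.+ + ∑ (λ d → δᵛ w (nbr d v))
topple-chips w S v = go (v ≟ᵛ w) (v ∈? neighbours w)
  where
  open ≡-Reasoning
  n = ∑ (λ d → δᵛ w (nbr d v))
  go : Dec (v ≡ w) → Dec (v ∈ neighbours w) → topple w S v ℤ.+ + (6 * δᵛ w v) ≡ S v ℤ.+ + n
  go (yes refl) _ = begin
    topple v S v ℤ.+ + (6 * δᵛ v v)  ≡⟨ cong₂ (λ c m → c ℤ.+ + (6 * m)) (topple-self v S) (δᵛ-≡ {v} refl) ⟩
    S v ℤ.- + 6 ℤ.+ + 6              ≡⟨ ℤₚ.+-assoc (S v) (ℤ.- + 6) (+ 6) ⟩
    S v ℤ.+ + 0                      ≡⟨ cong (λ m → S v ℤ.+ + m) (∑-zero λ d → δᵛ-≢ (nbr-≢ d v ∘ sym)) ⟨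
    S v ℤ.+ + n                      ∎
  go (no v≢w) (yes v∈) with d , e ← ∈-neighbours⁻ v∈ = begin
    topple w S v ℤ.+ + (6 * δᵛ w v)  ≡⟨ cong₂ (λ c m → c ℤ.+ + (6 * m)) (topple-near S v≢w v∈) (δᵛ-≢ (v≢w ∘ sym)) ⟩
    S v ℤ.+ + 1 ℤ.+ + 0              ≡⟨ ℤₚ.+-identityʳ _ ⟩
    S v ℤ.+ + 1                      ≡⟨ cong (λ m → S v ℤ.+ + m) (single d e) ⟨
    S v ℤ.+ + n                      ∎
    where
    single : ∀ d → v ≡ nbr d w → n ≡ 1
    -- Among the neighbours of `v`, only the one in direction `op d` is `w`.
    single d refl = trans (∑-update (op d) f) (cong₂ _+_ (δᵛ-≡ (sym (nbr-op d w))) (∑-zero rest))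
      where
      f : Dir → ℕ
      f e = δᵛ w (nbr e v)
      rest : ∀ e → update (op d) f e ≡ 0
      rest e = rest′ (op d ≟ᵈ e)
        where
        rest′ : Dec (op d ≡ e) → update (op d) f e ≡ 0
        rest′ (yes refl) = update-same (op d) f
        rest′ (no ¬e) = trans (update-other f ¬e)
          (δᵛ-≢ λ eq → ¬e (nbr-injective v (trans (nbr-op d w) eq)))
  go (no v≢w) (no v∉) = begin
    topple w S v ℤ.+ + (6 * δᵛ w v)  ≡⟨ cong₂ (λ c m → c ℤ.+ + (6 * m)) (topple-far S v≢w v∉) (δᵛ-≢ (v≢w ∘ sym)) ⟩
    S v ℤ.+ + 0                      ≡⟨ cong (λ m → S v ℤ.+ + m) (∑-zero λ d → δᵛ-≢ λ e → v∉
                                          (subst (_∈ neighbours w) (nbr-op d v)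
                                            (subst (λ u → nbr (op d) u ∈ neighbours w) e (∈-neighbours⁺ (op d) w)))) ⟨
    S v ℤ.+ + n                      ∎

-- The conservation law of sandpiles: the current pile is the initial one plus the discrete
-- Laplacian of the counts. Stability can hence be read off the counts of a vertex and its
-- neighbours, whatever the order of the topplings.
after-chips : ∀ S s t v →
  after S s t v ℤ.+ + (6 * occurrences s v t) ≡ S v ℤ.+ + ∑ (λ d → occurrences s (nbr d v) t)
after-chips S s zero v = refl
after-chips S s (suc t) v with term s t
... | nothing = after-chips S s t v
... | just w = begin
  topple w A v ℤ.+ + (6 * (δᵛ w v + o))               ≡⟨ cong (λ n → topple w A v ℤ.+ + n) (ℕₚ.*-distribˡ-+ 6 (δᵛ w v) o) ⟩
  topple w A v ℤ.+ (+ (6 * δᵛ w v) ℤ.+ + (6 * o))     ≡⟨ ℤₚ.+-assoc (topple w A v) _ _ ⟨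
  topple w A v ℤ.+ + (6 * δᵛ w v) ℤ.+ + (6 * o)       ≡⟨ cong (ℤ._+ + (6 * o)) (topple-chips w A v) ⟩
  A v ℤ.+ + n₁ ℤ.+ + (6 * o)                          ≡⟨ ℤₚ.+-assoc (A v) _ _ ⟩
  A v ℤ.+ (+ n₁ ℤ.+ + (6 * o))                        ≡⟨ cong (ℤ._+_ (A v)) (ℤₚ.+-comm (+ n₁) (+ (6 * o))) ⟩
  A v ℤ.+ (+ (6 * o) ℤ.+ + n₁)                        ≡⟨ ℤₚ.+-assoc (A v) _ _ ⟨
  A v ℤ.+ + (6 * o) ℤ.+ + n₁                          ≡⟨ cong (ℤ._+ + n₁) (after-chips S s t v) ⟩
  S v ℤ.+ + n₂ ℤ.+ + n₁                               ≡⟨ ℤₚ.+-assoc (S v) _ _ ⟩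
  S v ℤ.+ + (n₂ + n₁)                                 ≡⟨ cong (λ n → S v ℤ.+ + n) (trans (ℕₚ.+-comm n₂ n₁) (sym (∑-+ (λ d → δᵛ w (nbr d v)) (λ d → occurrences s (nbr d v) t)))) ⟩
  S v ℤ.+ + ∑ (λ d → δᵛ w (nbr d v) + occurrences s (nbr d v) t) ∎
  where
  open ≡-Reasoning
  A = after S s t
  o = occurrences s v t
  n₁ = ∑ (λ d → δᵛ w (nbr d v))
  n₂ = ∑ (λ d → occurrences s (nbr d v) t)

occurrences-mono : ∀ s v {t t′} → t ≤ t′ → occurrences s v t ≤ occurrences s v t′
occurrences-mono s v {t} {t′} t≤t′ with ℕₚ.m≤n⇒∃[o]m+o≡n t≤t′
... | k , refl = go k
  where
  go : ∀ k → occurrences s v t ≤ occurrences s v (t + k)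
  go zero = ℕₚ.≤-reflexive (cong (occurrences s v) (sym (ℕₚ.+-identityʳ t)))
  go (suc k) rewrite ℕₚ.+-suc t k = ℕₚ.m≤n⇒m≤o+n (maybe′ (λ w → δᵛ w v) 0 (term s (t + k))) (go k)

-- Piles as threshold circuits

data Kind : Set where
  wall wire gate source : Kind

-- The number of neighbours whose toppling makes a vertex unstable.
threshold : Kind → ℕ
threshold wall   = 7
threshold wire   = 1
threshold gate   = 2
threshold source = 0

-- A wall gets -1 chips: even if all six neighbours topple once, it ends with five.
chips : Kind → ℤ
chips k = + 6 ℤ.- + threshold k

module Percolation (S : Sandpile) (kind : Vertex → Kind) (S≡ : ∀ v → S v ≡ chips (kind v)) where

  -- Adding the threshold cancels the initial pile, so that instability becomes an inequality
  -- between counts alone, the form in which `unstable⇒` and `⇒unstable` use it.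
  balance : ∀ s t v → after S s t v ℤ.+ + (6 * occurrences s v t + threshold (kind v)) ≡
    + (6 + ∑ (λ d → occurrences s (nbr d v) t))
  balance s t v = begin
    a ℤ.+ (+ o ℤ.+ + k)                      ≡⟨ ℤₚ.+-assoc a _ _ ⟨
    a ℤ.+ + o ℤ.+ + k                        ≡⟨ cong (ℤ._+ + k) (after-chips S s t v) ⟩
    S v ℤ.+ + n ℤ.+ + k                      ≡⟨ cong (λ c → c ℤ.+ + n ℤ.+ + k) (S≡ v) ⟩
    + 6 ℤ.+ ℤ.- + k ℤ.+ + n ℤ.+ + k          ≡⟨ ℤₚ.+-assoc (+ 6 ℤ.+ ℤ.- + k) (+ n) (+ k) ⟩
    + 6 ℤ.+ ℤ.- + k ℤ.+ (+ n ℤ.+ + k)        ≡⟨ cong (ℤ._+_ (+ 6 ℤ.+ ℤ.- + k)) (ℤₚ.+-comm (+ n) (+ k)) ⟩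
    + 6 ℤ.+ ℤ.- + k ℤ.+ (+ k ℤ.+ + n)        ≡⟨ ℤₚ.+-assoc (+ 6) (ℤ.- + k) _ ⟩
    + 6 ℤ.+ (ℤ.- + k ℤ.+ (+ k ℤ.+ + n))      ≡⟨ cong (ℤ._+_ (+ 6)) (ℤₚ.+-assoc (ℤ.- + k) (+ k) (+ n)) ⟨
    + 6 ℤ.+ (ℤ.- + k ℤ.+ + k ℤ.+ + n)        ≡⟨ cong (λ c → + 6 ℤ.+ (c ℤ.+ + n)) (ℤₚ.+-inverseˡ (+ k)) ⟩
    + 6 ℤ.+ (+ 0 ℤ.+ + n)                    ≡⟨⟩
    + (6 + n)                                ∎
    where
    open ≡-Reasoning
    a = after S s t v
    o = 6 * occurrences s v t
    k = threshold (kind v)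
    n = ∑ (λ d → occurrences s (nbr d v) t)

  unstable⇒ : ∀ s t v → Unstable (after S s t) v →
    6 * occurrences s v t + threshold (kind v) ≤ ∑ (λ d → occurrences s (nbr d v) t)
  unstable⇒ s t v u = ℕₚ.+-cancelˡ-≤ 6 _ _ (ℤₚ.drop‿+≤+ (subst (+ (6 + m) ℤ.≤_) (balance s t v)
    (ℤₚ.+-monoˡ-≤ (+ m) u)))
    where m = 6 * occurrences s v t + threshold (kind v)

  ⇒unstable : ∀ s t v →
    6 * occurrences s v t + threshold (kind v) ≤ ∑ (λ d → occurrences s (nbr d v) t) →
    Unstable (after S s t) v
  ⇒unstable s t v m≤ with + 6 ℤₚ.≤? after S s t v
  ... | yes u = u
  ... | no ¬u = contradiction (ℤₚ.drop‿+<+ (subst (ℤ._< + (6 + m)) (balance s t v)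
      (ℤₚ.+-monoˡ-< (+ m) (ℤₚ.≰⇒> ¬u)))) (ℕₚ.≤⇒≯ (ℕₚ.+-monoʳ-≤ 6 m≤))
    where m = 6 * occurrences s v t + threshold (kind v)

  -- The upper bound on a legal sequence; `Fired` may be any set closed under the threshold rules. A
  -- source needs a wall beside it, for if all six neighbours toppled it would regain six chips and
  -- topple again.
  module Sound
    (Fired : Vertex → Set)
    (source-fired : ∀ v → kind v ≡ source → Fired v)
    (wire-fired : ∀ v d → kind v ≡ wire → Fired (nbr d v) → Fired v)
    (gate-fired : ∀ v d d′ → kind v ≡ gate → d ≢ d′ → Fired (nbr d v) → Fired (nbr d′ v) → Fired v)
    (source-wall : ∀ v → kind v ≡ source → ∃[ d ] kind (nbr d v) ≡ wall)
    (s : TopplingSequence) (legal : Legal S s) where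

    record Invariant (n : ℕ) (v : Vertex) : Set where
      field
        once  : n ≤ 1
        fired : 1 ≤ n → Fired v
        never : kind v ≡ wall → n ≡ 0
    open Invariant

    module _ (t : ℕ) (inv : ∀ v → Invariant (occurrences s v t) v) {w} (u : Unstable (after S s t) w) where
      private
        o : Vertex → ℕ
        o v = occurrences s v t
        n = ∑ (λ d → o (nbr d w))
        enough : 6 * o w + threshold (kind w) ≤ ∑ (λ d → o (nbr d w))
        enough = unstable⇒ s t w u
        ≤6 : ∑ (λ d → o (nbr d w)) ≤ 6
        ≤6 = ∑≤6 _ λ d → once (inv (nbr d w))

      not-wall : kind w ≢ wall
      not-wall eq = ℕₚ.<⇒≱ {6} ℕₚ.≤-refl (ℕₚ.≤-trans (ℕₚ.m≤n+m 7 (6 * o w))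
        (ℕₚ.≤-trans (subst (λ k → 6 * o w + threshold k ≤ n) eq enough) ≤6))

      -- A second toppling takes 6 plus the threshold topplings of the neighbours, and six
      -- neighbours offer one each. Only a source has threshold 0, and it loses one neighbour to a
      -- wall.
      not-toppled : o w ≡ 0
      not-toppled with o w | once (inv w) | enough
      ... | zero | _ | _ = refl
      ... | suc zero | _ | ≤∑ with kind w in eq
      ...   | wall = ⊥-elim (not-wall eq)
      ...   | wire = contradiction (ℕₚ.≤-trans ≤∑ ≤6) (ℕₚ.<⇒≱ ℕₚ.≤-refl)
      ...   | gate = contradiction (ℕₚ.≤-trans (ℕₚ.≤-trans (ℕₚ.n≤1+n 7) ≤∑) ≤6) (ℕₚ.<⇒≱ ℕₚ.≤-refl)
      ...   | source with d , isWall ← source-wall w eq =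
        contradiction (ℕₚ.≤-trans ≤∑ (∑≤5 (λ d → o (nbr d w)) d (λ d → once (inv (nbr d w))) (never (inv (nbr d w)) isWall)))
          (ℕₚ.<⇒≱ ℕₚ.≤-refl)
      not-toppled | suc (suc _) | s≤s () | _

      toppled-fired : Fired w
      toppled-fired with kind w in eq | subst (λ m → 6 * m + threshold (kind w) ≤ n) not-toppled enough
      ... | wall | _ = ⊥-elim (not-wall eq)
      ... | source | _ = source-fired w eq
      ... | wire | 1≤ with d , 1≤d ← 1≤∑⇒ (λ d → o (nbr d w)) 1≤ = wire-fired w d eq (fired (inv (nbr d w)) 1≤d)
      ... | gate | 2≤ with d , d′ , d≢d′ , 1≤d , 1≤d′ ← 2≤∑⇒ (λ d → o (nbr d w)) (λ d → once (inv (nbr d w))) 2≤ =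
        gate-fired w d d′ eq d≢d′ (fired (inv (nbr d w)) 1≤d) (fired (inv (nbr d′ w)) 1≤d′)

    invariant : ∀ t v → Invariant (occurrences s v t) v
    invariant zero v = record { once = z≤n ; fired = λ () ; never = λ _ → refl }
    invariant (suc t) v with term s t in eq
    ... | nothing = invariant t v
    ... | just w with u ← legal t w eq | w ≟ᵛ v
    ...   | no _ = invariant t v
    ...   | yes refl = record
      { once  = s≤s (ℕₚ.≤-reflexive (not-toppled t (invariant t) u))
      ; fired = λ _ → toppled-fired t (invariant t) u
      ; never = λ isWall → ⊥-elim (not-wall t (invariant t) u isWall)
      }

    sound : ∀ {v} → 1 ≤#[ v ∈ s ] → Fired v
    sound {v} (t , 1≤) = fired (invariant t v) 1≤

  -- The lower bound: by completeness, the set of vertices that topple is closed under the threshold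
  -- rules.
  module Completion (s : TopplingSequence) (complete : Complete S s) where

    Topples : Vertex → Set
    Topples v = 1 ≤#[ v ∈ s ]

    topples : ∀ v t → threshold (kind v) ≤ ∑ (λ d → occurrences s (nbr d v) t) → Topples v
    topples v t ≤∑ with occurrences s v t in eq
    ... | suc _ = t , subst (1 ≤_) (sym eq) (s≤s z≤n)
    ... | zero with complete t v (⇒unstable s t v
                      (subst (λ n → 6 * n + threshold (kind v) ≤ ∑ (λ d → occurrences s (nbr d v) t)) (sym eq) ≤∑))
    ...   | t′ , _ , now = suc t′ , lemma
      where
      lemma : 1 ≤ occurrences s v (suc t′)
      lemma rewrite now | δᵛ-≡ {v} {v} refl = s≤s z≤n

    source-topples : ∀ v → kind v ≡ source → Topples v
    source-topples v eq = topples v 0 (subst (λ k → threshold k ≤ 0) (sym eq) z≤n)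

    wire-topples : ∀ v d → kind v ≡ wire → Topples (nbr d v) → Topples v
    wire-topples v d eq (t , 1≤) = topples v t (subst (λ k → threshold k ≤ ∑ (λ d → occurrences s (nbr d v) t)) (sym eq)
      (ℕₚ.≤-trans 1≤ (term≤∑ (λ d → occurrences s (nbr d v) t) d)))

    gate-topples : ∀ v d d′ → kind v ≡ gate → d ≢ d′ →
      Topples (nbr d v) → Topples (nbr d′ v) → Topples v
    gate-topples v d d′ eq d≢d′ (t , 1≤) (t′ , 1≤′) = topples v (t ⊔ t′)
      (subst (λ k → threshold k ≤ ∑ (λ d → occurrences s (nbr d v) (t ⊔ t′))) (sym eq) (two≤∑ (λ d → occurrences s (nbr d v) (t ⊔ t′)) d≢d′
        (ℕₚ.≤-trans 1≤ (occurrences-mono s _ (ℕₚ.m≤m⊔n t t′)))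
        (ℕₚ.≤-trans 1≤′ (occurrences-mono s _ (ℕₚ.m≤n⊔m t t′)))))

-- A legal complete toppling sequence

-- The vertices still to be proposed and the size of the next cube. The cubes grow and exhaust the
-- lattice, so that every vertex is proposed again and again.
Schedule : Set
Schedule = List Vertex × ℕ

integers : ℕ → List ℤ
integers m = concatMap (λ n → + n ∷ -[1+ n ] ∷ []) (upTo m)

cube : ℕ → List Vertex
cube m = cartesianProduct (integers m) (cartesianProduct (integers m) (integers m))

advance : Schedule → Schedule
advance (v ∷ vs , m) = vs , m
-- Refilling takes a step of its own, in which nothing is proposed and `choose` falls back on a
-- source.
advance ([] , m)     = cube m , suc m

schedule : ℕ → Schedule
schedule zero    = [] , 0
schedule (suc t) = advance (schedule t)

∈-integers : ∀ {m} i → ℤ.∣ i ∣ < m → i ∈ integers m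
∈-integers (+ n) n<m = ∈ₚ.∈-concatMap⁺ _ (lose (∈ₚ.∈-upTo⁺ n<m) (here refl))
∈-integers -[1+ n ] n<m = ∈ₚ.∈-concatMap⁺ _ (lose (∈ₚ.∈-upTo⁺ (ℕₚ.<-trans (ℕₚ.n<1+n n) n<m)) (there (here refl)))

size : Vertex → ℕ
size (x , y , z) = suc (ℤ.∣ x ∣ + (ℤ.∣ y ∣ + ℤ.∣ z ∣))

∈-cube : ∀ {m} v → size v ≤ m → v ∈ cube m
∈-cube (x , y , z) size≤m = ∈ₚ.∈-cartesianProduct⁺
  (∈-integers x (ℕₚ.≤-trans (s≤s (ℕₚ.m≤m+n _ _)) size≤m))
  (∈ₚ.∈-cartesianProduct⁺
    (∈-integers y (ℕₚ.≤-trans (s≤s (ℕₚ.m≤n⇒m≤o+n ℤ.∣ x ∣ (ℕₚ.m≤m+n _ _))) size≤m))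
    (∈-integers z (ℕₚ.≤-trans (s≤s (ℕₚ.m≤n⇒m≤o+n ℤ.∣ x ∣ (ℕₚ.m≤n+m _ ℤ.∣ y ∣))) size≤m)))

private
  exhausted : ∀ t vs m → schedule t ≡ (vs , m) → schedule (length vs + t) ≡ ([] , m)
  exhausted t [] m eq = eq
  exhausted t (v ∷ vs) m eq = subst (λ n → schedule n ≡ ([] , m)) (ℕₚ.+-suc (length vs) t)
    (exhausted (suc t) vs m (cong advance eq))

  scheduled-in : ∀ t vs m v → schedule t ≡ (vs , m) → v ∈ vs →
    ∃[ k ] ∃[ ws ] ∃[ n ] schedule (k + t) ≡ (v ∷ ws , n)
  scheduled-in t (_ ∷ vs) m v eq (here refl) = 0 , vs , m , eq
  scheduled-in t (_ ∷ vs) m v eq (there v∈)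
    with k , ws , n , eq′ ← scheduled-in (suc t) vs m v (cong advance eq) v∈ =
    suc k , ws , n , subst (λ j → schedule j ≡ (v ∷ ws , n)) (ℕₚ.+-suc k t) eq′

  refilled : ∀ n t → ∃[ k ] ∃[ m ] n ≤ m × schedule (k + t) ≡ ([] , m)
  refilled zero t = length (proj₁ (schedule t)) , _ , z≤n , exhausted t _ _ refl
  refilled (suc n) t with k , m , n≤m , eq ← refilled n t =
    length (cube m) + suc k , suc m , s≤s n≤m ,
    subst (λ j → schedule j ≡ ([] , suc m)) (sym (ℕₚ.+-assoc (length (cube m)) (suc k) t))
      (exhausted (suc k + t) (cube m) (suc m) (cong advance eq))

scheduled : ∀ v t → ∃[ k ] ∃[ ws ] ∃[ n ] schedule (k + t) ≡ (v ∷ ws , n)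
scheduled v t with k , m , size≤m , eq ← refilled (size v) t
  with j , ws , n , eq′ ← scheduled-in (suc k + t) (cube m) (suc m) v (cong advance eq) (∈-cube v size≤m) =
  j + suc k , ws , n , subst (λ i → schedule i ≡ (v ∷ ws , n)) (sym (ℕₚ.+-assoc j (suc k) t)) eq′

-- A fair schedule proposes the vertices; when the proposed vertex is stable, a
-- source that has not toppled yet is toppled instead.
module Existence (S : Sandpile) (kind : Vertex → Kind) (S≡ : ∀ v → S v ≡ chips (kind v))
  (fresh : (vs : List Vertex) → ∃[ v ] kind v ≡ source × v ∉ vs) where

  open Percolation S kind S≡

  choose : List Vertex → Sandpile → List Vertex → Vertex
  choose (v ∷ _) A vs with + 6 ℤₚ.≤? A v
  ... | yes _ = v
  ... | no  _ = proj₁ (fresh vs)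
  choose [] A vs = proj₁ (fresh vs)

  mutual
    history : ℕ → List Vertex
    history zero    = []
    history (suc t) = greedy t ∷ history t

    pile : ℕ → Sandpile
    pile zero    = S
    pile (suc t) = topple (greedy t) (pile t)

    greedy : ℕ → Vertex
    greedy t = choose (proj₁ (schedule t)) (pile t) (history t)

  greedily : TopplingSequence
  greedily = infinite greedy

  pile≡after : ∀ t → pile t ≡ after S greedily t
  pile≡after zero    = refl
  pile≡after (suc t) = cong (topple (greedy t)) (pile≡after t)

  ∉-history : ∀ v t → v ∉ history t → occurrences greedily v t ≡ 0
  ∉-history v zero    v∉ = refl
  ∉-history v (suc t) v∉ = cong₂ _+_ (δᵛ-≢ (v∉ ∘ here ∘ sym)) (∉-history v t (v∉ ∘ there))

  fresh-unstable : ∀ t → Unstable (pile t) (proj₁ (fresh (history t)))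
  fresh-unstable t with v , isSource , v∉ ← fresh (history t) =
    subst (λ A → Unstable A v) (sym (pile≡after t)) (⇒unstable greedily t v
      (subst₂ (λ o k → 6 * o + threshold k ≤ ∑ (λ d → occurrences greedily (nbr d v) t))
        (sym (∉-history v t v∉)) (sym isSource) z≤n))

  choose-unstable : ∀ vs A ws → Unstable A (proj₁ (fresh ws)) → Unstable A (choose vs A ws)
  choose-unstable [] A ws u = u
  choose-unstable (v ∷ _) A ws u with + 6 ℤₚ.≤? A v
  ... | yes u′ = u′
  ... | no  _  = u

  choose-first : ∀ v vs A ws → Unstable A v → choose (v ∷ vs) A ws ≡ v
  choose-first v vs A ws u with + 6 ℤₚ.≤? A v
  ... | yes _ = refl
  ... | no ¬u = contradiction u ¬u

  greedily-legal : Legal S greedily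
  greedily-legal t _ refl = subst (λ A → Unstable A (greedy t)) (pile≡after t)
    (choose-unstable (proj₁ (schedule t)) (pile t) (history t) (fresh-unstable t))

  -- Toppling elsewhere only adds chips, so an unstable vertex can wait until the schedule proposes
  -- it. This is why fairness gives completeness.
  unstable-persists : ∀ {v w} A → v ≢ w → Unstable A v → Unstable (topple w A) v
  unstable-persists {v} {w} A v≢w u with v ∈? neighbours w
  ... | yes v∈ = subst (+ 6 ℤ.≤_) (sym (topple-near A v≢w v∈)) (ℤₚ.≤-trans u (ℤₚ.i≤i+j (A v) (+ 1)))
  ... | no v∉  = subst (+ 6 ℤ.≤_) (sym (topple-far A v≢w v∉)) u

  wait : ∀ v t k → Unstable (pile t) v →
    (∃[ t′ ] t ≤ t′ × greedy t′ ≡ v) ⊎ Unstable (pile (k + t)) v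
  wait v t zero u = inj₂ u
  wait v t (suc k) u with wait v t k u
  ... | inj₁ done = inj₁ done
  ... | inj₂ u′ = next (v ≟ᵛ greedy (k + t))
    where
    next : Dec (v ≡ greedy (k + t)) →
      (∃[ t′ ] t ≤ t′ × greedy t′ ≡ v) ⊎ Unstable (pile (suc k + t)) v
    next (yes e) = inj₁ (k + t , ℕₚ.m≤n+m t k , sym e)
    next (no v≢) = inj₂ (unstable-persists (pile (k + t)) v≢ u′)

  greedily-complete : Complete S greedily
  greedily-complete t v u with k , ws , n , eq ← scheduled v t
    with wait v t k (subst (λ A → Unstable A v) (sym (pile≡after t)) u)
  ... | inj₁ (t′ , t≤t′ , e) = t′ , t≤t′ , cong just e
  ... | inj₂ u′ = k + t , ℕₚ.m≤n+m t k , cong just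
    (trans (cong (λ p → choose (proj₁ p) (pile (k + t)) (history (k + t))) eq)
      (choose-first v ws (pile (k + t)) (history (k + t)) u′))

-- The circuit in the lattice

ℤ-induction : (P : ℤ → Set) → P (+ 0) → (∀ i → P i → P (ℤ.suc i)) → (∀ i → P i → P (ℤ.pred i)) → ∀ i → P i
ℤ-induction P p₀ p⁺ p⁻ (+ zero)     = p₀
ℤ-induction P p₀ p⁺ p⁻ (+ suc n)    = p⁺ (+ n) (ℤ-induction P p₀ p⁺ p⁻ (+ n))
ℤ-induction P p₀ p⁺ p⁻ -[1+ zero ]  = p⁻ (+ 0) p₀
ℤ-induction P p₀ p⁺ p⁻ -[1+ suc n ] = p⁻ -[1+ n ] (ℤ-induction P p₀ p⁺ p⁻ -[1+ n ])

-- The inner induction walks from `i` to zero, the outer one from zero to `j`.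
connected : (P : ℤ → Set) → (∀ i → P i → P (ℤ.suc i)) → (∀ i → P i → P (ℤ.pred i)) → ∀ i j → P i → P j
connected P p⁺ p⁻ i j p = ℤ-induction P
  (ℤ-induction (λ i → P i → P (+ 0)) (λ p → p)
    (λ i ih p → ih (subst P (ℤₚ.pred-suc i) (p⁻ _ p)))
    (λ i ih p → ih (subst P (ℤₚ.suc-pred i) (p⁺ _ p))) i p)
  p⁺ p⁻ j

-- Division with remainder, as the orbit of zero under an invertible successor.
module Orbit {Y : Set} (next prev : Y → Y) (next-prev : ∀ y → next (prev y) ≡ y)
  (prev-next : ∀ y → prev (next y) ≡ y) (y₀ : Y) where

  orbit : ℤ → Y
  orbit (+ zero)     = y₀
  orbit (+ suc n)    = next (orbit (+ n))
  orbit -[1+ zero ]  = prev y₀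
  orbit -[1+ suc n ] = prev (orbit -[1+ n ])

  orbit-suc : ∀ i → orbit (ℤ.suc i) ≡ next (orbit i)
  orbit-suc (+ n)        = refl
  orbit-suc -[1+ zero ]  = sym (next-prev y₀)
  orbit-suc -[1+ suc n ] = sym (next-prev (orbit -[1+ n ]))

  orbit-pred : ∀ i → orbit (ℤ.pred i) ≡ prev (orbit i)
  orbit-pred i = trans (sym (prev-next (orbit (ℤ.pred i))))
    (cong prev (trans (sym (orbit-suc (ℤ.pred i))) (cong orbit (ℤₚ.suc-pred i))))

  orbit-injective : (value : Y → ℤ) → value y₀ ≡ + 0 → (∀ y → value (next y) ≡ ℤ.suc (value y)) →
    ∀ {i j} → orbit i ≡ orbit j → i ≡ j
  orbit-injective value v₀ v-next {i} {j} e = trans (sym (inverse i)) (trans (cong value e) (inverse j))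
    where
    inverse : ∀ i → value (orbit i) ≡ i
    inverse = ℤ-induction _ v₀
      (λ i ih → trans (cong value (orbit-suc i)) (trans (v-next (orbit i)) (cong ℤ.suc ih)))
      (λ i ih → trans (cong value (orbit-pred i)) (trans (sym (ℤₚ.pred-suc (value (prev (orbit i)))))
        (cong ℤ.pred (trans (sym (v-next (prev (orbit i)))) (trans (cong value (next-prev (orbit i))) ih)))))

Bi : Set
Bi = ℤ × Bool

next₂ prev₂ : Bi → Bi
next₂ (q , false) = q , true
next₂ (q , true)  = ℤ.suc q , false
prev₂ (q , true)  = q , false
prev₂ (q , false) = ℤ.pred q , true

next-prev₂ : ∀ y → next₂ (prev₂ y) ≡ y
next-prev₂ (q , false) = cong (_, false) (ℤₚ.suc-pred q)
next-prev₂ (q , true)  = refl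

prev-next₂ : ∀ y → prev₂ (next₂ y) ≡ y
prev-next₂ (q , false) = refl
prev-next₂ (q , true)  = cong (_, true) (ℤₚ.pred-suc q)

data Four : Set where
  β₀ β₁ β₂ β₃ : Four

Quad : Set
Quad = ℤ × Four

next₄ prev₄ : Quad → Quad
next₄ (q , β₀) = q , β₁
next₄ (q , β₁) = q , β₂
next₄ (q , β₂) = q , β₃
next₄ (q , β₃) = ℤ.suc q , β₀
prev₄ (q , β₀) = ℤ.pred q , β₃
prev₄ (q , β₁) = q , β₀
prev₄ (q , β₂) = q , β₁
prev₄ (q , β₃) = q , β₂

next-prev₄ : ∀ y → next₄ (prev₄ y) ≡ y
next-prev₄ (q , β₀) = cong (_, β₀) (ℤₚ.suc-pred q)
next-prev₄ (q , β₁) = refl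
next-prev₄ (q , β₂) = refl
next-prev₄ (q , β₃) = refl

prev-next₄ : ∀ y → prev₄ (next₄ y) ≡ y
prev-next₄ (q , β₀) = refl
prev-next₄ (q , β₁) = refl
prev-next₄ (q , β₂) = refl
prev-next₄ (q , β₃) = cong (_, β₃) (ℤₚ.pred-suc q)

module O₂ = Orbit next₂ prev₂ next-prev₂ prev-next₂ (+ 0 , false)
module O₄ = Orbit next₄ prev₄ next-prev₄ prev-next₄ (+ 0 , β₀)

private
  value₂ : Bi → ℤ
  value₂ (q , false) = q ℤ.* + 2
  value₂ (q , true)  = + 1 ℤ.+ q ℤ.* + 2

  value-next₂ : ∀ y → value₂ (next₂ y) ≡ ℤ.suc (value₂ y)
  value-next₂ (q , false) = refl
  value-next₂ (q , true)  = lemma q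
    where lemma : ∀ q → (+ 1 ℤ.+ q) ℤ.* + 2 ≡ + 1 ℤ.+ (+ 1 ℤ.+ q ℤ.* + 2)
          lemma = ℤ-solver.solve-∀

  value₄ : Quad → ℤ
  value₄ (q , β₀) = q ℤ.* + 4
  value₄ (q , β₁) = + 1 ℤ.+ q ℤ.* + 4
  value₄ (q , β₂) = + 1 ℤ.+ (+ 1 ℤ.+ q ℤ.* + 4)
  value₄ (q , β₃) = + 1 ℤ.+ (+ 1 ℤ.+ (+ 1 ℤ.+ q ℤ.* + 4))

  value-next₄ : ∀ y → value₄ (next₄ y) ≡ ℤ.suc (value₄ y)
  value-next₄ (q , β₀) = refl
  value-next₄ (q , β₁) = refl
  value-next₄ (q , β₂) = refl
  value-next₄ (q , β₃) = lemma q
    where lemma : ∀ q → (+ 1 ℤ.+ q) ℤ.* + 4 ≡ + 1 ℤ.+ (+ 1 ℤ.+ (+ 1 ℤ.+ (+ 1 ℤ.+ q ℤ.* + 4)))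
          lemma = ℤ-solver.solve-∀

Site : Set
Site = Bi × Quad × Bi

-- Quotients and remainders become data, by 2 in x and z and by 4 in y. A step of the lattice is
-- then the case distinction `stepˢ`, and the geometry of the circuit can be checked by pattern
-- matching.
site : Vertex → Site
site (x , y , z) = O₂.orbit x , O₄.orbit y , O₂.orbit z

stepˢ : Dir → Site → Site
stepˢ x⁺ (x , y , z) = next₂ x , y , z
stepˢ x⁻ (x , y , z) = prev₂ x , y , z
stepˢ y⁺ (x , y , z) = x , next₄ y , z
stepˢ y⁻ (x , y , z) = x , prev₄ y , z
stepˢ z⁺ (x , y , z) = x , y , next₂ z
stepˢ z⁻ (x , y , z) = x , y , prev₂ z

site-nbr : ∀ d v → site (nbr d v) ≡ stepˢ d (site v)
site-nbr x⁺ (x , y , z) = cong (_, _) (O₂.orbit-suc x)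
site-nbr x⁻ (x , y , z) = cong (_, _) (O₂.orbit-pred x)
site-nbr y⁺ (x , y , z) = cong (λ a → _ , a , _) (O₄.orbit-suc y)
site-nbr y⁻ (x , y , z) = cong (λ a → _ , a , _) (O₄.orbit-pred y)
site-nbr z⁺ (x , y , z) = cong (λ a → _ , _ , a) (O₂.orbit-suc z)
site-nbr z⁻ (x , y , z) = cong (λ a → _ , _ , a) (O₂.orbit-pred z)

site-injective : ∀ {v w} → site v ≡ site w → v ≡ w
site-injective e = cong₂ _,_ (inj₂′ (cong proj₁ e))
  (cong₂ _,_ (O₄.orbit-injective value₄ refl value-next₄ (cong (λ s → proj₁ (proj₂ s)) e))
    (inj₂′ (cong (λ s → proj₂ (proj₂ s)) e)))
  where
  inj₂′ : ∀ {i j} → O₂.orbit i ≡ O₂.orbit j → i ≡ j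
  inj₂′ = O₂.orbit-injective value₂ refl value-next₂

-- Classes of row positions and the vertices that they require

data Class : Set where
  off first need pass out hub : Class

-- Whether the row continues to the next column in the east or in the west. Neighbouring columns
-- must agree on this, which is the hypothesis `link` of `Layout`.
linkE linkW : Class → Bool
linkE off   = false
linkE first = true
linkE need  = true
linkE pass  = true
linkE out   = false
linkE hub   = true
linkW off   = false
linkW first = false
linkW need  = true
linkW pass  = true
linkW out   = true
linkW hub   = true

reads writes : Class → Bool
reads first = true
reads need  = true
reads hub   = true
reads _     = false
writes out = true
writes _   = false

wireIf : Bool → Kind
wireIf b = if b then wire else wall

row exit : Class → Kind
row off  = wall
row need = gate
row _    = wire
exit out = gate
exit hub = wire
exit _   = wall

spare : Bool → Four → Kind
spare false β₀ = wire
spare true  β₁ = source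
spare _     _  = wall

-- The second class is that of the next column to the east. It is consulted only at α = 1, β = 3,
-- where the vertex is the second of the two paths into the exit of that column.
circuit : Bool → Four → Class → Class → Kind
circuit false β₀ c c′ = wire
circuit true  β₀ c c′ = wall
circuit false β₁ c c′ = wireIf (reads c)
circuit true  β₁ c c′ = wall
circuit false β₂ c c′ = row c
circuit true  β₂ c c′ = wireIf (linkE c)
circuit false β₃ c c′ = exit c
circuit true  β₃ c c′ = wireIf (writes c′)

wireIf≢gate : ∀ b → wireIf b ≢ gate
wireIf≢gate true ()
wireIf≢gate false ()

row-gate : ∀ c → row c ≡ gate → c ≡ need
row-gate need _ = refl

exit-gate : ∀ c → exit c ≡ gate → c ≡ out
exit-gate out _ = refl

circuit≢source : ∀ b β c c′ → circuit b β c c′ ≢ source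
circuit≢source false β₁ c c′ e with reads c
circuit≢source false β₁ c c′ () | true
circuit≢source false β₁ c c′ () | false
circuit≢source true β₂ c c′ e with linkE c
circuit≢source true β₂ c c′ () | true
circuit≢source true β₂ c c′ () | false
circuit≢source true β₃ c c′ e with writes c′
circuit≢source true β₃ c c′ () | true
circuit≢source true β₃ c c′ () | false
circuit≢source false β₂ off c′ ()
circuit≢source false β₂ need c′ ()
circuit≢source false β₃ out c′ ()
circuit≢source false β₃ hub c′ ()

-- The vertex (2X + α , 4t + β , 2Z + γ) carries the atom X at time t if
-- α = β = 0, and belongs to row Z of time t otherwise.  The row runs east along
-- β = 2.  Through β = 1 it reads an atom where its class is first or need, and
-- through β = 3 it writes the atom of time t + 1 where its class is out; at a
-- hub, row and atom are joined in all directions.  A toppling must not travel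
-- back from an atom into a row that writes it, so the vertex next to the atom
-- needs two toppled neighbours, and the row reaches it along two paths.  The
-- sources do not touch the circuit: they only make sure that a fresh unstable
-- vertex can be found at any time.
module Layout (cls : ℤ → ℤ → Class)
  (link : ∀ Z X → linkE (cls Z X) ≡ linkW (cls Z (ℤ.suc X))) where

  kindˢ : Site → Kind
  kindˢ ((X , a) , (t , β) , (Z , true))  = spare a β
  kindˢ ((X , a) , (t , β) , (Z , false)) = circuit a β (cls Z X) (cls Z (ℤ.suc X))

  link′ : ∀ Z X → linkE (cls Z (ℤ.pred X)) ≡ linkW (cls Z X)
  link′ Z X = trans (link Z (ℤ.pred X)) (cong (λ X → linkW (cls Z X)) (ℤₚ.suc-pred X))

  -- What an interpretation must satisfy to contain all flow. Since wires conduct both ways, the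
  -- rules come with their converses. The exception is `write`, whose converse would make an atom
  -- evidence for every row that can write it.
  record Model : Set₁ where
    field
      Atom : ℤ → ℤ → Set
      Row  : ℤ → ℤ → ℤ → Set
      first⇒ : ∀ {Z X t} → cls Z X ≡ first → Row Z X t → Atom X t
      ⇒first : ∀ {Z X t} → cls Z X ≡ first → Atom X t → Row Z X t
      need⇒  : ∀ {Z X t} → cls Z X ≡ need → Row Z X t → Row Z (ℤ.pred X) t × Atom X t
      ⇒need  : ∀ {Z X t} → cls Z X ≡ need → Row Z (ℤ.pred X) t → Atom X t → Row Z X t
      pass⇒  : ∀ {Z X t} → cls Z X ≡ pass → Row Z X t → Row Z (ℤ.pred X) t
      ⇒pass  : ∀ {Z X t} → cls Z X ≡ pass → Row Z (ℤ.pred X) t → Row Z X t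
      out⇒   : ∀ {Z X t} → cls Z X ≡ out → Row Z X t → Row Z (ℤ.pred X) t
      ⇒out   : ∀ {Z X t} → cls Z X ≡ out → Row Z (ℤ.pred X) t → Row Z X t
      write  : ∀ {Z X t} → cls Z X ≡ out → Row Z X t → Atom X (ℤ.suc t)
      hub⇒   : ∀ {Z X t} → cls Z X ≡ hub → Row Z X t → Row Z (ℤ.pred X) t
      ⇒hub   : ∀ {Z X t} → cls Z X ≡ hub → Row Z (ℤ.pred X) t → Row Z X t
      hub⇒atom : ∀ {Z X t} → cls Z X ≡ hub → Row Z X t → Atom X t
      atom⇒hub : ∀ {Z X t} → cls Z X ≡ hub → Atom X t → Row Z X t
      hub-suc  : ∀ {Z X t} → cls Z X ≡ hub → Atom X t → Atom X (ℤ.suc t)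
      hub-pred : ∀ {Z X t} → cls Z X ≡ hub → Atom X (ℤ.suc t) → Atom X t

  module _ (M : Model) where
    open Model M

    -- Sources are granted outright: they lie at odd sites with β = 1, where `value` is empty.
    guard : Kind → Set → Set
    guard wall   _ = ⊥
    guard source _ = ⊤
    guard _      A = A

    -- An odd site of a row carries the value of the column to its west: what the column to its east
    -- reads is not yet part of the conjunction there.
    value : Site → Set
    value ((X , false) , (t , β₀) , _)           = Atom X t
    value ((X , false) , (t , β₁) , (Z , _))     = Atom X t
    value ((X , _)     , (t , β₂) , (Z , _))     = Row Z X t
    value ((X , _)     , (t , β₃) , (Z , _))     = Row Z X t
    value ((X , true)  , (t , _)  , (Z , _))     = ⊥

    Fired : Site → Set
    Fired σ = guard (kindˢ σ) (value σ)

    private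
      conn : ∀ {X t Z} → guard (wireIf (reads (cls Z X))) (Atom X t) → Atom X t
      conn {X} {t} {Z} f with cls Z X
      ... | first = f
      ... | need = f
      ... | hub = f

      row′ : ∀ {X t Z} → guard (row (cls Z X)) (Row Z X t) → Row Z X t
      row′ {X} {t} {Z} f with cls Z X
      ... | first = f
      ... | need = f
      ... | hub = f
      ... | pass = f
      ... | out = f

      edge′ : ∀ {X t Z} → guard (wireIf (linkE (cls Z X))) (Row Z X t) →
        linkE (cls Z X) ≡ true × Row Z X t
      edge′ {X} {t} {Z} f with linkE (cls Z X)
      ... | true = refl , f

      edgeW : ∀ {X t Z} → guard (wireIf (linkE (cls Z (ℤ.pred X)))) (Row Z (ℤ.pred X) t) →
        linkW (cls Z X) ≡ true × Row Z (ℤ.pred X) t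
      edgeW {X} {t} {Z} f with l , r ← edge′ {ℤ.pred X} {t} {Z} f = trans (sym (link′ Z X)) l , r

      exit′ : ∀ {X t Z} → guard (exit (cls Z X)) (Row Z X t) →
        (cls Z X ≡ out ⊎ cls Z X ≡ hub) × Row Z X t
      exit′ {X} {t} {Z} f with cls Z X
      ... | out = inj₁ refl , f
      ... | hub = inj₂ refl , f

      entry′ : ∀ {X t Z} → guard (wireIf (writes (cls Z (ℤ.suc X)))) (Row Z X t) →
        cls Z (ℤ.suc X) ≡ out × Row Z X t
      entry′ {X} {t} {Z} f with cls Z (ℤ.suc X)
      ... | out = refl , f

      entryW : ∀ {X t Z} → guard (wireIf (writes (cls Z (ℤ.suc (ℤ.pred X))))) (Row Z (ℤ.pred X) t) →
        cls Z X ≡ out × Row Z (ℤ.pred X) t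
      entryW {X} {t} {Z} f with e , r ← entry′ {ℤ.pred X} {t} {Z} f =
        trans (cong (cls Z) (sym (ℤₚ.suc-pred X))) e , r

      backward : ∀ {Z X t} → linkW (cls Z X) ≡ true → Row Z X t → Row Z (ℤ.pred X) t
      backward {Z} {X} l r with cls Z X in eq
      backward () r | off
      backward () r | first
      ... | need = proj₁ (need⇒ eq r)
      ... | pass = pass⇒ eq r
      ... | out = out⇒ eq r
      ... | hub = hub⇒ eq r

      backward′ : ∀ {Z X t} → linkE (cls Z X) ≡ true → Row Z (ℤ.suc X) t → Row Z X t
      backward′ {Z} {X} {t} l r = subst (λ X → Row Z X t) (ℤₚ.pred-suc X)
        (backward (trans (sym (link Z X)) l) r)

      from-exit : ∀ {Z X t} → cls Z X ≡ out ⊎ cls Z X ≡ hub → Row Z X t → Atom X (ℤ.suc t)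
      from-exit (inj₁ e) r = write e r
      from-exit (inj₂ e) r = hub-suc e (hub⇒atom e r)

      to-row : ∀ {Z X t} → row (cls Z X) ≡ wire → linkW (cls Z X) ≡ true → Row Z (ℤ.pred X) t → Row Z X t
      to-row {Z} {X} k l r with cls Z X in eq
      to-row () l r | off
      to-row k () r | first
      to-row () l r | need
      ... | pass = ⇒pass eq r
      ... | out = ⇒out eq r
      ... | hub = ⇒hub eq r

    -- One neighbour suffices for a wire, so the flow has to be checked from each of the six
    -- directions. Flow to the west relies on the converse rules of `Model`, as in `backward`.
    wire-value : ∀ σ d → kindˢ σ ≡ wire → Fired (stepˢ d σ) → value σ
    wire-value ((X , false) , (t , β₀) , (Z , false)) x⁺ k ()
    wire-value ((X , false) , (t , β₀) , (Z , false)) x⁻ k ()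
    wire-value ((X , false) , (t , β₀) , (Z , true)) x⁺ k ()
    wire-value ((X , false) , (t , β₀) , (Z , true)) x⁻ k ()
    wire-value ((X , false) , (t , β₀) , (Z , false)) y⁺ k f = conn f
    wire-value ((X , false) , (t , β₀) , (Z , true)) y⁺ k ()
    wire-value ((X , false) , (t , β₀) , (Z , false)) y⁻ k f with e , r ← exit′ f =
      subst (Atom X) (ℤₚ.suc-pred t) (from-exit e r)
    wire-value ((X , false) , (t , β₀) , (Z , true)) y⁻ k ()
    wire-value ((X , false) , (t , β₀) , (Z , false)) z⁺ k f = f
    wire-value ((X , false) , (t , β₀) , (Z , true)) z⁺ k f = f
    wire-value ((X , false) , (t , β₀) , (Z , false)) z⁻ k f = f
    wire-value ((X , false) , (t , β₀) , (Z , true)) z⁻ k f = f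
    wire-value ((X , false) , (t , β₁) , (Z , false)) x⁺ k ()
    wire-value ((X , false) , (t , β₁) , (Z , false)) x⁻ k ()
    wire-value ((X , false) , (t , β₁) , (Z , false)) y⁺ k f with cls Z X in eq
    ... | first = first⇒ eq f
    ... | need = proj₂ (need⇒ eq f)
    ... | hub = hub⇒atom eq f
    wire-value ((X , false) , (t , β₁) , (Z , false)) y⁻ k f = f
    wire-value ((X , false) , (t , β₁) , (Z , false)) z⁺ k ()
    wire-value ((X , false) , (t , β₁) , (Z , false)) z⁻ k ()
    wire-value ((X , false) , (t , β₂) , (Z , false)) x⁺ k f = proj₂ (edge′ f)
    wire-value ((X , false) , (t , β₂) , (Z , false)) x⁻ k f with l , r ← edgeW f = to-row k l r
    wire-value ((X , false) , (t , β₂) , (Z , false)) y⁺ k f = proj₂ (exit′ f)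
    wire-value ((X , false) , (t , β₂) , (Z , false)) y⁻ k f with cls Z X in eq
    ... | first = ⇒first eq f
    ... | hub = atom⇒hub eq f
    wire-value ((X , false) , (t , β₂) , (Z , false)) z⁺ k ()
    wire-value ((X , false) , (t , β₂) , (Z , false)) z⁻ k ()
    wire-value ((X , true) , (t , β₂) , (Z , false)) x⁺ k f with linkE (cls Z X) in eq
    ... | true = backward′ eq (row′ f)
    wire-value ((X , true) , (t , β₂) , (Z , false)) x⁻ k f = row′ f
    wire-value ((X , true) , (t , β₂) , (Z , false)) y⁺ k f = proj₂ (entry′ f)
    wire-value ((X , true) , (t , β₂) , (Z , false)) y⁻ k ()
    wire-value ((X , true) , (t , β₂) , (Z , false)) z⁺ k ()
    wire-value ((X , true) , (t , β₂) , (Z , false)) z⁻ k ()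
    wire-value ((X , false) , (t , β₃) , (Z , false)) x⁺ k f = proj₂ (entry′ f)
    -- An entry leads only into an `out` column, whose exit is a gate and not a wire.
    wire-value ((X , false) , (t , β₃) , (Z , false)) x⁻ k f with e , r ← entryW f
      with () ← trans (sym k) (cong exit e)
    wire-value ((X , false) , (t , β₃) , (Z , false)) y⁺ k f with cls Z X in eq
    ... | hub = atom⇒hub eq (hub-pred eq f)
    wire-value ((X , false) , (t , β₃) , (Z , false)) y⁻ k f = row′ f
    wire-value ((X , false) , (t , β₃) , (Z , false)) z⁺ k ()
    wire-value ((X , false) , (t , β₃) , (Z , false)) z⁻ k ()
    wire-value ((X , true) , (t , β₃) , (Z , false)) x⁺ k f = backward‴ (proj₂ (exit′ f))
      where
      backward‴ : Row Z (ℤ.suc X) t → Row Z X t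
      backward‴ r with cls Z (ℤ.suc X) in eq
      ... | out = subst (λ X → Row Z X t) (ℤₚ.pred-suc X) (out⇒ eq r)
    wire-value ((X , true) , (t , β₃) , (Z , false)) x⁻ k f = proj₂ (exit′ f)
    wire-value ((X , true) , (t , β₃) , (Z , false)) y⁺ k ()
    wire-value ((X , true) , (t , β₃) , (Z , false)) y⁻ k f = proj₂ (edge′ f)
    wire-value ((X , true) , (t , β₃) , (Z , false)) z⁺ k ()
    wire-value ((X , true) , (t , β₃) , (Z , false)) z⁻ k ()

    wire-value ((X , true) , (t , β₀) , (Z , false)) d () f
    wire-value ((X , true) , (t , β₀) , (Z , true)) d () f
    wire-value ((X , true) , (t , β₁) , (Z , true)) d () f
    wire-value ((X , true) , (t , β₁) , (Z , false)) d () f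
    wire-value ((X , false) , (t , β₁) , (Z , true)) d () f
    wire-value ((X , true) , (t , β₂) , (Z , true)) d () f
    wire-value ((X , false) , (t , β₂) , (Z , true)) d () f
    wire-value ((X , true) , (t , β₃) , (Z , true)) d () f
    wire-value ((X , false) , (t , β₃) , (Z , true)) d () f

    private
      -- Only the western edge and the connector of the atom can fire while the conjunction is
      -- false, and each of them supplies one conjunct. Two distinct fired neighbours thus give the
      -- conjunction itself or both of its parts.
      need-step : ∀ X t Z d → cls Z X ≡ need → Fired (stepˢ d ((X , false) , (t , β₂) , (Z , false))) →
        Row Z X t ⊎ (d ≡ x⁻ × Row Z (ℤ.pred X) t) ⊎ (d ≡ y⁻ × Atom X t)
      need-step X t Z x⁺ e f = inj₁ (proj₂ (edge′ f))
      need-step X t Z x⁻ e f = inj₂ (inj₁ (refl , proj₂ (edge′ f)))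
      need-step X t Z y⁺ e f = inj₁ (proj₂ (exit′ f))
      need-step X t Z y⁻ e f = inj₂ (inj₂ (refl , conn f))
      need-step X t Z z⁺ e ()
      need-step X t Z z⁻ e ()

      -- The diode: only the atom of the next time, in direction `y⁺`, can fire without the row, and
      -- the gate needs a second neighbour.
      out-step : ∀ X t Z d → cls Z X ≡ out → Fired (stepˢ d ((X , false) , (t , β₃) , (Z , false))) →
        Row Z X t ⊎ d ≡ y⁺
      out-step X t Z x⁺ e f = inj₁ (proj₂ (entry′ f))
      out-step X t Z x⁻ e f = inj₁ (⇒out e (proj₂ (entry′ f)))
      out-step X t Z y⁺ e f = inj₂ refl
      out-step X t Z y⁻ e f = inj₁ (row′ f)
      out-step X t Z z⁺ e ()
      out-step X t Z z⁻ e ()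

    gate-value : ∀ σ d d′ → kindˢ σ ≡ gate → d ≢ d′ → Fired (stepˢ d σ) → Fired (stepˢ d′ σ) → value σ
    gate-value ((X , false) , (t , β₁) , (Z , false)) d d′ k d≢d′ f f′ = ⊥-elim (wireIf≢gate (reads (cls Z X)) k)
    gate-value ((X , false) , (t , β₂) , (Z , false)) d d′ k d≢d′ f f′ =
      combine (need-step X t Z d isNeed f) (need-step X t Z d′ isNeed f′)
      where
      isNeed : cls Z X ≡ need
      isNeed = row-gate (cls Z X) k
      combine : Row Z X t ⊎ (d ≡ x⁻ × Row Z (ℤ.pred X) t) ⊎ (d ≡ y⁻ × Atom X t) →
        Row Z X t ⊎ (d′ ≡ x⁻ × Row Z (ℤ.pred X) t) ⊎ (d′ ≡ y⁻ × Atom X t) → Row Z X t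
      combine (inj₁ r) _ = r
      combine _ (inj₁ r) = r
      combine (inj₂ (inj₁ (refl , _))) (inj₂ (inj₁ (refl , _))) = contradiction refl d≢d′
      combine (inj₂ (inj₂ (refl , _))) (inj₂ (inj₂ (refl , _))) = contradiction refl d≢d′
      combine (inj₂ (inj₁ (_ , r))) (inj₂ (inj₂ (_ , a))) = ⇒need isNeed r a
      combine (inj₂ (inj₂ (_ , a))) (inj₂ (inj₁ (_ , r))) = ⇒need isNeed r a
    gate-value ((X , true) , (t , β₂) , (Z , false)) d d′ k d≢d′ f f′ =
      ⊥-elim (wireIf≢gate (linkE (cls Z X)) k)
    gate-value ((X , false) , (t , β₃) , (Z , false)) d d′ k d≢d′ f f′ =
      combine (out-step X t Z d isOut f) (out-step X t Z d′ isOut f′)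
      where
      isOut : cls Z X ≡ out
      isOut = exit-gate (cls Z X) k
      combine : Row Z X t ⊎ d ≡ y⁺ → Row Z X t ⊎ d′ ≡ y⁺ → Row Z X t
      combine (inj₁ r) _ = r
      combine _ (inj₁ r) = r
      combine (inj₂ refl) (inj₂ refl) = contradiction refl d≢d′
    gate-value ((X , true) , (t , β₃) , (Z , false)) d d′ k d≢d′ f f′ =
      ⊥-elim (wireIf≢gate (writes (cls Z (ℤ.suc X))) k)
    gate-value ((X , false) , (t , β₀) , (Z , false)) d d′ () d≢d′ f f′
    gate-value ((X , false) , (t , β₀) , (Z , true)) d d′ () d≢d′ f f′
    gate-value ((X , true) , (t , β₀) , (Z , false)) d d′ () d≢d′ f f′
    gate-value ((X , true) , (t , β₀) , (Z , true)) d d′ () d≢d′ f f′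
    gate-value ((X , true) , (t , β₁) , (Z , true)) d d′ () d≢d′ f f′
    gate-value ((X , true) , (t , β₁) , (Z , false)) d d′ () d≢d′ f f′
    gate-value ((X , false) , (t , β₁) , (Z , true)) d d′ () d≢d′ f f′
    gate-value ((X , true) , (t , β₂) , (Z , true)) d d′ () d≢d′ f f′
    gate-value ((X , false) , (t , β₂) , (Z , true)) d d′ () d≢d′ f f′
    gate-value ((X , true) , (t , β₃) , (Z , true)) d d′ () d≢d′ f f′
    gate-value ((X , false) , (t , β₃) , (Z , true)) d d′ () d≢d′ f f′

  -- The counterpart of `Model`: what every set of sites closed under the rules must contain, to be
  -- applied to the vertices that topple.
  module Closed (T : Site → Set)
    (wire-closed : ∀ σ d → kindˢ σ ≡ wire → T (stepˢ d σ) → T σ)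
    (gate-closed : ∀ σ d d′ → kindˢ σ ≡ gate → d ≢ d′ → T (stepˢ d σ) → T (stepˢ d′ σ) → T σ) where

    Line : ℤ → ℤ → Set
    Line X t = ∀ Z → T ((X , false) , (t , β₀) , (Z , false))

    Rowᵀ Edge : ℤ → ℤ → ℤ → Set
    Rowᵀ Z X t = T ((X , false) , (t , β₂) , (Z , false))
    Edge Z X t = T ((X , true) , (t , β₂) , (Z , false))

    -- An atom is a wire along the whole z-axis, so that every row can meet it. The next row is two
    -- steps away, across the layer γ = 1.
    line : ∀ {X t} Z → T ((X , false) , (t , β₀) , (Z , false)) → Line X t
    line {X} {t} Z τ Z′ = connected _
      (λ Z τ → wire-closed _ z⁻ refl (subst (λ Z → T ((X , false) , (t , β₀) , (Z , true))) (sym (ℤₚ.pred-suc Z))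
        (wire-closed _ z⁻ refl τ)))
      (λ Z τ → wire-closed _ z⁺ refl (wire-closed _ z⁺ refl
        (subst (λ Z → T ((X , false) , (t , β₀) , (Z , false))) (sym (ℤₚ.suc-pred Z)) τ)))
      Z Z′ τ

    edge : ∀ {Z X t} → linkE (cls Z X) ≡ true → Rowᵀ Z X t → Edge Z X t
    edge {Z} {X} l = wire-closed _ x⁻ (cong wireIf l)

    edge′ : ∀ {Z X t} → linkW (cls Z X) ≡ true → Rowᵀ Z (ℤ.pred X) t → Edge Z (ℤ.pred X) t
    edge′ {Z} {X} l = edge (trans (link′ Z X) l)

    read : ∀ {Z X t} → reads (cls Z X) ≡ true → Line X t → T ((X , false) , (t , β₁) , (Z , false))
    read {Z} k τ = wire-closed _ y⁻ (cong wireIf k) (τ Z)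

    first-row : ∀ {Z X t} → cls Z X ≡ first → Line X t → Rowᵀ Z X t
    first-row e τ = wire-closed _ y⁻ (cong row e) (read (cong reads e) τ)

    need-row : ∀ {Z X t} → cls Z X ≡ need → Rowᵀ Z (ℤ.pred X) t → Line X t → Rowᵀ Z X t
    need-row e τ τ′ = gate-closed _ x⁻ y⁻ (cong row e) (λ ()) (edge′ (cong linkW e) τ)
      (read (cong reads e) τ′)

    pass-row : ∀ {Z X t} → cls Z X ≡ pass → Rowᵀ Z (ℤ.pred X) t → Rowᵀ Z X t
    pass-row e τ = wire-closed _ x⁻ (cong row e) (edge′ (cong linkW e) τ)

    written : ∀ {Z X t} → T ((X , false) , (t , β₃) , (Z , false)) → Line X (ℤ.suc t)
    written {Z} {X} {t} τ = line Z (wire-closed _ y⁻ refl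
      (subst (λ t → T ((X , false) , (t , β₃) , (Z , false))) (sym (ℤₚ.pred-suc t)) τ))

    out-row : ∀ {Z X t} → cls Z X ≡ out → Rowᵀ Z (ℤ.pred X) t → Line X (ℤ.suc t)
    -- The edge before the column feeds the gate along both paths, through the entry and through the
    -- row.
    out-row {Z} {X} {t} e τ = written (gate-closed _ x⁻ y⁻ (cong exit e) (λ ())
      (wire-closed _ y⁻ (cong (wireIf ∘ writes) (trans (cong (cls Z) (ℤₚ.suc-pred X)) e)) τ′)
      (wire-closed _ x⁻ (cong row e) τ′))
      where
      τ′ : Edge Z (ℤ.pred X) t
      τ′ = edge′ (cong linkW e) τ

    module Bus (Z : ℤ) (bus : ∀ X → cls Z X ≡ pass ⊎ cls Z X ≡ hub) where

      private
        row-wire : ∀ X → row (cls Z X) ≡ wire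
        row-wire X with bus X
        ... | inj₁ e = cong row e
        ... | inj₂ e = cong row e

        linkE-true : ∀ X → linkE (cls Z X) ≡ true
        linkE-true X with bus X
        ... | inj₁ e = cong linkE e
        ... | inj₂ e = cong linkE e

      along : ∀ {t} X X′ → Rowᵀ Z X t → Rowᵀ Z X′ t
      along {t} = connected (λ X → Rowᵀ Z X t)
        (λ X τ → wire-closed _ x⁻ (row-wire (ℤ.suc X))
          (edge (linkE-true (ℤ.pred (ℤ.suc X))) (subst (λ X → Rowᵀ Z X t) (sym (ℤₚ.pred-suc X)) τ)))
        (λ X τ → wire-closed _ x⁺ (row-wire (ℤ.pred X))
          (wire-closed _ x⁺ (cong wireIf (linkE-true (ℤ.pred X)))
            (subst (λ X → Rowᵀ Z X t) (sym (ℤₚ.suc-pred X)) τ)))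

      hub-row : ∀ {X t} → cls Z X ≡ hub → Line X t → Rowᵀ Z X t
      hub-row e τ = wire-closed _ y⁻ (cong row e) (read (cong reads e) τ)

      row-hub : ∀ {X t} → cls Z X ≡ hub → Rowᵀ Z X t → Line X t
      row-hub e τ = line Z (wire-closed _ y⁺ refl (wire-closed _ y⁺ (cong (wireIf ∘ reads) e) τ))

      -- At a hub the exit is a wire instead of a gate, so that toppling travels along time in both
      -- directions.
      through : ∀ {X} → cls Z X ≡ hub → ∀ t t′ → Line X t → Line X t′
      through {X} e = connected (Line X)
        (λ t τ → written (wire-closed _ y⁻ (cong exit e) (hub-row e τ)))
        (λ t τ → row-hub e (wire-closed _ y⁺ (cong row e) (wire-closed _ y⁺ (cong exit e)
          (subst (λ t → T ((X , false) , (t , β₀) , (Z , false))) (sym (ℤₚ.suc-pred t)) (τ Z)))))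

      broadcast : ∀ {X X′ t t′} → cls Z X ≡ hub → cls Z X′ ≡ hub → Line X t → Line X′ t′
      broadcast {X} {X′} {t} {t′} e e′ τ = through e′ t t′ (row-hub e′ (along X X′ (hub-row e τ)))

-- Rows of the circuit for a finite set of rules

open DecMembership ℕₚ._≟_ using () renaming (_∈?_ to _∈ℕ?_)

digits-≤ : ∀ n {r r′ q q′} → r < n → + r ℤ.+ q ℤ.* + n ≡ + r′ ℤ.+ q′ ℤ.* + n → q′ ℤ.≤ q
digits-≤ n {r} {r′} {q} {q′} r<n e = ℤₚ.≮⇒≥ λ q<q′ → ℤₚ.<⇒≱ (lt q<q′) (ℤₚ.≤-reflexive (sym e))
  where
  open ℤₚ.≤-Reasoning
  lt : q ℤ.< q′ → + r ℤ.+ q ℤ.* + n ℤ.< + r′ ℤ.+ q′ ℤ.* + n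
  lt q<q′ = begin-strict
    + r ℤ.+ q ℤ.* + n    <⟨ ℤₚ.+-monoˡ-< (q ℤ.* + n) (ℤ.+<+ r<n) ⟩
    + n ℤ.+ q ℤ.* + n    ≡⟨ ℤₚ.suc-* q (+ n) ⟨
    ℤ.suc q ℤ.* + n      ≤⟨ ℤₚ.*-monoʳ-≤-nonNeg (+ n) (ℤₚ.i<j⇒suc[i]≤j q<q′) ⟩
    q′ ℤ.* + n           ≤⟨ ℤₚ.i≤j+i (q′ ℤ.* + n) (+ r′) ⟩
    + r′ ℤ.+ q′ ℤ.* + n  ∎

digits-unique : ∀ n {r r′ q q′} → r < n → r′ < n → + r ℤ.+ q ℤ.* + n ≡ + r′ ℤ.+ q′ ℤ.* + n →
  r ≡ r′ × q ≡ q′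
digits-unique n {r} {r′} {q} {q′} r<n r′<n e
  with refl ← ℤₚ.≤-antisym {q} {q′} (digits-≤ n r′<n (sym e)) (digits-≤ n r<n e) =
  ℤₚ.+-injective (∙-cancelʳ ℤₚ.+-0-abelianGroup (q ℤ.* + n) (+ r) (+ r′) e) , refl

%ℕ-/ℕ-unique : ∀ n .{{_ : NonZero n}} {r q} i → r < n → i ≡ + r ℤ.+ q ℤ.* + n → i %ℕ n ≡ r × i /ℕ n ≡ q
%ℕ-/ℕ-unique n i r<n e = digits-unique n (n%ℕd<d i n) r<n (trans (sym (a≡a%ℕn+[a/ℕn]*n i n)) e)

nth : ∀ {A : Set} → A → List A → ℕ → A
nth d []       _       = d
nth d (a ∷ as) zero    = a
nth d (a ∷ as) (suc n) = nth d as n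

nth-∈ : ∀ {A : Set} {d : A} {as} → d ∈ as → ∀ n → nth d as n ∈ as
nth-∈ {d = d} {as} d∈ n with go as n
  where
  go : ∀ as n → nth d as n ∈ as ⊎ nth d as n ≡ d
  go [] n = inj₂ refl
  go (a ∷ as) zero = inj₁ (here refl)
  go (a ∷ as) (suc n) with go as n
  ... | inj₁ a∈ = inj₁ (there a∈)
  ... | inj₂ e = inj₂ e
... | inj₁ a∈ = a∈
... | inj₂ e = subst (_∈ as) (sym e) d∈

∈-nth : ∀ {A : Set} {d a : A} {as} → a ∈ as → ∃[ n ] n < length as × nth d as n ≡ a
∈-nth (here refl) = 0 , s≤s z≤n , refl
∈-nth (there a∈) with n , n< , e ← ∈-nth a∈ = suc n , s≤s n< , e

-- A Horn clause between columns of a window: the atoms `start` and `rest` at one time yield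
-- `target` at the next. `Valid` asks for an order in which a row that runs east can meet them.
record Rule : Set where
  field
    start : ℕ
    rest  : List ℕ
    target : ℕ

open Rule

record Valid (bound : ℕ) (ρ : Rule) : Set where
  field
    start<end  : start ρ < target ρ
    end<bound  : target ρ < bound
    start<rest : ∀ {n} → n ∈ rest ρ → start ρ < n
    rest<end   : ∀ {n} → n ∈ rest ρ → n < target ρ

data Pattern : Set where
  bus  : Pattern
  rule : Rule → Pattern

data View (hubs : List ℕ) : Pattern → ℕ → Class → Set where
  before-start   : ∀ {ρ u} → u < start ρ → View hubs (rule ρ) u off
  at-start : ∀ {ρ u} → u ≡ start ρ → View hubs (rule ρ) u first
  at-need  : ∀ {ρ u} → start ρ < u → u < target ρ → u ∈ rest ρ → View hubs (rule ρ) u need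
  at-pass  : ∀ {ρ u} → start ρ < u → u < target ρ → u ∉ rest ρ → View hubs (rule ρ) u pass
  at-target   : ∀ {ρ u} → start ρ < u → u ≡ target ρ → View hubs (rule ρ) u out
  past-target    : ∀ {ρ u} → start ρ < u → target ρ < u → View hubs (rule ρ) u off
  at-hub   : ∀ {u} → u ∈ hubs → View hubs bus u hub
  no-hub   : ∀ {u} → u ∉ hubs → View hubs bus u pass

view : ∀ hubs p u → ∃[ c ] View hubs p u c
view hubs bus u with u ∈ℕ? hubs
... | yes u∈ = hub , at-hub u∈
... | no u∉ = pass , no-hub u∉
view hubs (rule ρ) u with ℕₚ.<-cmp u (start ρ)
... | tri< u< _ _ = off , before-start u<
... | tri≈ _ u≡ _ = first , at-start u≡
... | tri> _ _ u> with ℕₚ.<-cmp u (target ρ)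
...   | tri≈ _ u≡ _ = out , at-target u> u≡
...   | tri> _ _ e< = off , past-target u> e<
...   | tri< <e _ _ with u ∈ℕ? rest ρ
...     | yes u∈ = need , at-need u> <e u∈
...     | no u∉ = pass , at-pass u> <e u∉

linkE-true : ∀ {hubs ρ u c} → View hubs (rule ρ) u c → start ρ ≤ u → u < target ρ → linkE c ≡ true
linkE-true (before-start u<) s≤ <e = contradiction s≤ (ℕₚ.<⇒≱ u<)
linkE-true (at-start _) s≤ <e = refl
linkE-true (at-need _ _ _) s≤ <e = refl
linkE-true (at-pass _ _ _) s≤ <e = refl
linkE-true (at-target _ refl) s≤ <e = contradiction <e (ℕₚ.<-irrefl refl)
linkE-true (past-target _ e<) s≤ <e = contradiction <e (ℕₚ.<-asym e<)

linkE-false : ∀ {hubs ρ u c} → start ρ < target ρ → View hubs (rule ρ) u c →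
  ¬ (start ρ ≤ u × u < target ρ) → linkE c ≡ false
linkE-false v (before-start _) ¬in = refl
linkE-false s<e (at-start refl) ¬in = contradiction (ℕₚ.≤-refl , s<e) ¬in
linkE-false v (at-need s< <e _) ¬in = contradiction (ℕₚ.<⇒≤ s< , <e) ¬in
linkE-false v (at-pass s< <e _) ¬in = contradiction (ℕₚ.<⇒≤ s< , <e) ¬in
linkE-false v (at-target _ _) ¬in = refl
linkE-false v (past-target _ _) ¬in = refl

linkW-true : ∀ {hubs ρ u c} → View hubs (rule ρ) u c → start ρ < u → u ≤ target ρ → linkW c ≡ true
linkW-true (before-start u<) s< ≤e = contradiction s< (ℕₚ.<-asym u<)
linkW-true (at-start refl) s< ≤e = contradiction s< (ℕₚ.<-irrefl refl)
linkW-true (at-need _ _ _) s< ≤e = refl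
linkW-true (at-pass _ _ _) s< ≤e = refl
linkW-true (at-target _ _) s< ≤e = refl
linkW-true (past-target _ e<) s< ≤e = contradiction ≤e (ℕₚ.<⇒≱ e<)

linkW-false : ∀ {hubs ρ u c} → View hubs (rule ρ) u c → ¬ (start ρ < u × u ≤ target ρ) → linkW c ≡ false
linkW-false (before-start _) ¬in = refl
linkW-false (at-start _) ¬in = refl
linkW-false (at-need s< <e _) ¬in = contradiction (s< , ℕₚ.<⇒≤ <e) ¬in
linkW-false (at-pass s< <e _) ¬in = contradiction (s< , ℕₚ.<⇒≤ <e) ¬in
linkW-false (at-target s< refl) ¬in = contradiction (s< , ℕₚ.≤-refl) ¬in
linkW-false (past-target _ _) ¬in = refl

bus-linkE : ∀ {hubs u c} → View hubs bus u c → linkE c ≡ true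
bus-linkE (at-hub _) = refl
bus-linkE (no-hub _) = refl

bus-linkW : ∀ {hubs u c} → View hubs bus u c → linkW c ≡ true
bus-linkW (at-hub _) = refl
bus-linkW (no-hub _) = refl

-- A rule occupies a window of four blocks of w columns.  Windows that start at
-- neighbouring blocks overlap, hence each rule has one row for every residue m
-- modulo 4 of the starting block.
module Array (k : ℕ) (rules : List Rule) (valid : ∀ {ρ} → ρ ∈ rules → Valid (4 * suc k) ρ) where

  w W : ℕ
  w = suc k
  W = 4 * w

  -- Column 0 of each of the four blocks of a window, hence of every block of the line.
  hubs : List ℕ
  hubs = map (_* w) (upTo 4)

  Slot : Set
  Slot = Pattern × ℕ

  table : List Slot
  table = (bus , 0) ∷ cartesianProduct (map rule rules) (upTo 4)

  R : ℕ
  R = length table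

  slot : ℤ → Slot
  slot Z = nth (bus , 0) table (Z %ℕ R)

  -- The line is tiled by windows of width `W`, with a window starting at block `m`. Here `place` is
  -- the position inside a window, `window` its number, and `pos` the inverse of the pair.
  place : ℕ → ℤ → ℕ
  place m X = (X ℤ.- + (m * w)) %ℕ W

  window : ℕ → ℤ → ℤ
  window m X = (X ℤ.- + (m * w)) /ℕ W

  pos : ℕ → ℤ → ℕ → ℤ
  pos m q u = + u ℤ.+ (q ℤ.* + W ℤ.+ + (m * w))

  classˢ : Slot → ℤ → Class
  classˢ (p , m) X = proj₁ (view hubs p (place m X))

  cls : ℤ → ℤ → Class
  cls Z X = classˢ (slot Z) X

  pos-place : ∀ m X → X ≡ pos m (window m X) (place m X)
  pos-place m X = begin
    X                                      ≡⟨ lemma X a ⟩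
    (X ℤ.- a) ℤ.+ a                        ≡⟨ cong (ℤ._+ a) (a≡a%ℕn+[a/ℕn]*n (X ℤ.- a) W) ⟩
    (+ u ℤ.+ q ℤ.* + W) ℤ.+ a              ≡⟨ ℤₚ.+-assoc (+ u) (q ℤ.* + W) a ⟩
    + u ℤ.+ (q ℤ.* + W ℤ.+ a)              ∎
    where
    open ≡-Reasoning
    a = + (m * w)
    u = place m X
    q = window m X
    lemma : ∀ x a → x ≡ (x ℤ.- a) ℤ.+ a
    lemma = ℤ-solver.solve-∀

  place-pos : ∀ m q {u} → u < W → place m (pos m q u) ≡ u × window m (pos m q u) ≡ q
  place-pos m q {u} u<W = %ℕ-/ℕ-unique W _ u<W (lemma (+ u) (q ℤ.* + W) (+ (m * w)))
    where
    lemma : ∀ u v a → (u ℤ.+ (v ℤ.+ a)) ℤ.- a ≡ u ℤ.+ v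
    lemma = ℤ-solver.solve-∀

  place<W : ∀ m X → place m X < W
  place<W m X = n%ℕd<d (X ℤ.- + (m * w)) W

  suc-pos : ∀ m q u → ℤ.suc (pos m q u) ≡ pos m q (suc u)
  suc-pos m q u = sym (ℤₚ.+-assoc (+ 1) (+ u) (q ℤ.* + W ℤ.+ + (m * w)))

  pred-pos : ∀ m q u → ℤ.pred (pos m q (suc u)) ≡ pos m q u
  pred-pos m q u = trans (cong ℤ.pred (sym (suc-pos m q u))) (ℤₚ.pred-suc (pos m q u))

  place-suc : ∀ m X → suc (place m X) < W → place m (ℤ.suc X) ≡ suc (place m X)
  place-suc m X <W = trans (cong (place m ∘ ℤ.suc) (pos-place m X))
    (trans (cong (place m) (suc-pos m (window m X) (place m X))) (proj₁ (place-pos m (window m X) <W)))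

  place-wrap : ∀ m X → suc (place m X) ≡ W → place m (ℤ.suc X) ≡ 0
  place-wrap m X ≡W = trans (cong (place m) e) (proj₁ (place-pos m (ℤ.suc q) (s≤s z≤n)))
    where
    open ≡-Reasoning
    q = window m X
    a = + (m * w)
    e : ℤ.suc X ≡ pos m (ℤ.suc q) 0
    e = begin
      ℤ.suc X                             ≡⟨ cong ℤ.suc (pos-place m X) ⟩
      ℤ.suc (pos m q (place m X))         ≡⟨ suc-pos m q (place m X) ⟩
      pos m q (suc (place m X))           ≡⟨ cong (pos m q) ≡W ⟩
      + W ℤ.+ (q ℤ.* + W ℤ.+ a)           ≡⟨ ℤₚ.+-assoc (+ W) (q ℤ.* + W) a ⟨
      (+ W ℤ.+ q ℤ.* + W) ℤ.+ a           ≡⟨ cong (ℤ._+ a) (ℤₚ.suc-* q (+ W)) ⟨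
      ℤ.suc q ℤ.* + W ℤ.+ a               ≡⟨ ℤₚ.+-identityˡ _ ⟨
      pos m (ℤ.suc q) 0                   ∎

  place-pred : ∀ m X {u} → place m X ≡ suc u →
    place m (ℤ.pred X) ≡ u × window m (ℤ.pred X) ≡ window m X
  place-pred m X {u} e = subst (λ Y → place m Y ≡ u × window m Y ≡ window m X)
    (sym (trans (cong ℤ.pred (trans (pos-place m X) (cong (pos m q) e))) (pred-pos m q u)))
    (place-pos m q (ℕₚ.<-trans (ℕₚ.n<1+n u) (subst (_< W) e (place<W m X))))
    where q = window m X

  data ValidSlot : Slot → Set where
    bus  : ValidSlot (bus , 0)
    rule : ∀ {ρ m} → ρ ∈ rules → ValidSlot (rule ρ , m)

  table-valid : ∀ {s} → s ∈ table → ValidSlot s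
  table-valid (here refl) = bus
  table-valid (there s∈) with p∈ , _ ← ∈ₚ.∈-cartesianProduct⁻ (map rule rules) (upTo 4) s∈
    with ρ , ρ∈ , refl ← ∈ₚ.∈-map⁻ rule p∈ = rule ρ∈

  slot-valid : ∀ Z → ValidSlot (slot Z)
  slot-valid Z = table-valid (nth-∈ (here refl) (Z %ℕ R))

  slot-at : ∀ {s} → s ∈ table → ∃[ Z ] slot Z ≡ s
  slot-at s∈ with n , n< , e ← ∈-nth {d = bus , 0} s∈ =
    + n , trans (cong (nth (bus , 0) table) (ℕ%.m<n⇒m%n≡m n<)) e

  -- The links of a rule fill the stretch from `start` to `target`, which ends before the window
  -- does. At the seam between two windows both sides therefore have no link.
  linkˢ : ∀ {s} → ValidSlot s → ∀ X → linkE (classˢ s X) ≡ linkW (classˢ s (ℤ.suc X))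
  linkˢ bus X = trans (bus-linkE (proj₂ (view hubs bus (place 0 X))))
    (sym (bus-linkW (proj₂ (view hubs bus (place 0 (ℤ.suc X))))))
  linkˢ (rule {ρ} {m} ρ∈) X = go (ℕₚ.m≤n⇒m<n∨m≡n (place<W m X))
    where
    open Valid (valid ρ∈)
    u = place m X
    V = proj₂ (view hubs (rule ρ) u)
    V′ = proj₂ (view hubs (rule ρ) (place m (ℤ.suc X)))
    go : suc u < W ⊎ suc u ≡ W → linkE (classˢ (rule ρ , m) X) ≡ linkW (classˢ (rule ρ , m) (ℤ.suc X))
    go (inj₂ ≡W) = trans
      (linkE-false start<end V λ (_ , u<e) →
        ℕₚ.<⇒≱ end<bound (ℕₚ.≤-trans (ℕₚ.≤-reflexive (sym ≡W)) u<e))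
      (sym (linkW-false V′ λ (s<u , _) → contradiction (subst (start ρ <_) (place-wrap m X ≡W) s<u) λ ()))
    go (inj₁ <W) with start ρ ℕₚ.≤? u | u ℕₚ.<? target ρ
    ... | yes s≤u | yes u<e = trans (linkE-true V s≤u u<e)
      (sym (linkW-true V′ (subst (start ρ <_) (sym e) (s≤s s≤u)) (subst (_≤ target ρ) (sym e) u<e)))
      where e = place-suc m X <W
    ... | no s≰u | _ = trans (linkE-false start<end V λ (s≤u , _) → s≰u s≤u)
      (sym (linkW-false V′ λ (s<u , _) → s≰u (ℕₚ.≤-pred (subst (start ρ <_) (place-suc m X <W) s<u))))
    ... | yes _ | no u≮e = trans (linkE-false start<end V λ (_ , u<e) → u≮e u<e)
      (sym (linkW-false V′ λ (_ , u≤e) → u≮e (subst (_≤ target ρ) (place-suc m X <W) u≤e)))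

  link : ∀ Z X → linkE (cls Z X) ≡ linkW (cls Z (ℤ.suc X))
  link Z = linkˢ (slot-valid Z)

  open Layout cls link public

  column : ℤ → ℕ → ℤ
  column B n = + n ℤ.+ B ℤ.* + w

  pos≡column : ∀ m q u → pos m q u ≡ column (q ℤ.* + 4 ℤ.+ + m) u
  pos≡column m q u = cong (ℤ._+_ (+ u)) (begin
    q ℤ.* + (4 * w) ℤ.+ + (m * w)            ≡⟨ cong₂ (λ a b → q ℤ.* a ℤ.+ b) (ℤₚ.pos-* 4 w) (ℤₚ.pos-* m w) ⟩
    q ℤ.* (+ 4 ℤ.* + w) ℤ.+ + m ℤ.* + w      ≡⟨ lemma q (+ 4) (+ w) (+ m) ⟩
    (q ℤ.* + 4 ℤ.+ + m) ℤ.* + w              ∎)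
    where
    open ≡-Reasoning
    lemma : ∀ q f w m → q ℤ.* (f ℤ.* w) ℤ.+ m ℤ.* w ≡ (q ℤ.* f ℤ.+ m) ℤ.* w
    lemma = ℤ-solver.solve-∀

  column≡pos : ∀ B → ∃[ m ] ∃[ q ] m < 4 × (∀ u → column B u ≡ pos m q u)
  column≡pos B = B %ℕ 4 , B /ℕ 4 , n%ℕd<d B 4 , λ u → trans
    (cong (λ B → column B u) (trans (a≡a%ℕn+[a/ℕn]*n B 4) (ℤₚ.+-comm (+ (B %ℕ 4)) (B /ℕ 4 ℤ.* + 4))))
    (sym (pos≡column (B %ℕ 4) (B /ℕ 4) u))

  -- What remains of `Model` once the rows are eliminated: atoms closed under the rules, and one
  -- truth value `G` shared by the bus and by all hub columns at all times.
  record Semantics : Set₁ where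
    field
      Atom : ℤ → ℤ → Set
      G    : Set
      hub⇒G : ∀ B {t} → Atom (column B 0) t → G
      G⇒hub : ∀ B {t} → G → Atom (column B 0) t
      apply : ∀ {ρ} → ρ ∈ rules → ∀ B {t} → Atom (column B (start ρ)) t →
              (∀ {n} → n ∈ rest ρ → Atom (column B n) t) → Atom (column B (target ρ)) (ℤ.suc t)

  module _ (S : Semantics) where
    open Semantics S

    private
      -- The conjunction of what the row has read at `X` or west of it. It can always be shortened,
      -- by `shrink`, which makes backward flow sound.
      Rowˢ : Slot → ℤ → ℤ → Set
      Rowˢ (bus , _)    X t = G
      Rowˢ (rule ρ , m) X t = Atom (pos m q (start ρ)) t ×
        (∀ {n} → n ∈ rest ρ → n ≤ place m X → Atom (pos m q n) t)
        where q = window m X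

      here⇒ : ∀ m X {u t} → place m X ≡ u → Atom X t → Atom (pos m (window m X) u) t
      here⇒ m X {t = t} e a = subst (λ X → Atom X t) (trans (pos-place m X) (cong (pos m (window m X)) e)) a

      ⇒here : ∀ m X {u t} → place m X ≡ u → Atom (pos m (window m X) u) t → Atom X t
      ⇒here m X {t = t} e a = subst (λ X → Atom X t) (sym (trans (pos-place m X) (cong (pos m (window m X)) e))) a

      hub-column : ∀ X → place 0 X ∈ hubs → ∃[ B ] X ≡ column B 0
      hub-column X u∈ with m , _ , e ← ∈ₚ.∈-map⁻ (_* w) {xs = upTo 4} u∈ = q ℤ.* + 4 ℤ.+ + m , (begin
        X                          ≡⟨ pos-place 0 X ⟩
        pos 0 q (place 0 X)        ≡⟨ cong (pos 0 q) e ⟩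
        pos 0 q (m * w)            ≡⟨ cong (ℤ._+_ (+ (m * w))) (ℤₚ.+-identityʳ (q ℤ.* + W)) ⟩
        + (m * w) ℤ.+ q ℤ.* + W    ≡⟨ ℤₚ.+-comm (+ (m * w)) (q ℤ.* + W) ⟩
        q ℤ.* + W ℤ.+ + (m * w)    ≡⟨ ℤₚ.+-identityˡ _ ⟨
        pos m q 0                  ≡⟨ pos≡column m q 0 ⟩
        column (q ℤ.* + 4 ℤ.+ + m) 0 ∎)
        where
        open ≡-Reasoning
        q = window 0 X

      hub⇒ˢ : ∀ X {t} → place 0 X ∈ hubs → Atom X t → G
      hub⇒ˢ X {t} u∈ a with B , e ← hub-column X u∈ = hub⇒G B (subst (λ X → Atom X t) e a)

      ⇒hubˢ : ∀ X {t} → place 0 X ∈ hubs → G → Atom X t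
      ⇒hubˢ X {t} u∈ g with B , e ← hub-column X u∈ = subst (λ X → Atom X t) (sym e) (G⇒hub B g)

      extend : ∀ {ρ} m X {t} → start ρ < place m X →
        (∀ {n} → n ∈ rest ρ → n ≡ place m X → Atom (pos m (window m X) n) t) →
        Rowˢ (rule ρ , m) (ℤ.pred X) t → Rowˢ (rule ρ , m) X t
      extend {ρ} m X s<u new row with place m X in eq
      extend {ρ} m X () new row | zero
      ... | suc u with eu , ew ← place-pred m X eq rewrite eu | ew = proj₁ row , λ n∈ n≤u →
        go n∈ (ℕₚ.m≤n⇒m<n∨m≡n n≤u)
        where
        go : ∀ {n} → n ∈ rest ρ → n < suc u ⊎ n ≡ suc u → Atom (pos m (window m X) n) _
        go n∈ (inj₁ n<) = proj₂ row n∈ (ℕₚ.≤-pred n<)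
        go n∈ (inj₂ n≡) = new n∈ n≡

      shrink : ∀ {ρ} m X {t} → start ρ < place m X →
        Rowˢ (rule ρ , m) X t → Rowˢ (rule ρ , m) (ℤ.pred X) t
      shrink {ρ} m X s<u row with place m X in eq
      shrink {ρ} m X () row | zero
      ... | suc u with eu , ew ← place-pred m X eq rewrite eu | ew =
        proj₁ row , λ n∈ n≤u → proj₂ row n∈ (ℕₚ.m≤n⇒m≤1+n n≤u)

    model : Model
    model = record
      { Atom = Atom
      ; Row  = λ Z X t → Rowˢ (slot Z) X t
      ; first⇒ = λ {Z} {X} e → f⇒ (slot-valid Z) X (viewed Z X e)
      ; ⇒first = λ {Z} {X} e → ⇒f (slot-valid Z) X (viewed Z X e)
      ; need⇒ = λ {Z} {X} e → n⇒ (slot-valid Z) X (viewed Z X e)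
      ; ⇒need = λ {Z} {X} e → ⇒n (slot-valid Z) X (viewed Z X e)
      ; pass⇒ = λ {Z} {X} e → p⇒ (slot-valid Z) X (viewed Z X e)
      ; ⇒pass = λ {Z} {X} e → ⇒p (slot-valid Z) X (viewed Z X e)
      ; out⇒ = λ {Z} {X} e → o⇒ (slot-valid Z) X (viewed Z X e)
      ; ⇒out = λ {Z} {X} e → ⇒o (slot-valid Z) X (viewed Z X e)
      ; write = λ {Z} {X} e → wr (slot-valid Z) X (viewed Z X e)
      ; hub⇒ = λ {Z} {X} e → h⇒ (slot-valid Z) X (viewed Z X e)
      ; ⇒hub = λ {Z} {X} e → ⇒h (slot-valid Z) X (viewed Z X e)
      ; hub⇒atom = λ {Z} {X} e → ha (slot-valid Z) X (viewed Z X e)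
      ; atom⇒hub = λ {Z} {X} e → ah (slot-valid Z) X (viewed Z X e)
      ; hub-suc = λ {Z} {X} e a → aa (slot-valid Z) X (viewed Z X e) a
      ; hub-pred = λ {Z} {X} e a → aa (slot-valid Z) X (viewed Z X e) a
      }
      where
      Seen : Slot → ℤ → Class → Set
      Seen (p , m) X c = View hubs p (place m X) c

      viewed : ∀ Z X {c} → cls Z X ≡ c → Seen (slot Z) X c
      viewed Z X refl = proj₂ (view hubs (proj₁ (slot Z)) (place (proj₂ (slot Z)) X))

      f⇒ : ∀ {s} → ValidSlot s → ∀ X {t} → Seen s X first → Rowˢ s X t → Atom X t
      f⇒ (rule {ρ} {m} _) X (at-start e) (a , _) = ⇒here m X e a

      ⇒f : ∀ {s} → ValidSlot s → ∀ X {t} → Seen s X first → Atom X t → Rowˢ s X t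
      ⇒f (rule {ρ} {m} ρ∈) X (at-start e) a = here⇒ m X e a , λ n∈ n≤u →
        contradiction (Valid.start<rest (valid ρ∈) n∈) (ℕₚ.≤⇒≯ (subst (_ ≤_) e n≤u))

      n⇒ : ∀ {s} → ValidSlot s → ∀ X {t} → Seen s X need → Rowˢ s X t → Rowˢ s (ℤ.pred X) t × Atom X t
      n⇒ (rule {ρ} {m} _) X (at-need s<u _ u∈) r = shrink {ρ} m X s<u r , ⇒here m X refl (proj₂ r u∈ ℕₚ.≤-refl)

      ⇒n : ∀ {s} → ValidSlot s → ∀ X {t} → Seen s X need → Rowˢ s (ℤ.pred X) t → Atom X t → Rowˢ s X t
      ⇒n (rule {ρ} {m} _) X (at-need s<u _ u∈) r a =
        extend {ρ} m X s<u (λ { _ refl → here⇒ m X refl a }) r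

      p⇒ : ∀ {s} → ValidSlot s → ∀ X {t} → Seen s X pass → Rowˢ s X t → Rowˢ s (ℤ.pred X) t
      p⇒ bus X _ g = g
      p⇒ (rule {ρ} {m} _) X (at-pass s<u _ _) r = shrink {ρ} m X s<u r

      ⇒p : ∀ {s} → ValidSlot s → ∀ X {t} → Seen s X pass → Rowˢ s (ℤ.pred X) t → Rowˢ s X t
      ⇒p bus X _ g = g
      ⇒p (rule {ρ} {m} _) X (at-pass s<u _ u∉) r =
        extend {ρ} m X s<u (λ { n∈ refl → contradiction n∈ u∉ }) r

      o⇒ : ∀ {s} → ValidSlot s → ∀ X {t} → Seen s X out → Rowˢ s X t → Rowˢ s (ℤ.pred X) t
      o⇒ (rule {ρ} {m} _) X (at-target s<u _) r = shrink {ρ} m X s<u r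

      ⇒o : ∀ {s} → ValidSlot s → ∀ X {t} → Seen s X out → Rowˢ s (ℤ.pred X) t → Rowˢ s X t
      ⇒o (rule {ρ} {m} ρ∈) X (at-target s<u e) r = extend {ρ} m X s<u
        (λ n∈ n≡u → contradiction (Valid.rest<end (valid ρ∈) n∈) (ℕₚ.≤⇒≯ (ℕₚ.≤-reflexive (sym (trans n≡u e))))) r

      wr : ∀ {s} → ValidSlot s → ∀ X {t} → Seen s X out → Rowˢ s X t → Atom X (ℤ.suc t)
      wr (rule {ρ} {m} ρ∈) X {t} (at-target s<u e) (a , as) = ⇒here m X e
        (subst (λ X → Atom X (ℤ.suc t)) (sym (pos≡column m q (target ρ)))
          (apply ρ∈ (q ℤ.* + 4 ℤ.+ + m) (subst (λ X → Atom X t) (pos≡column m q (start ρ)) a)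
            λ {n} n∈ → subst (λ X → Atom X t) (pos≡column m q n)
              (as n∈ (ℕₚ.≤-trans (ℕₚ.<⇒≤ (Valid.rest<end (valid ρ∈) n∈)) (ℕₚ.≤-reflexive (sym e))))))
        where q = window m X

      h⇒ : ∀ {s} → ValidSlot s → ∀ X {t} → Seen s X hub → Rowˢ s X t → Rowˢ s (ℤ.pred X) t
      h⇒ bus X _ g = g

      ⇒h : ∀ {s} → ValidSlot s → ∀ X {t} → Seen s X hub → Rowˢ s (ℤ.pred X) t → Rowˢ s X t
      ⇒h bus X _ g = g

      ha : ∀ {s} → ValidSlot s → ∀ X {t} → Seen s X hub → Rowˢ s X t → Atom X t
      ha bus X (at-hub u∈) g = ⇒hubˢ X u∈ g

      ah : ∀ {s} → ValidSlot s → ∀ X {t} → Seen s X hub → Atom X t → Rowˢ s X t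
      ah bus X (at-hub u∈) a = hub⇒ˢ X u∈ a

      aa : ∀ {s} → ValidSlot s → ∀ X {t t′} → Seen s X hub → Atom X t → Atom X t′
      aa bus X (at-hub u∈) a = ⇒hubˢ X u∈ (hub⇒ˢ X u∈ a)

  module ClosedArray (T : Site → Set)
    (wire-closed : ∀ σ d → kindˢ σ ≡ wire → T (stepˢ d σ) → T σ)
    (gate-closed : ∀ σ d d′ → kindˢ σ ≡ gate → d ≢ d′ → T (stepˢ d σ) → T (stepˢ d′ σ) → T σ) where

    open Closed T wire-closed gate-closed

    private
      class-pos : ∀ {Z p m} → slot Z ≡ (p , m) → ∀ q {u} → u < W → cls Z (pos m q u) ≡ proj₁ (view hubs p u)
      class-pos {Z} {p} {m} e q {u} u<W = trans (cong (λ s → classˢ s (pos m q u)) e)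
        (cong (λ u → proj₁ (view hubs p u)) (proj₁ (place-pos m q u<W)))

      module _ {ρ} (ρ∈ : ρ ∈ rules) {Z m} (e : slot Z ≡ (rule ρ , m)) (q t : ℤ)
        (τ : Line (pos m q (start ρ)) t) (τs : ∀ {n} → n ∈ rest ρ → Line (pos m q n) t) where
        open Valid (valid ρ∈)

        progress : ∀ d → start ρ + d < target ρ → Rowᵀ Z (pos m q (start ρ + d)) t
        progress zero <e rewrite ℕₚ.+-identityʳ (start ρ)
          with view hubs (rule ρ) (start ρ) | class-pos {Z} {rule ρ} {m} e q (ℕₚ.<-trans <e end<bound)
        ... | _ , before-start lt | _ = contradiction lt (ℕₚ.<-irrefl refl)
        ... | _ , at-start _ | c = first-row {Z} {pos m q (start ρ)} c τ
        ... | _ , at-need lt _ _ | _ = contradiction lt (ℕₚ.<-irrefl refl)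
        ... | _ , at-pass lt _ _ | _ = contradiction lt (ℕₚ.<-irrefl refl)
        ... | _ , at-target lt _ | _ = contradiction lt (ℕₚ.<-irrefl refl)
        ... | _ , past-target lt _ | _ = contradiction lt (ℕₚ.<-irrefl refl)
        progress (suc d) <e rewrite ℕₚ.+-suc (start ρ) d
          with view hubs (rule ρ) (suc (start ρ + d)) | class-pos {Z} {rule ρ} {m} e q (ℕₚ.<-trans <e end<bound)
             | subst (λ X → Rowᵀ Z X t) (sym (pred-pos m q (start ρ + d))) (progress d (ℕₚ.<-trans (ℕₚ.n<1+n _) <e))
        ... | _ , before-start lt | _ | _ = contradiction lt (ℕₚ.≤⇒≯ (ℕₚ.m≤n⇒m≤1+n (ℕₚ.m≤m+n (start ρ) d)))
        ... | _ , at-start eq | _ | _ = contradiction (ℕₚ.≤-reflexive eq) (ℕₚ.<⇒≱ (s≤s (ℕₚ.m≤m+n (start ρ) d)))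
        ... | _ , at-need _ _ n∈ | c | r = need-row {Z} {pos m q (suc (start ρ + d))} c r (τs n∈)
        ... | _ , at-pass _ _ _ | c | r = pass-row {Z} {pos m q (suc (start ρ + d))} c r
        ... | _ , at-target _ eq | _ | _ = contradiction <e (ℕₚ.<-irrefl eq)
        ... | _ , past-target _ gt | _ | _ = contradiction <e (ℕₚ.<-asym gt)

        finish : ∀ d → suc (start ρ + d) ≡ target ρ → Line (pos m q (target ρ)) (ℤ.suc t)
        finish d ≡e with view hubs (rule ρ) (target ρ) | class-pos {Z} {rule ρ} {m} e q end<bound
          | subst (λ X → Rowᵀ Z X t) (sym (trans (cong (λ u → ℤ.pred (pos m q u)) (sym ≡e)) (pred-pos m q (start ρ + d))))
              (progress d (ℕₚ.≤-reflexive ≡e))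
        ... | _ , before-start lt | _ | _ = contradiction start<end (ℕₚ.<-asym lt)
        ... | _ , at-start eq | _ | _ = contradiction start<end (ℕₚ.<-irrefl (sym eq))
        ... | _ , at-need _ lt _ | _ | _ = contradiction lt (ℕₚ.<-irrefl refl)
        ... | _ , at-pass _ lt _ | _ | _ = contradiction lt (ℕₚ.<-irrefl refl)
        ... | _ , at-target _ _ | c | r = out-row {Z} {pos m q (target ρ)} c r
        ... | _ , past-target _ lt | _ | _ = contradiction lt (ℕₚ.<-irrefl refl)

    -- The residue of `B` modulo 4 selects, among the four rows of the rule, the one with a window
    -- that starts at block `B`.
    apply-line : ∀ {ρ} → ρ ∈ rules → ∀ B {t} → Line (column B (start ρ)) t →
      (∀ {n} → n ∈ rest ρ → Line (column B n) t) → Line (column B (target ρ)) (ℤ.suc t)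
    apply-line {ρ} ρ∈ B {t} τ τs
      with m , q , m<4 , eq ← column≡pos B
      with Z , e ← slot-at (there (∈ₚ.∈-cartesianProduct⁺ (∈ₚ.∈-map⁺ rule ρ∈) (∈ₚ.∈-upTo⁺ m<4)))
      with d , ≡e ← ℕₚ.m≤n⇒∃[o]m+o≡n (Valid.start<end (valid ρ∈)) =
      subst (λ X → Line X (ℤ.suc t)) (sym (eq (target ρ)))
        (finish ρ∈ {Z} {m} e q t (subst (λ X → Line X t) (eq (start ρ)) τ)
          (λ {n} n∈ → subst (λ X → Line X t) (eq n) (τs n∈)) d ≡e)

    broadcast-line : ∀ B B′ {t t′} → Line (column B 0) t → Line (column B′ 0) t′
    broadcast-line B B′ = broadcast (hub-class B) (hub-class B′)
      where
      bus-view : ∀ X → ∀ {c} → View hubs bus (place 0 X) c → c ≡ pass ⊎ c ≡ hub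
      bus-view X (at-hub _) = inj₂ refl
      bus-view X (no-hub _) = inj₁ refl
      open Bus (+ 0) (λ X → bus-view X (proj₂ (view hubs bus (place 0 X))))
      hub-class : ∀ B → cls (+ 0) (column B 0) ≡ hub
      hub-class B with m , q , m<4 , eq ← column≡pos B = go (proj₂ (view hubs bus (place 0 (column B 0))))
        where
        placed : place 0 (column B 0) ≡ m * w
        placed = trans (cong (place 0) (begin
          column B 0                          ≡⟨ eq 0 ⟩
          + 0 ℤ.+ (q ℤ.* + W ℤ.+ + (m * w))   ≡⟨ ℤₚ.+-identityˡ _ ⟩
          q ℤ.* + W ℤ.+ + (m * w)             ≡⟨ ℤₚ.+-comm (q ℤ.* + W) (+ (m * w)) ⟩
          + (m * w) ℤ.+ q ℤ.* + W             ≡⟨ cong (ℤ._+_ (+ (m * w))) (ℤₚ.+-identityʳ (q ℤ.* + W)) ⟨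
          pos 0 q (m * w)                     ∎))
          (proj₁ (place-pos 0 q (ℕₚ.*-monoˡ-< w m<4)))
          where open ≡-Reasoning
        go : ∀ {c} → View hubs bus (place 0 (column B 0)) c → c ≡ hub
        go (at-hub _) = refl
        go (no-hub u∉) = contradiction (subst (_∈ hubs) (sym placed) (∈ₚ.∈-map⁺ (_* w) (∈ₚ.∈-upTo⁺ m<4))) u∉

-- Machines with one tape

offset : Direction → ℤ
offset left  = -[1+ 0 ]
offset right = + 1

module Machine (Γ Q : Set) (blank : Γ) (δ : Q → Γ → (Q ⊎ Bool) × Γ × Direction) where

  Strip : Set
  Strip = List Γ × Γ × List Γ

  Config : Set
  Config = (Q ⊎ Bool) × Strip

  pop : List Γ → Γ × List Γ
  pop []       = blank , []
  pop (a ∷ as) = a , as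

  shift : Direction → Strip → Strip
  shift left  (ls , a , rs) = let b , ls′ = pop ls in ls′ , b , a ∷ rs
  shift right (ls , a , rs) = let b , rs′ = pop rs in a ∷ ls , b , rs′

  next : Config → Config
  next (inj₂ b , τ)           = inj₂ b , τ
  next (inj₁ q , ls , a , rs) = let c , a′ , d = δ q a in c , shift d (ls , a′ , rs)

  drift : Config → ℤ
  drift (inj₂ _ , _)         = + 0
  drift (inj₁ q , _ , a , _) = offset (proj₂ (proj₂ (δ q a)))

  iterate : ℕ → Config → Config
  iterate zero    c = c
  iterate (suc n) c = next (iterate n c)

  halted-stays : ∀ k n {c b} → proj₁ (iterate n c) ≡ inj₂ b → proj₁ (iterate (k + n) c) ≡ inj₂ b
  halted-stays zero    n e = e
  halted-stays (suc k) n {c} e = stays (iterate (k + n) c) (halted-stays k n e)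
    where
    stays : ∀ c {b} → proj₁ c ≡ inj₂ b → proj₁ (next c) ≡ inj₂ b
    stays (inj₂ _ , _) e = e

  verdict-unique : ∀ m n {c b b′} → proj₁ (iterate m c) ≡ inj₂ b → proj₁ (iterate n c) ≡ inj₂ b′ → b ≡ b′
  verdict-unique m n {c} e e′ = inj₂-injective (trans (sym (halted-stays n m e))
    (trans (cong (λ k → proj₁ (iterate k c)) (ℕₚ.+-comm n m)) (halted-stays m n e′)))

  scan : Strip → Γ
  scan (_ , a , _) = a

  at : Strip → ℤ → Γ
  at (ls , a , rs) (+ zero)  = a
  at (ls , a , rs) (+ suc k) = nth blank rs k
  at (ls , a , rs) -[1+ k ]  = nth blank ls k

  at-shift : ∀ d τ i → at (shift d τ) (i ℤ.- offset d) ≡ at τ i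
  at-shift right (ls , a , rs) (+ zero) = refl
  at-shift right (ls , a , []) (+ suc zero) = refl
  at-shift right (ls , a , _ ∷ _) (+ suc zero) = refl
  at-shift right (ls , a , []) (+ suc (suc k)) = refl
  at-shift right (ls , a , _ ∷ _) (+ suc (suc k)) = refl
  at-shift right (ls , a , rs) -[1+ k ] rewrite ℕₚ.+-identityʳ k = refl
  at-shift left (ls , a , rs) (+ k) rewrite ℕₚ.+-comm k 1 with k
  ... | zero = refl
  ... | suc k = refl
  at-shift left ([] , a , rs) -[1+ zero ] = refl
  at-shift left (_ ∷ _ , a , rs) -[1+ zero ] = refl
  at-shift left ([] , a , rs) -[1+ suc k ] = refl
  at-shift left (_ ∷ _ , a , rs) -[1+ suc k ] = refl

  module Trace (c₀ : Config) where

    conf : ℕ → Config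
    conf n = iterate n c₀

    pos : ℕ → ℤ
    pos zero    = + 0
    pos (suc n) = drift (conf n) ℤ.+ pos n

    -- In absolute coordinates, in which a cell of the automaton stays the same cell, whereas `at`
    -- counts from the moving head.
    tape : ℕ → ℤ → Γ
    tape n x = at (proj₂ (conf n)) (x ℤ.- pos n)

    written : Config → Γ
    written (inj₂ _ , _ , a , _) = a
    written (inj₁ q , _ , a , _) = proj₁ (proj₂ (δ q a))

    private
      x-x : ∀ {x y} → x ≡ y → x ℤ.- y ≡ + 0
      x-x {x} refl = ℤₚ.+-inverseʳ x

      shifted : ∀ x d p → x ℤ.- (d ℤ.+ p) ≡ (x ℤ.- p) ℤ.- d
      shifted = ℤ-solver.solve-∀

    tape-pos : ∀ n {x} → x ≡ pos n → tape n x ≡ scan (proj₂ (conf n))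
    tape-pos n e rewrite x-x e = refl

    tape-suc-pos : ∀ n {x} → x ≡ pos n → tape (suc n) x ≡ written (conf n)
    tape-suc-pos n {x} e with conf n
    ... | inj₂ b , ls , a , rs rewrite ℤₚ.+-identityˡ (pos n) | x-x e = refl
    ... | inj₁ q , ls , a , rs rewrite shifted x (offset (proj₂ (proj₂ (δ q a)))) (pos n) =
      trans (at-shift (proj₂ (proj₂ (δ q a))) _ (x ℤ.- pos n)) (cong (at _) (x-x e))

    tape-suc : ∀ n {x} → x ≢ pos n → tape (suc n) x ≡ tape n x
    tape-suc n {x} x≢ with conf n
    ... | inj₂ b , ls , a , rs rewrite ℤₚ.+-identityˡ (pos n) = refl
    ... | inj₁ q , ls , a , rs rewrite shifted x (offset (proj₂ (proj₂ (δ q a)))) (pos n) =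
      trans (at-shift (proj₂ (proj₂ (δ q a))) _ (x ℤ.- pos n)) (other (x ℤ.- pos n) (x≢ ∘ ℤₚ.i-j≡0⇒i≡j x (pos n)))
      where
      other : ∀ i → i ≢ + 0 → at (ls , proj₁ (proj₂ (δ q a)) , rs) i ≡ at (ls , a , rs) i
      other (+ zero) i≢ = contradiction refl i≢
      other (+ suc k) i≢ = refl
      other -[1+ k ] i≢ = refl

    drift-≤ : ∀ c → drift c ℤ.≤ + 1
    drift-≤ (inj₂ _ , _) = ℤ.+≤+ z≤n
    drift-≤ (inj₁ q , _ , a , _) with proj₂ (proj₂ (δ q a))
    ... | left = ℤ.-≤+
    ... | right = ℤₚ.≤-refl

    drift-≥ : ∀ c → -[1+ 0 ] ℤ.≤ drift c
    drift-≥ (inj₂ _ , _) = ℤ.-≤+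
    drift-≥ (inj₁ q , _ , a , _) with proj₂ (proj₂ (δ q a))
    ... | left = ℤₚ.≤-refl
    ... | right = ℤ.-≤+

    pos-≥ : ∀ n → ℤ.- + n ℤ.≤ pos n
    pos-≥ zero = ℤₚ.≤-refl
    pos-≥ (suc n) = subst (ℤ._≤ pos (suc n)) (sym (ℤₚ.neg-suc n)) (ℤₚ.+-mono-≤ (drift-≥ (conf n)) (pos-≥ n))

    module _ (starts-left : drift c₀ ≡ -[1+ 0 ]) where

      -- The right edge of the automaton moves by one cell per step, as fast as a head can. The
      -- first move to the left keeps the head behind it, so that the head never enters a cell in
      -- the very step in which the edge leaves a blank there.
      pos-< : ∀ n → pos (suc n) ℤ.< + n
      pos-< zero = subst (λ d → d ℤ.+ + 0 ℤ.< + 0) (sym starts-left) ℤ.-<+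
      pos-< (suc n) = ℤₚ.+-mono-≤-< (drift-≤ (conf (suc n))) (pos-< n)

      pos-≤ : ∀ n → pos n ℤ.≤ + n
      pos-≤ zero = ℤₚ.≤-refl
      pos-≤ (suc n) = ℤₚ.≤-trans (ℤₚ.<⇒≤ (pos-< n)) (ℤ.+≤+ (ℕₚ.n≤1+n n))

      untouched-right : ∀ n {x} → + n ℤ.≤ x → tape n x ≡ at (proj₂ c₀) (x ℤ.- + 0)
      untouched-right zero n≤x = refl
      untouched-right (suc n) n<x = trans
        (tape-suc n λ e → ℤₚ.<⇒≱ (ℤₚ.suc[i]≤j⇒i<j n<x) (subst (ℤ._≤ + n) (sym e) (pos-≤ n)))
        (untouched-right n (ℤₚ.≤-trans (ℤ.+≤+ (ℕₚ.n≤1+n n)) n<x))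

    untouched-left : ∀ n {x} → x ℤ.< ℤ.- + n → tape n x ≡ at (proj₂ c₀) (x ℤ.- + 0)
    untouched-left zero x< = refl
    untouched-left (suc n) {x} x< = trans
      (tape-suc n λ e → ℤₚ.<⇒≱ x<n (subst (ℤ.- + n ℤ.≤_) (sym e) (pos-≥ n)))
      (untouched-left n x<n)
      where
      x<n : x ℤ.< ℤ.- + n
      x<n = ℤₚ.<-≤-trans x< (ℤₚ.neg-mono-≤ (ℤ.+≤+ (ℕₚ.n≤1+n n)))

-- The machine as a cellular automaton

position : ∀ {A : Set} {a : A} {as} → a ∈ as → ℕ
position (here _)   = 0
position (there a∈) = suc (position a∈)

position< : ∀ {A : Set} {a : A} {as} (a∈ : a ∈ as) → position a∈ < length as
position< (here _)   = s≤s z≤n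
position< (there a∈) = s≤s (position< a∈)

nth-position : ∀ {A : Set} {d a : A} {as} (a∈ : a ∈ as) → nth d as (position a∈) ≡ a
nth-position (here refl) = refl
nth-position (there a∈)  = nth-position a∈

record Finite (A : Set) : Set where
  field
    elements : List A
    complete : ∀ a → a ∈ elements

open Finite

module Automaton {Γ Q : Set} (finΓ : Finite Γ) (finQ : Finite Q)
  (blank filler home : Γ) (item : Maybe Letter → Γ)
  (δ : Q → Γ → (Q ⊎ Bool) × Γ × Direction) (q₀ : Q)
  (starts-left : proj₂ (proj₂ (δ q₀ home)) ≡ left) where

  open Machine Γ Q blank δ

  data State : Set where
    Hub Boot Left Right : State
    Inj   : Maybe Letter → State
    plain : Γ → State
    head  : Q ⊎ Bool → Γ → State

  control : List (Q ⊎ Bool)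
  control = inj₂ true ∷ inj₂ false ∷ map inj₁ (elements finQ)

  control-complete : ∀ c → c ∈ control
  control-complete (inj₂ true)  = here refl
  control-complete (inj₂ false) = there (here refl)
  control-complete (inj₁ q)     = there (there (∈ₚ.∈-map⁺ inj₁ (complete finQ q)))

  -- The order matters. The states that seeds inject come first, so that their columns, and with
  -- them the codes of the seeds, are the same for every machine. `Hub` precedes them all because
  -- the hubs and the origin lie in column 0.
  others : List State
  others = Boot ∷ Inj (just one) ∷ Inj (just minus) ∷ Inj (just end) ∷ Inj nothing ∷ Left ∷ Right ∷
    map plain (elements finΓ) ++ map (uncurry head) (cartesianProduct control (elements finΓ))

  states : List State
  states = Hub ∷ others

  states-complete : ∀ s → s ∈ states
  states-complete Hub                = here refl
  states-complete Boot               = there (here refl)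
  states-complete (Inj (just one))   = there (there (here refl))
  states-complete (Inj (just minus)) = there (there (there (here refl)))
  states-complete (Inj (just end))   = there (there (there (there (here refl))))
  states-complete (Inj nothing)      = there (there (there (there (there (here refl)))))
  states-complete Left               = there (there (there (there (there (there (here refl))))))
  states-complete Right              = there (there (there (there (there (there (there (here refl)))))))
  states-complete (plain a)          = there (there (there (there (there (there (there (there
    (∈ₚ.∈-++⁺ˡ (∈ₚ.∈-map⁺ plain (complete finΓ a))))))))))
  states-complete (head c a)         = there (there (there (there (there (there (there (there
    (∈ₚ.∈-++⁺ʳ (map plain (elements finΓ)) (∈ₚ.∈-map⁺ (uncurry head)
      (∈ₚ.∈-cartesianProduct⁺ (control-complete c) (complete finΓ a)))))))))))

  k : ℕ
  k = length others

  col : State → ℕ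
  col s = position (states-complete s)

  col< : ∀ s → col s < suc k
  col< s = position< (states-complete s)

  col-injective : ∀ {s s′} → col s ≡ col s′ → s ≡ s′
  col-injective {s} {s′} e = trans (sym (nth-position {d = Hub} (states-complete s)))
    (trans (cong (nth Hub states) e) (nth-position (states-complete s′)))

  sends : Direction → Direction → Q ⊎ Bool → Maybe (Q ⊎ Bool)
  sends left  left  c = just c
  sends right right c = just c
  sends _     _     _ = nothing

  moves : Direction → State → Maybe (Q ⊎ Bool)
  moves d (head (inj₁ q) a) = let c , _ , d′ = δ q a in sends d d′ c
  moves _ _                 = nothing

  arrive : Maybe (Q ⊎ Bool) → Maybe (Q ⊎ Bool) → Γ → State
  arrive (just c) _        a = head c a
  arrive nothing  (just c) a = head c a
  arrive nothing  nothing  a = plain a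

  -- The centre decides whether there is a value at all: the states of the edges, `Boot` and `Hub`
  -- have none here, and the next state near an edge comes from `produces`.
  local : State → State → State → Maybe State
  local l (plain a) r         = just (arrive (moves right l) (moves left r) a)
  local l (head (inj₁ q) a) r = just (plain (proj₁ (proj₂ (δ q a))))
  local l (head (inj₂ b) a) r = just (head (inj₂ b) a)
  local l _ r                 = nothing

  -- The pairs (j , s′) such that s at x and time t yields s′ at x + j - 2 and
  -- time t + 1.
  produces : State → List (ℕ × State)
  produces Boot                  = (1 , plain filler) ∷ (2 , head (inj₁ q₀) home) ∷ (3 , Right) ∷ []
  produces (Inj (just ℓ))        = (1 , plain filler) ∷ (2 , plain (item (just ℓ))) ∷ []
  produces (Inj nothing)         = (1 , Left) ∷ (2 , plain (item nothing)) ∷ []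
  produces Left                  = (1 , Left) ∷ (2 , plain blank) ∷ []
  produces Right                 = (2 , plain blank) ∷ (3 , Right) ∷ []
  produces (head (inj₂ false) a) = (1 , Hub) ∷ []
  produces _                     = []

  width : ℕ
  width = suc k

  -- The right neighbour lies in block 2 and a row writes to the east of what it reads, so the
  -- result appears in block 3, two blocks east of the centre. Hence the drift by two and the
  -- windows of four blocks.
  tripleRule : State → State → State → State → Rule
  tripleRule l c r s = record
    { start = col l ; rest = 1 * width + col c ∷ 2 * width + col r ∷ [] ; target = 3 * width + col s }

  singleRule : State → ℕ × State → Rule
  singleRule s (j , s′) = record { start = col s ; rest = [] ; target = j * width + col s′ }

  triples : State × State × State → List Rule
  triples (l , c , r) = maybe′ (λ s → tripleRule l c r s ∷ []) [] (local l c r)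

  singles : State → List Rule
  singles s = map (singleRule s) (produces s)

  rules : List Rule
  rules = concatMap triples (cartesianProduct states (cartesianProduct states states)) ++ concatMap singles states

  data RuleView : Rule → Set where
    triple : ∀ {l c r s} → local l c r ≡ just s → RuleView (tripleRule l c r s)
    single : ∀ {s p} → p ∈ produces s → RuleView (singleRule s p)

  private
    triples-view : ∀ {l c r ρ} m → local l c r ≡ m → ρ ∈ maybe′ (λ s → tripleRule l c r s ∷ []) [] m → RuleView ρ
    triples-view (just s) e (here refl) = triple e

    all-triples : List (State × State × State)
    all-triples = cartesianProduct states (cartesianProduct states states)

    view-triples : ∀ {ρ} xs → ρ ∈ concatMap triples xs → RuleView ρ
    view-triples xs ρ∈ with (l , c , r) , _ , ρ∈′ ← find (∈ₚ.∈-concatMap⁻ triples {xs = xs} ρ∈) =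
      triples-view {l} {c} {r} (local l c r) refl ρ∈′

    view-singles : ∀ {ρ} xs → ρ ∈ concatMap singles xs → RuleView ρ
    view-singles xs ρ∈ with s , _ , ρ∈′ ← find (∈ₚ.∈-concatMap⁻ singles {xs = xs} ρ∈)
      with _ , p∈ , refl ← ∈ₚ.∈-map⁻ (singleRule s) ρ∈′ = single p∈

  rule-view : ∀ {ρ} → ρ ∈ rules → RuleView ρ
  rule-view ρ∈ with ∈ₚ.∈-++⁻ (concatMap triples all-triples) ρ∈
  ... | inj₁ ρ∈₁ = view-triples all-triples ρ∈₁
  ... | inj₂ ρ∈₂ = view-singles states ρ∈₂

  triple-∈ : ∀ {l c r s} → local l c r ≡ just s → tripleRule l c r s ∈ rules
  triple-∈ {l} {c} {r} {s} e = ∈ₚ.∈-++⁺ˡ (∈ₚ.∈-concatMap⁺ triples (lose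
    (∈ₚ.∈-cartesianProduct⁺ (states-complete l) (∈ₚ.∈-cartesianProduct⁺ (states-complete c) (states-complete r)))
    (subst (λ m → tripleRule l c r s ∈ maybe′ (λ s → tripleRule l c r s ∷ []) [] m) (sym e) (here refl))))

  single-∈ : ∀ {s p} → p ∈ produces s → singleRule s p ∈ rules
  single-∈ {s} p∈ = ∈ₚ.∈-++⁺ʳ _ (∈ₚ.∈-concatMap⁺ singles (lose (states-complete s) (∈ₚ.∈-map⁺ (singleRule s) p∈)))

  block< : ∀ i j s s′ → i < j → i * width + col s < j * width + col s′
  block< i j s s′ i<j = begin-strict
    i * width + col s   <⟨ ℕₚ.+-monoʳ-< (i * width) (col< s) ⟩
    i * width + width   ≡⟨ ℕₚ.+-comm (i * width) width ⟩
    suc i * width       ≤⟨ ℕₚ.*-monoˡ-≤ width i<j ⟩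
    j * width           ≤⟨ ℕₚ.m≤m+n _ _ ⟩
    j * width + col s′  ∎
    where open ℕₚ.≤-Reasoning

  produces-range : ∀ s {j s′} → (j , s′) ∈ produces s → 0 < j × j < 4
  produces-range Boot (here refl) = s≤s z≤n , s≤s (s≤s z≤n)
  produces-range Boot (there (here refl)) = s≤s z≤n , s≤s (s≤s (s≤s z≤n))
  produces-range Boot (there (there (here refl))) = s≤s z≤n , s≤s (s≤s (s≤s (s≤s z≤n)))
  produces-range (Inj (just _)) (here refl) = s≤s z≤n , s≤s (s≤s z≤n)
  produces-range (Inj (just _)) (there (here refl)) = s≤s z≤n , s≤s (s≤s (s≤s z≤n))
  produces-range (Inj nothing) (here refl) = s≤s z≤n , s≤s (s≤s z≤n)
  produces-range (Inj nothing) (there (here refl)) = s≤s z≤n , s≤s (s≤s (s≤s z≤n))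
  produces-range Left (here refl) = s≤s z≤n , s≤s (s≤s z≤n)
  produces-range Left (there (here refl)) = s≤s z≤n , s≤s (s≤s (s≤s z≤n))
  produces-range Right (here refl) = s≤s z≤n , s≤s (s≤s (s≤s z≤n))
  produces-range Right (there (here refl)) = s≤s z≤n , s≤s (s≤s (s≤s (s≤s z≤n)))
  produces-range (head (inj₂ false) a) (here refl) = s≤s z≤n , s≤s (s≤s z≤n)

  private
    bound : ∀ j s → j < 4 → j * width + col s < 4 * width
    bound j s j<4 = ℕₚ.<-≤-trans (block< j 4 s Hub j<4) (ℕₚ.≤-reflexive (ℕₚ.+-identityʳ (4 * width)))

  rule-valid : ∀ {ρ} → ρ ∈ rules → Valid (4 * suc k) ρ
  rule-valid ρ∈ with rule-view ρ∈
  ... | triple {l} {c} {r} {s} _ = record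
    { start<end  = block< 0 3 l s (s≤s z≤n)
    ; end<bound  = bound 3 s ℕₚ.≤-refl
    ; start<rest = λ { (here refl) → block< 0 1 l c (s≤s z≤n) ; (there (here refl)) → block< 0 2 l r (s≤s z≤n) }
    ; rest<end   = λ { (here refl) → block< 1 3 c s (s≤s (s≤s z≤n)) ; (there (here refl)) → block< 2 3 r s ℕₚ.≤-refl }
    }
  ... | single {s} {j , s′} p∈ with 0<j , j<4 ← produces-range s p∈ = record
    { start<end  = block< 0 j s s′ 0<j
    ; end<bound  = bound j s′ j<4
    ; start<rest = λ ()
    ; rest<end   = λ ()
    }

  open Array k rules rule-valid public

  column-block : ∀ B j c → column B (j * width + c) ≡ column (B ℤ.+ + j) c
  column-block B j c = begin
    + (j * width + c) ℤ.+ B ℤ.* + width             ≡⟨ cong (ℤ._+ B ℤ.* + width) (trans (ℤₚ.pos-+ (j * width) c) (cong (ℤ._+ + c) (ℤₚ.pos-* j width))) ⟩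
    (+ j ℤ.* + width ℤ.+ + c) ℤ.+ B ℤ.* + width     ≡⟨ lemma (+ j) (+ width) (+ c) B ⟩
    + c ℤ.+ (B ℤ.+ + j) ℤ.* + width                 ∎
    where
    open ≡-Reasoning
    lemma : ∀ j w c B → (j ℤ.* w ℤ.+ c) ℤ.+ B ℤ.* w ≡ c ℤ.+ (B ℤ.+ j) ℤ.* w
    lemma = ℤ-solver.solve-∀

  column-injective : ∀ {B B′ s s′} → column B (col s) ≡ column B′ (col s′) → B ≡ B′ × s ≡ s′
  column-injective {s = s} {s′} e with ec , eB ← digits-unique width (col< s) (col< s′) e =
    eB , col-injective ec

  -- The cells drift east by two blocks per step, because a row can write only to
  -- the east of what it reads.  In return the left edge stays in block 0 while it
  -- injects the input.
  block : ℕ → ℤ → ℤ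
  block t x = x ℤ.+ (+ t ℤ.+ + t)

  block-injective : ∀ t {x y} → block t x ≡ block t y → x ≡ y
  block-injective t {x} {y} e = trans (lemma x (+ t)) (trans (cong (λ B → B ℤ.- (+ t ℤ.+ + t)) e) (sym (lemma y (+ t))))
    where
    lemma : ∀ x t → x ≡ (x ℤ.+ (t ℤ.+ t)) ℤ.- (t ℤ.+ t)
    lemma = ℤ-solver.solve-∀

  block-step : ∀ t x d → block t x ℤ.+ (d ℤ.+ + 2) ≡ block (suc t) (x ℤ.+ d)
  block-step t x d = lemma x (+ t) d
    where
    lemma : ∀ x t d → (x ℤ.+ (t ℤ.+ t)) ℤ.+ (d ℤ.+ + 2) ≡ (x ℤ.+ d) ℤ.+ ((+ 1 ℤ.+ t) ℤ.+ (+ 1 ℤ.+ t))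
    lemma = ℤ-solver.solve-∀

  block-+ : ∀ t x j → block t x ℤ.+ j ≡ block t (j ℤ.+ x)
  block-+ t x j = lemma x (+ t) j
    where
    lemma : ∀ x t j → (x ℤ.+ (t ℤ.+ t)) ℤ.+ j ≡ (j ℤ.+ x) ℤ.+ (t ℤ.+ t)
    lemma = ℤ-solver.solve-∀

  -- The fillers are forced: cells drift east by two blocks per step while every item enters in
  -- block 0, so that consecutive items are two cells apart.
  leftTape : List Letter → List Γ
  leftTape []      = filler ∷ item nothing ∷ []
  leftTape (ℓ ∷ h) = filler ∷ item (just ℓ) ∷ leftTape h

  leftState : List Letter → ℕ → State
  leftState []      zero    = Inj nothing
  leftState []      (suc n) = Left
  leftState (ℓ ∷ h) zero    = Inj (just ℓ)
  leftState (ℓ ∷ h) (suc n) = leftState h n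

  -- At time n + 1 the left edge is at -[1+ reach h n ].
  reach : List Letter → ℕ → ℕ
  reach h       zero    = 1
  reach []      (suc n) = 2 + n
  reach (ℓ ∷ h) (suc n) = 2 + reach h n

  reach-> : ∀ h n → n < reach h n
  reach-> h zero = s≤s z≤n
  reach-> [] (suc n) = ℕₚ.≤-refl
  reach-> (ℓ ∷ h) (suc n) = s≤s (ℕₚ.m≤n⇒m≤1+n (reach-> h n))

  data Advance (h : List Letter) (n : ℕ) : Set where
    letter : ∀ ℓ → leftState h n ≡ Inj (just ℓ) → leftState h (suc n) ≢ Left → reach h (suc n) ≡ 2 + reach h n →
             nth blank (leftTape h) (reach h n) ≡ item (just ℓ) →
             nth blank (leftTape h) (suc (reach h n)) ≡ filler → Advance h n
    last   : leftState h n ≡ Inj nothing → leftState h (suc n) ≡ Left → reach h (suc n) ≡ suc (reach h n) →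
             nth blank (leftTape h) (reach h n) ≡ item nothing → Advance h n
    beyond : leftState h n ≡ Left → leftState h (suc n) ≡ Left → reach h (suc n) ≡ suc (reach h n) →
             nth blank (leftTape h) (reach h n) ≡ blank → Advance h n

  advance-left : ∀ h n → Advance h n
  advance-left [] zero = last refl refl refl refl
  advance-left [] (suc n) = beyond refl refl refl refl
  advance-left (ℓ ∷ []) zero = letter ℓ refl (λ ()) refl refl refl
  advance-left (ℓ ∷ _ ∷ _) zero = letter ℓ refl (λ ()) refl refl refl
  advance-left (ℓ ∷ h) (suc n) with advance-left h n
  ... | letter ℓ′ e e′ r a b = letter ℓ′ e e′ (cong (_+_ 2) r) a b
  ... | last e e′ r a = last e e′ (cong (_+_ 2) r) a
  ... | beyond e e′ r a = beyond e e′ (cong (_+_ 2) r) a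

  reach-inj : ∀ h n {m} → leftState h n ≡ Inj m → reach h n ≡ suc (n + n)
  reach-inj h zero e = refl
  reach-inj (ℓ ∷ h) (suc n) e = trans (cong (_+_ 2) (reach-inj h n e)) (cong (_+_ 2) (sym (ℕₚ.+-suc n n)))

  filler-first : ∀ h → nth blank (leftTape h) 0 ≡ filler
  filler-first []      = refl
  filler-first (_ ∷ _) = refl

  module Input (h : List Letter) where

    c₀ : Config
    c₀ = inj₁ q₀ , leftTape h , home , []

    open Trace c₀ renaming (pos to headpos)

    ctl : ℕ → Q ⊎ Bool
    ctl n = proj₁ (conf n)

    glance : ℕ → ℤ → State
    glance n x = if does (x ℤ.≟ headpos n) then head (ctl n) (tape n x) else plain (tape n x)

    glance-head : ∀ n {x} → x ≡ headpos n → glance n x ≡ head (ctl n) (tape n x)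
    glance-head n {x} e rewrite dec-true (x ℤ.≟ headpos n) e = refl

    glance-plain : ∀ n {x} → x ≢ headpos n → glance n x ≡ plain (tape n x)
    glance-plain n {x} ¬e rewrite dec-false (x ℤ.≟ headpos n) ¬e = refl

    private
      no-offset : ∀ d x → x ≢ offset d ℤ.+ x
      no-offset left x e = ℤₚ.i≢suc[i] {ℤ.pred x} (trans (sym e) (sym (ℤₚ.suc-pred x)))
      no-offset right x e = ℤₚ.i≢suc[i] e

      halted-next : ∀ c {b} → proj₁ c ≡ inj₂ b → next c ≡ c × drift c ≡ + 0 × written c ≡ scan (proj₂ c)
      halted-next _ refl = refl , refl , refl

      running-next : ∀ c {q} → proj₁ c ≡ inj₁ q → let c′ , a′ , d = δ q (scan (proj₂ c)) in
        proj₁ (next c) ≡ c′ × drift c ≡ offset d × written c ≡ a′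
      running-next _ refl = refl , refl , refl

      stay-plain : ∀ n {x} → x ≢ headpos n → x ≢ headpos (suc n) → plain (tape n x) ≡ glance (suc n) x
      stay-plain n ¬e ¬e′ = trans (cong plain (sym (tape-suc n ¬e))) (sym (glance-plain (suc n) ¬e′))

      become-head : ∀ n {x c} → x ≢ headpos n → x ≡ headpos (suc n) → ctl (suc n) ≡ c →
        head c (tape n x) ≡ glance (suc n) x
      become-head n ¬e e′ refl = trans (cong (head _) (sym (tape-suc n ¬e))) (sym (glance-head (suc n) e′))

      moves-away : ∀ d n {x} → x ≢ headpos n → moves d (glance n x) ≡ nothing
      moves-away d n ¬e = cong (moves d) (glance-plain n ¬e)

      moves-halted : ∀ d n x {b} → ctl n ≡ inj₂ b → moves d (glance n x) ≡ nothing
      moves-halted d n x e with x ℤ.≟ headpos n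
      ... | yes _ = cong (λ c → moves d (head c (tape n x))) e
      ... | no _ = refl

      moves-running : ∀ d n {x q} → ctl n ≡ inj₁ q → x ≡ headpos n → let c , _ , d′ = δ q (scan (proj₂ (conf n))) in
        moves d (glance n x) ≡ sends d d′ c
      moves-running d n e ex = cong (moves d) (trans (glance-head n ex) (cong₂ head e (tape-pos n ex)))

      moves-against : ∀ d n x {q} → ctl n ≡ inj₁ q → sends d (proj₂ (proj₂ (δ q (scan (proj₂ (conf n)))))) ≡ (λ _ → nothing) →
        moves d (glance n x) ≡ nothing
      moves-against d n x e none with x ℤ.≟ headpos n
      ... | no _ = refl
      ... | yes ex = trans (cong (moves d) (cong₂ head e (tape-pos n ex))) (cong (λ f → f (proj₁ (δ _ (scan (proj₂ (conf n)))))) none)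

    -- The neighbours enter only through `moves`, which reports a head about to arrive. At the
    -- border, the state of an edge can thus stand in for the cell that the machine has there.
    glance-step : ∀ n x {l r} → moves right l ≡ moves right (glance n (ℤ.pred x)) →
      moves left r ≡ moves left (glance n (ℤ.suc x)) → local l (glance n x) r ≡ just (glance (suc n) x)
    glance-step n x {l} {r} el er = go (x ℤ.≟ headpos n) (ctl n) refl
      where
      τ : Strip
      τ = proj₂ (conf n)

      arrived : ∀ {ml mr} → moves right (glance n (ℤ.pred x)) ≡ ml → moves left (glance n (ℤ.suc x)) ≡ mr →
        arrive ml mr (tape n x) ≡ glance (suc n) x → x ≢ headpos n →
        local l (glance n x) r ≡ just (glance (suc n) x)
      arrived refl refl e ¬e = trans (cong (λ s → local l s r) (glance-plain n ¬e))
        (cong just (trans (cong₂ (λ m m′ → arrive m m′ (tape n x)) el er) e))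

      go : Dec (x ≡ headpos n) → ∀ c → ctl n ≡ c → local l (glance n x) r ≡ just (glance (suc n) x)
      go (yes e) (inj₂ b) ec with conf≡ , drift≡ , written≡ ← halted-next (conf n) ec =
        trans (cong (λ s → local l s r) (trans (glance-head n e) (cong₂ head ec (tape-pos n e))))
          (cong just (sym (trans (glance-head (suc n) (trans e (sym (trans (cong (ℤ._+ headpos n) drift≡) (ℤₚ.+-identityˡ _)))))
            (cong₂ head (trans (cong proj₁ conf≡) ec) (trans (tape-suc-pos n e) written≡)))))
      go (yes e) (inj₁ q) ec with _ , drift≡ , written≡ ← running-next (conf n) ec =
        trans (cong (λ s → local l s r) (trans (glance-head n e) (cong₂ head ec (tape-pos n e))))
          (cong just (sym (trans
            (glance-plain (suc n) λ e′ → no-offset (proj₂ (proj₂ (δ q (scan τ)))) x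
              (trans e′ (cong₂ ℤ._+_ drift≡ (sym e))))
            (cong plain (trans (tape-suc-pos n e) written≡)))))
      go (no ¬e) (inj₂ b) ec with _ , drift≡ , _ ← halted-next (conf n) ec =
        arrived (moves-halted right n (ℤ.pred x) ec) (moves-halted left n (ℤ.suc x) ec)
          (stay-plain n ¬e λ e′ → ¬e (trans e′ (trans (cong (ℤ._+ headpos n) drift≡) (ℤₚ.+-identityˡ _)))) ¬e
      go (no ¬e) (inj₁ q) ec with ctl≡ , drift≡ , _ ← running-next (conf n) ec =
        go′ (proj₂ (proj₂ (δ q (scan τ)))) refl (ℤ.pred x ℤ.≟ headpos n) (ℤ.suc x ℤ.≟ headpos n)
        where
        go′ : ∀ d → proj₂ (proj₂ (δ q (scan τ))) ≡ d → Dec (ℤ.pred x ≡ headpos n) → Dec (ℤ.suc x ≡ headpos n) →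
          local l (glance n x) r ≡ just (glance (suc n) x)
        go′ right ed (yes ep) _ = arrived (trans (moves-running right n {ℤ.pred x} ec ep) (cong (λ d → sends right d (proj₁ (δ q (scan τ)))) ed))
          (moves-against left n (ℤ.suc x) ec (cong (sends left) ed))
          (become-head n ¬e (trans (sym (ℤₚ.suc-pred x))
            (sym (cong₂ ℤ._+_ (trans drift≡ (cong offset ed)) (sym ep)))) ctl≡) ¬e
        go′ right ed (no ¬ep) _ = arrived (moves-away right n {ℤ.pred x} ¬ep) (moves-against left n (ℤ.suc x) ec (cong (sends left) ed))
          (stay-plain n ¬e λ e′ → ¬ep (trans (cong ℤ.pred (trans e′
            (cong (ℤ._+ headpos n) (trans drift≡ (cong offset ed))))) (ℤₚ.pred-suc _))) ¬e
        go′ left ed _ (yes ep) = arrived (moves-against right n (ℤ.pred x) ec (cong (sends right) ed))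
          (trans (moves-running left n {ℤ.suc x} ec ep) (cong (λ d → sends left d (proj₁ (δ q (scan τ)))) ed))
          (become-head n ¬e (trans (sym (ℤₚ.pred-suc x))
            (sym (cong₂ ℤ._+_ (trans drift≡ (cong offset ed)) (sym ep)))) ctl≡) ¬e
        go′ left ed _ (no ¬ep) = arrived (moves-against right n (ℤ.pred x) ec (cong (sends right) ed)) (moves-away left n {ℤ.suc x} ¬ep)
          (stay-plain n ¬e λ e′ → ¬ep (trans (cong ℤ.suc (trans e′
            (cong (ℤ._+ headpos n) (trans drift≡ (cong offset ed))))) (ℤₚ.suc-pred _))) ¬e

    private
      starts : drift c₀ ≡ -[1+ 0 ]
      starts = cong offset starts-left

      below : ∀ n {r} → n ≤ r → -[1+ r ] ℤ.< ℤ.- + n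
      below zero    _   = ℤ.-<+
      below (suc n) n≤r = ℤ.-<- n≤r

      glance-left : ∀ n {r} → n ≤ r → glance n -[1+ r ] ≡ plain (nth blank (leftTape h) r)
      glance-left n {r} n≤r = trans
        (glance-plain n λ e → ℤₚ.<⇒≱ (below n n≤r) (subst (ℤ.- + n ℤ.≤_) (sym e) (pos-≥ n)))
        (cong plain (untouched-left n (below n n≤r)))

      glance-right : ∀ n → glance (suc n) (+ suc n) ≡ plain blank
      glance-right n = trans
        (glance-plain (suc n) λ e → ℤₚ.<⇒≱ (pos-< starts n) (subst (+ n ℤ.≤_) e (ℤ.+≤+ (ℕₚ.n≤1+n n))))
        (cong plain (untouched-right starts (suc n) ℤₚ.≤-refl))

      left-≢ : ∀ n → -[1+ reach h n ] ≢ headpos n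
      left-≢ n e = ℤₚ.<⇒≱ (below n (ℕₚ.<⇒≤ (reach-> h n))) (subst (ℤ.- + n ℤ.≤_) (sym e) (pos-≥ n))

      right-≢ : ∀ n → + suc n ≢ headpos n
      right-≢ n e = ℤₚ.<⇒≱ (ℤ.+<+ (ℕₚ.n<1+n n)) (subst (ℤ._≤ + n) (sym e) (pos-≤ starts n))

      reach-≤ : ∀ n → reach h n ≤ reach h (suc n)
      reach-≤ n with advance-left h n
      ... | letter _ _ _ e _ _ = ℕₚ.≤-trans (ℕₚ.m≤n+m _ 2) (ℕₚ.≤-reflexive (sym e))
      ... | last _ _ e _ = ℕₚ.≤-trans (ℕₚ.n≤1+n _) (ℕₚ.≤-reflexive (sym e))
      ... | beyond _ _ e _ = ℕₚ.≤-trans (ℕₚ.n≤1+n _) (ℕₚ.≤-reflexive (sym e))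

      leftState-still : ∀ d n → moves d (leftState h n) ≡ nothing
      leftState-still d n with advance-left h n
      ... | letter _ e _ _ _ _ = cong (moves d) e
      ... | last e _ _ _ = cong (moves d) e
      ... | beyond e _ _ _ = cong (moves d) e

      leftState-passive : ∀ n l r → local l (leftState h n) r ≡ nothing
      leftState-passive n l r with advance-left h n
      ... | letter _ e _ _ _ _ = cong (λ c → local l c r) e
      ... | last e _ _ _ = cong (λ c → local l c r) e
      ... | beyond e _ _ _ = cong (λ c → local l c r) e

    -- The machine starts at time 1; the automaton does not know yet what lies beyond
    -- the edges, which the head never reaches.
    data Cell : ℕ → ℤ → State → Set where
      boot  : Cell 0 (+ 0) Boot
      edgeˡ : ∀ n → Cell (suc n) -[1+ reach h n ] (leftState h n)
      edgeʳ : ∀ n → Cell (suc n) (+ suc n) Right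
      inner : ∀ n {x} → -[1+ reach h n ] ℤ.< x → x ℤ.< + suc n → Cell (suc n) x (glance n x)

    private
      agree : ∀ n {x s} → Cell (suc n) x s → ∀ d → moves d s ≡ moves d (glance n x)
      agree n (edgeˡ n) d = trans (leftState-still d n) (sym (moves-away d n (left-≢ n)))
      agree n (edgeʳ n) d = sym (moves-away d n (right-≢ n))
      agree n (inner n _ _) d = refl

      inner-suc : ∀ n {x} → -[1+ reach h n ] ℤ.< x → x ℤ.< + suc n → Cell (suc (suc n)) x (glance (suc n) x)
      inner-suc n l r = inner (suc n) (ℤₚ.≤-<-trans (ℤ.-≤- (reach-≤ n)) l) (ℤₚ.<-trans r (ℤ.+<+ (ℕₚ.n<1+n (suc n))))

      inner-right : ∀ n → Cell (suc (suc n)) (+ suc n) (plain blank)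
      inner-right n = subst (Cell (suc (suc n)) (+ suc n)) (glance-right n) (inner (suc n) ℤ.-<+ (ℤ.+<+ ℕₚ.≤-refl))

      inner-left : ∀ n r {a} → suc n ≤ r → r < reach h (suc n) → nth blank (leftTape h) r ≡ a →
        Cell (suc (suc n)) -[1+ r ] (plain a)
      inner-left n r n<r r< e = subst (Cell (suc (suc n)) -[1+ r ])
        (trans (glance-left (suc n) n<r) (cong plain e)) (inner (suc n) (ℤ.-<- r<) ℤ.-<+)

      inner-filler : Cell 1 -[1+ 0 ] (plain filler)
      inner-filler = subst (Cell 1 -[1+ 0 ]) (trans (glance-left 0 z≤n) (cong plain (filler-first h)))
        (inner 0 (ℤ.-<- (s≤s z≤n)) ℤ.-<+)

      glance-view : ∀ n x → glance n x ≡ plain (tape n x) ⊎ glance n x ≡ head (ctl n) (tape n x)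
      glance-view n x with x ℤ.≟ headpos n
      ... | yes _ = inj₂ refl
      ... | no _  = inj₁ refl

    -- `local` has no value at `Boot` or at an edge, so the centre is an inner cell. Its neighbours
    -- may be edges, which `agree` allows to be replaced by cells of the machine.
    sound-triple : ∀ t x {l c r s} → Cell t (ℤ.pred x) l → Cell t x c → Cell t (ℤ.suc x) r →
      local l c r ≡ just s → Cell (suc t) x s
    sound-triple _ _ _ boot _ ()
    sound-triple _ _ {l} {r = r} _ (edgeˡ n) _ e with () ← trans (sym (leftState-passive n l r)) e
    sound-triple _ _ _ (edgeʳ n) _ ()
    sound-triple _ x cl (inner n l r) cr e = subst (Cell (suc (suc n)) x)
      (just-injective (trans (sym (glance-step n x (agree n cl right) (agree n cr left))) e)) (inner-suc n l r)

    sound-single : (∀ n → ctl n ≢ inj₂ false) → ∀ t x {s j s′} → Cell t x s → (j , s′) ∈ produces s →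
      Cell (suc t) (x ℤ.+ (+ j ℤ.- + 2)) s′
    sound-single never _ _ boot (here refl) = inner-filler
    sound-single never _ _ boot (there (here refl)) = inner 0 ℤ.-<+ (ℤ.+<+ (s≤s z≤n))
    sound-single never _ _ boot (there (there (here refl))) = edgeʳ 0
    sound-single never _ _ (edgeˡ n) p∈ with advance-left h n
    ... | letter ℓ e _ re a b with subst (λ s → _ ∈ produces s) e p∈
    ...   | here refl rewrite ℕₚ.+-identityʳ (reach h n) =
      inner-left n (suc (reach h n)) (ℕₚ.m≤n⇒m≤1+n (reach-> h n)) (ℕₚ.≤-reflexive (sym re)) b
    ...   | there (here refl) =
      inner-left n (reach h n) (reach-> h n) (ℕₚ.≤-trans (ℕₚ.n≤1+n _) (ℕₚ.≤-reflexive (sym re))) a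
    sound-single never _ _ (edgeˡ n) p∈ | last e e′ re a with subst (λ s → _ ∈ produces s) e p∈
    ...   | here refl rewrite ℕₚ.+-identityʳ (reach h n) =
      subst₂ (Cell (suc (suc n))) (cong -[1+_] re) e′ (edgeˡ (suc n))
    ...   | there (here refl) = inner-left n (reach h n) (reach-> h n) (ℕₚ.≤-reflexive (sym re)) a
    sound-single never _ _ (edgeˡ n) p∈ | beyond e e′ re a with subst (λ s → _ ∈ produces s) e p∈
    ...   | here refl rewrite ℕₚ.+-identityʳ (reach h n) =
      subst₂ (Cell (suc (suc n))) (cong -[1+_] re) e′ (edgeˡ (suc n))
    ...   | there (here refl) = inner-left n (reach h n) (reach-> h n) (ℕₚ.≤-reflexive (sym re)) a
    sound-single never _ _ (edgeʳ n) (here refl) rewrite ℕₚ.+-identityʳ n = inner-right n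
    sound-single never _ _ (edgeʳ n) (there (here refl)) rewrite ℕₚ.+-comm n 1 = edgeʳ (suc n)
    sound-single never _ _ {j = j} {s′} (inner n {x} _ _) p∈ with glance-view n x
    ... | inj₁ e with () ← subst (λ s → (j , s′) ∈ produces s) e p∈
    ... | inj₂ e = ⊥-elim (unproductive (ctl n) (never n) (subst (λ s → (j , s′) ∈ produces s) e p∈))
      where
      unproductive : ∀ c → c ≢ inj₂ false → ∀ {a} → (j , s′) ∈ produces (head c a) → ⊥
      unproductive (inj₁ _) ¬e ()
      unproductive (inj₂ true) ¬e ()
      unproductive (inj₂ false) ¬e _ = ¬e refl

    private
      data Place (n : ℕ) (x : ℤ) : Set where
        beyond-left : x ℤ.< -[1+ reach h n ] → Place n x
        on-left     : x ≡ -[1+ reach h n ] → Place n x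
        between     : -[1+ reach h n ] ℤ.< x → x ℤ.< + suc n → Place n x
        on-right    : x ≡ + suc n → Place n x
        beyond-right : + suc n ℤ.< x → Place n x

      place? : ∀ n x → Place n x
      place? n x with ℤₚ.<-cmp x -[1+ reach h n ]
      ... | tri< lt _ _ = beyond-left lt
      ... | tri≈ _ eq _ = on-left eq
      ... | tri> _ _ gt with ℤₚ.<-cmp x (+ suc n)
      ...   | tri< lt _ _ = between gt lt
      ...   | tri≈ _ eq _ = on-right eq
      ...   | tri> _ _ gt′ = beyond-right gt′

      occupied : ∀ n x → -[1+ reach h n ] ℤ.≤ x → x ℤ.≤ + suc n → ∃[ s ] Cell (suc n) x s
      occupied n x l r with place? n x
      ... | beyond-left lt = contradiction l (ℤₚ.<⇒≱ lt)
      ... | on-left refl = _ , edgeˡ n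
      ... | between l′ r′ = _ , inner n l′ r′
      ... | on-right refl = _ , edgeʳ n
      ... | beyond-right gt = contradiction r (ℤₚ.<⇒≱ gt)

      not-left : ∀ h → leftState h 0 ≢ Left
      not-left [] ()
      not-left (_ ∷ _) ()

    -- While it injects, the left edge is at -(2n + 2) at time n + 1, and the drift of 2n + 2 blocks
    -- takes it to block 0.
    seed-block : ∀ n {m} → leftState h n ≡ Inj m → block (suc n) -[1+ reach h n ] ≡ + 0
    seed-block n e rewrite reach-inj h n e | ℕₚ.+-suc n n = ℤₚ.n⊖n≡0 (suc (suc (n + n)))

    -- Time in the circuit is an integer; the index `+ t` leaves no atom before time 0.
    data Occupied (X : ℤ) : ℤ → Set where
      atom : ∀ t x s → X ≡ column (block t x) (col s) → Cell t x s → Occupied X (+ t)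

    semantics : (∀ n → ctl n ≢ inj₂ false) → Semantics
    semantics never = record
      { Atom = Occupied
      -- If the machine never rejects, no `Hub` arises and the bus never fires.
      ; G = ⊥
      ; hub⇒G = hub-false
      ; G⇒hub = λ _ ()
      ; apply = λ ρ∈ → apply (rule-view ρ∈)
      }
      where
      glance-≢-Hub : ∀ n x → glance n x ≢ Hub
      glance-≢-Hub n x e with glance-view n x
      ... | inj₁ e′ with () ← trans (sym e′) e
      ... | inj₂ e′ with () ← trans (sym e′) e

      leftState-≢-Hub : ∀ n → leftState h n ≢ Hub
      leftState-≢-Hub n e with advance-left h n
      ... | letter _ e′ _ _ _ _ with () ← trans (sym e′) e
      ... | last e′ _ _ _ with () ← trans (sym e′) e
      ... | beyond e′ _ _ _ with () ← trans (sym e′) e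

      hubless : ∀ {t x s} → Cell t x s → s ≢ Hub
      hubless boot ()
      hubless (edgeˡ n) = leftState-≢-Hub n
      hubless (edgeʳ n) ()
      hubless (inner n {x} _ _) = glance-≢-Hub n x

      hub-false : ∀ B {t} → Occupied (column B 0) t → ⊥
      hub-false B (atom t x s e c) = hubless c (sym (proj₂ (column-injective {B} {block t x} {Hub} {s} e)))

      at-column : ∀ B s {t X} → X ≡ column B (col s) → Occupied X (+ t) → ∃[ x ] B ≡ block t x × Cell t x s
      at-column B s eX (atom t x s′ e c) = x , proj₁ same , subst (Cell t x) (sym (proj₂ same)) c
        where
        same : B ≡ block t x × s ≡ s′
        same = column-injective {B} {block t x} {s} {s′} (trans (sym eX) e)

      apply-triple : ∀ {l c r s} → local l c r ≡ just s → ∀ B t →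
        ∃[ x ] B ≡ block t x × Cell t x l →
        ∃[ y ] B ℤ.+ + 1 ≡ block t y × Cell t y c →
        ∃[ z ] B ℤ.+ + 2 ≡ block t z × Cell t z r →
        Occupied (column B (3 * width + col s)) (+ suc t)
      apply-triple {l} {c} {r} {s} e B t (x , ex , cl) (y , ey , cc) (z , ez , cr) = atom (suc t) (ℤ.suc x) s
        (trans (column-block B 3 (col s)) (cong (λ B → column B (col s))
          (trans (cong (λ B → B ℤ.+ + 3) ex) (trans (block-step t x (+ 1)) (cong (block (suc t)) (ℤₚ.+-comm x (+ 1)))))))
        (sound-triple t (ℤ.suc x)
          (subst (λ x → Cell t x l) (sym (ℤₚ.pred-suc x)) cl)
          (subst (λ y → Cell t y c) y≡ cc)
          (subst (λ z → Cell t z r) (trans z≡ (ℤₚ.+-assoc (+ 1) (+ 1) x)) cr) e)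
        where
        y≡ : y ≡ + 1 ℤ.+ x
        y≡ = block-injective t (trans (sym ey) (trans (cong (λ B → B ℤ.+ + 1) ex) (block-+ t x (+ 1))))
        z≡ : z ≡ + 2 ℤ.+ x
        z≡ = block-injective t (trans (sym ez) (trans (cong (λ B → B ℤ.+ + 2) ex) (block-+ t x (+ 2))))

      apply-single : ∀ {s j s′} → (j , s′) ∈ produces s → ∀ B t → ∃[ x ] B ≡ block t x × Cell t x s →
        Occupied (column B (j * width + col s′)) (+ suc t)
      apply-single {s} {j} {s′} p∈ B t (x , ex , cs) = atom (suc t) (x ℤ.+ (+ j ℤ.- + 2)) s′
        (trans (column-block B j (col s′)) (cong (λ B → column B (col s′))
          (trans (cong₂ ℤ._+_ ex (lemma (+ j))) (block-step t x (+ j ℤ.- + 2)))))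
        (sound-single never t x cs p∈)
        where
        lemma : ∀ j → j ≡ (j ℤ.- + 2) ℤ.+ + 2
        lemma = ℤ-solver.solve-∀

      apply : ∀ {ρ} → RuleView ρ → ∀ B {t} → Occupied (column B (Rule.start ρ)) t →
        (∀ {n} → n ∈ Rule.rest ρ → Occupied (column B n) t) → Occupied (column B (Rule.target ρ)) (ℤ.suc t)
      apply (triple {l} {c} {r} e) B a@(atom t _ _ _ _) as = apply-triple e B t (at-column B l refl a)
        (at-column (B ℤ.+ + 1) c (column-block B 1 (col c)) (as (here refl)))
        (at-column (B ℤ.+ + 2) r (column-block B 2 (col r)) (as (there (here refl))))
      apply (single {s} p∈) B a@(atom t _ _ _ _) _ = apply-single p∈ B t (at-column B s refl a)

    module Derivation (T : Site → Set)
      (wire-closed : ∀ σ d → kindˢ σ ≡ wire → T (stepˢ d σ) → T σ)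
      (gate-closed : ∀ σ d d′ → kindˢ σ ≡ gate → d ≢ d′ → T (stepˢ d σ) → T (stepˢ d′ σ) → T σ) where

      open Closed T wire-closed gate-closed using (Line)
      open ClosedArray T wire-closed gate-closed

      record At (t : ℕ) (x : ℤ) (s : State) : Set where
        constructor at-line
        field
          line : Line (column (block t x) (col s)) (+ t)

      open At

      line-triple : ∀ t x {l c r s} → At t (ℤ.pred x) l → At t x c → At t (ℤ.suc x) r →
        local l c r ≡ just s → At (suc t) x s
      line-triple t x {l} {c} {r} {s} al ac ar e = at-line (subst (λ X → Line X (+ suc t))
        (trans (column-block B 3 (col s)) (cong (λ B → column B (col s))
          (trans (block-step t (ℤ.pred x) (+ 1)) (cong (block (suc t)) (trans (ℤₚ.+-comm (ℤ.pred x) (+ 1)) (ℤₚ.suc-pred x))))))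
        (apply-line (triple-∈ e) B (line al) (two (λ n → Line (column B n) (+ t)) ac′ ar′)))
        where
        B : ℤ
        B = block t (ℤ.pred x)
        ac′ : Line (column B (1 * width + col c)) (+ t)
        ac′ = subst (λ X → Line X (+ t)) (sym (trans (column-block B 1 (col c)) (cong (λ B → column B (col c))
          (trans (block-+ t (ℤ.pred x) (+ 1)) (cong (block t) (ℤₚ.suc-pred x)))))) (line ac)
        ar′ : Line (column B (2 * width + col r)) (+ t)
        ar′ = subst (λ X → Line X (+ t)) (sym (trans (column-block B 2 (col r)) (cong (λ B → column B (col r))
          (trans (block-+ t (ℤ.pred x) (+ 2)) (cong (block t) (trans (ℤₚ.+-assoc (+ 1) (+ 1) (ℤ.pred x))
            (cong ℤ.suc (ℤₚ.suc-pred x)))))))) (line ar)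
        two : ∀ (P : ℕ → Set) {a b} → P a → P b → ∀ {n} → n ∈ a ∷ b ∷ [] → P n
        two P pa pb (here refl)         = pa
        two P pa pb (there (here refl)) = pb

      line-single : ∀ t x {s j s′} → At t x s → (j , s′) ∈ produces s → At (suc t) (x ℤ.+ (+ j ℤ.- + 2)) s′
      line-single t x {s} {j} {s′} a p∈ = at-line (subst (λ X → Line X (+ suc t))
        (trans (column-block (block t x) j (col s′)) (cong (λ B → column B (col s′))
          (trans (cong (ℤ._+_ (block t x)) (lemma (+ j))) (block-step t x (+ j ℤ.- + 2)))))
        (apply-line (single-∈ p∈) (block t x) (line a) λ ()))
        where
        lemma : ∀ j → j ≡ (j ℤ.- + 2) ℤ.+ + 2
        lemma = ℤ-solver.solve-∀

      module _ (boot-line : Line (column (+ 0) (col Boot)) (+ 0))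
        (inj-line : ∀ n m → leftState h n ≡ Inj m → Line (column (+ 0) (col (Inj m))) (+ suc n)) where

        private
          seeded : ∀ n {m} → leftState h n ≡ Inj m → At (suc n) -[1+ reach h n ] (Inj m)
          seeded n {m} e = at-line (subst (λ B → Line (column B (col (Inj m))) (+ suc n)) (sym (seed-block n e)) (inj-line n m e))

          booted : At 0 (+ 0) Boot
          booted = at-line boot-line

        mutual
          derive : ∀ t x {s} → Cell t x s → At t x s
          derive zero          _ boot      = booted
          derive (suc zero)    _ (edgeʳ _) = line-single 0 (+ 0) booted (there (there (here refl)))
          derive (suc (suc n)) _ (edgeʳ _) = subst (λ k → At (suc (suc n)) (+ k) Right) (cong suc (ℕₚ.+-comm n 1))
            (line-single (suc n) (+ suc n) (derive (suc n) (+ suc n) (edgeʳ n)) (there (here refl)))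
          derive (suc n)       _ (edgeˡ _) = derive-left n (advance-left h n)
          derive (suc zero)    x (inner _ l r) = derive-first x l r
          derive (suc (suc n)) x (inner _ l r) = derive-inner (suc n) x l r (place? n x)

          derive-left : ∀ n → Advance h n → At (suc n) -[1+ reach h n ] (leftState h n)
          derive-left n (letter _ e _ _ _ _) = subst (At (suc n) -[1+ reach h n ]) (sym e) (seeded n e)
          derive-left n (last e _ _ _)       = subst (At (suc n) -[1+ reach h n ]) (sym e) (seeded n e)
          derive-left zero (beyond e _ _ _)    = ⊥-elim (not-left h e)
          derive-left (suc n) (beyond e _ _ _) = derive-beyond n e (advance-left h n)

          derive-beyond : ∀ n → leftState h (suc n) ≡ Left → Advance h n →
            At (suc (suc n)) -[1+ reach h (suc n) ] (leftState h (suc n))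
          derive-beyond n e (letter _ _ ¬e _ _ _) = contradiction e ¬e
          derive-beyond n e (last e′ _ re _)   = derive-further n e e′ re (here refl)
          derive-beyond n e (beyond e′ _ re _) = derive-further n e e′ re (here refl)

          derive-further : ∀ n {s} → leftState h (suc n) ≡ Left → leftState h n ≡ s → reach h (suc n) ≡ suc (reach h n) →
            (1 , Left) ∈ produces s → At (suc (suc n)) -[1+ reach h (suc n) ] (leftState h (suc n))
          derive-further n e e′ re p∈ = subst₂ (At (suc (suc n)))
            (trans (cong (λ j → -[1+ suc j ]) (ℕₚ.+-identityʳ (reach h n))) (cong -[1+_] (sym re))) (sym e)
            (line-single (suc n) -[1+ reach h n ] (derive-edge n e′) p∈)

          derive-edge : ∀ n {s} → leftState h n ≡ s → At (suc n) -[1+ reach h n ] s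
          derive-edge n e = subst (At (suc n) -[1+ reach h n ]) e (derive-left n (advance-left h n))

          derive-first : ∀ x → -[1+ 1 ] ℤ.< x → x ℤ.< + 1 → At 1 x (glance 0 x)
          derive-first (+ zero)     l r = line-single 0 (+ 0) booted (there (here refl))
          derive-first (+ suc _)    l (ℤ.+<+ (s≤s ()))
          derive-first -[1+ zero ]  l r = subst (At 1 -[1+ 0 ])
            (sym (trans (glance-left 0 z≤n) (cong plain (filler-first h)))) (line-single 0 (+ 0) booted (here refl))
          derive-first -[1+ suc _ ] (ℤ.-<- (s≤s ())) r

          -- The place of the cell relative to the edges one step earlier tells where it comes from:
          -- a transition of the machine, an item or a blank left by an edge, or the filler that the
          -- left edge skips when it moves by two.
          derive-inner : ∀ t x → -[1+ reach h t ] ℤ.< x → x ℤ.< + suc t → Place (ℕ.pred t) x → {{NonZero t}} →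
            At (suc t) x (glance t x)
          derive-inner (suc n) x l r (between l′ r′) = derive-between (suc n) x l′ r′
            (occupied n (ℤ.pred x) (ℤₚ.i<j⇒i≤pred[j] l′) (ℤₚ.≤-trans (ℤₚ.i≤j⇒pred[i]≤j ℤₚ.≤-refl) (ℤₚ.<⇒≤ r′)))
            (occupied n (ℤ.suc x) (ℤₚ.≤-trans (ℤₚ.<⇒≤ l′) (ℤₚ.i≤suc[i] x)) (ℤₚ.i<j⇒suc[i]≤j r′))
          derive-inner (suc n) _ l r (on-right refl) = subst₂ (At (suc (suc n))) (cong (λ k → + suc k) (ℕₚ.+-identityʳ n))
            (sym (glance-right n)) (line-single (suc n) (+ suc n) (derive (suc n) (+ suc n) (edgeʳ n)) (here refl))
          derive-inner (suc n) x l r (beyond-right gt) = contradiction (ℤₚ.i<j⇒suc[i]≤j gt) (ℤₚ.<⇒≱ r)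
          derive-inner (suc n) _ l r (on-left refl) = derive-on-left n (advance-left h n)
          derive-inner (suc n) (+ _) l r (beyond-left ())
          derive-inner (suc n) -[1+ k ] (ℤ.-<- k<) r (beyond-left (ℤ.-<- <k)) = derive-skipped n k k< <k (advance-left h n)

          derive-between : ∀ t x → -[1+ reach h (ℕ.pred t) ] ℤ.< x → x ℤ.< + t → 
            ∃[ s ] Cell t (ℤ.pred x) s → ∃[ s ] Cell t (ℤ.suc x) s → {{NonZero t}} → At (suc t) x (glance t x)
          derive-between (suc n) x l r (_ , cl) (_ , cr) = line-triple (suc n) x
            (derive (suc n) (ℤ.pred x) cl) (derive (suc n) x (inner n l r)) (derive (suc n) (ℤ.suc x) cr)
            (glance-step n x (agree n cl right) (agree n cr left))

          derive-on-left : ∀ n → Advance h n → At (suc (suc n)) -[1+ reach h n ] (glance (suc n) -[1+ reach h n ])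
          derive-on-left n (letter _ e _ _ a _) = derive-item n e a (there (here refl))
          derive-on-left n (last e _ _ a)       = derive-item n e a (there (here refl))
          derive-on-left n (beyond e _ _ a)     = derive-item n e a (there (here refl))

          derive-item : ∀ n {s a} → leftState h n ≡ s → nth blank (leftTape h) (reach h n) ≡ a → (2 , plain a) ∈ produces s →
            At (suc (suc n)) -[1+ reach h n ] (glance (suc n) -[1+ reach h n ])
          derive-item n e a p∈ = subst (At (suc (suc n)) -[1+ reach h n ])
            (sym (trans (glance-left (suc n) (reach-> h n)) (cong plain a)))
            (line-single (suc n) -[1+ reach h n ] (derive-edge n e) p∈)

          derive-skipped : ∀ n k → k < reach h (suc n) → reach h n < k → Advance h n →
            At (suc (suc n)) -[1+ k ] (glance (suc n) -[1+ k ])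
          derive-skipped n k k< <k (last _ _ e _)   = contradiction (subst (suc k ≤_) e k<) (ℕₚ.<⇒≱ (s≤s <k))
          derive-skipped n k k< <k (beyond _ _ e _) = contradiction (subst (suc k ≤_) e k<) (ℕₚ.<⇒≱ (s≤s <k))
          derive-skipped n k k< <k (letter _ e _ re _ b) = subst (λ k → At (suc (suc n)) -[1+ k ] (glance (suc n) -[1+ k ]))
            (ℕₚ.≤-antisym <k (ℕₚ.≤-pred (subst (suc k ≤_) re k<)))
            (subst₂ (At (suc (suc n))) (cong (λ j → -[1+ suc j ]) (ℕₚ.+-identityʳ (reach h n)))
              (sym (trans (glance-left (suc n) (ℕₚ.m≤n⇒m≤1+n (reach-> h n))) (cong plain b)))
              (line-single (suc n) -[1+ reach h n ] (derive-edge n e) (here refl)))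

        -- Column 0 of block 0 at time 0 is the line through the origin. The `Hub` that a rejecting
        -- head produces reaches it along the bus and back through time.
        reject-line : ∀ n → ctl n ≡ inj₂ false → Line (column (+ 0) 0) (+ 0)
        reject-line n e = broadcast-line (block (suc (suc n)) (headpos n ℤ.+ (+ 1 ℤ.- + 2))) (+ 0)
          (line (line-single (suc n) (headpos n) (subst (At (suc n) (headpos n)) (trans (glance-head n refl) (cong (λ c → head c (tape n (headpos n))) e))
            (derive (suc n) (headpos n) (inner n
              (ℤₚ.<-≤-trans (below n (ℕₚ.<⇒≤ (reach-> h n))) (pos-≥ n))
              (ℤₚ.≤-<-trans (pos-≤ starts n) (ℤ.+<+ (ℕₚ.n<1+n n)))))) (here refl)))

-- A machine that is given its own encoding

open Finite

infixr 5 _∷_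

-- The length is bounded so that a word still to be written can be part of a state.
data Word : ℕ → Set where
  []  : ∀ {n} → Word n
  _∷_ : ∀ {n} → Letter → Word n → Word (suc n)

letters : ∀ {n} → Word n → List Letter
letters []      = []
letters (ℓ ∷ w) = ℓ ∷ letters w

weaken : ∀ {n} → Word n → Word (suc n)
weaken []      = []
weaken (ℓ ∷ w) = ℓ ∷ weaken w

letters-weaken : ∀ {n} (w : Word n) → letters (weaken w) ≡ letters w
letters-weaken []      = refl
letters-weaken (ℓ ∷ w) = cong (ℓ ∷_) (letters-weaken w)

finiteLetter : Finite Letter
finiteLetter = record
  { elements = one ∷ minus ∷ end ∷ []
  ; complete = λ { one → here refl ; minus → there (here refl) ; end → there (there (here refl)) }
  }

-- The words of length at most eleven number (3^12 - 1) / 2 = 265720; their list must not be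
-- unfolded when columns are computed.
abstract
  finiteWord : ∀ n → Finite (Word n)
  finiteWord zero = record { elements = [] ∷ [] ; complete = λ { [] → here refl } }
  finiteWord (suc n) = record
    { elements = [] ∷ map (uncurry _∷_) (cartesianProduct (elements finiteLetter) (elements (finiteWord n)))
    ; complete = λ
      { []      → here refl
      ; (ℓ ∷ w) → there (∈ₚ.∈-map⁺ (uncurry _∷_)
          (∈ₚ.∈-cartesianProduct⁺ (complete finiteLetter ℓ) (complete (finiteWord n) w)))
      }
    }

data Mark : Set where
  new copied idle counted : Mark

-- The input h lies on the left of home as items, one for each letter and a last
-- one for the end.  The machine first copies h to the right of home, then adds
-- the code of the seed of each item, for which it counts the items up to this
-- one, and finally erases the items and starts M.
module Quine (M : TuringMachine Letter) where
  open TuringMachine M renaming (start to startᴹ; δ to δᴹ)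

  data Γ : Set where
    filler home : Γ
    item : Mark → Maybe Letter → Γ
    symb  : Symbol Letter #work-symbols → Γ

  data Phase : Set where
    copying entering counting : Phase

  data Q : Set where
    seek  : Phase → Q
    -- Eleven is the length of the longest word, `columnWord nothing`.
    emit  : Phase → Word 11 → Q
    reset erase : Q
    sim   : Fin #states → Q

  □ : Γ
  □ = symb blank

  embed : Control #states → Q ⊎ Bool
  embed (state q)  = inj₁ (sim q)
  embed (halted b) = inj₂ b

  -- The code of the seed (2 , 0 , 0), and the step of the y-coordinate from one
  -- injecting seed to the next.
  bootWord fourWord : Word 11
  bootWord = one ∷ one ∷ end ∷ end ∷ end ∷ one ∷ end ∷ []
  fourWord = one ∷ one ∷ one ∷ one ∷ []

  -- The x-coordinate of a seed that injects s.
  columnWord : Maybe Letter → Word 11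
  columnWord (just one)   = one ∷ one ∷ one ∷ one ∷ end ∷ []
  columnWord (just minus) = one ∷ one ∷ one ∷ one ∷ one ∷ one ∷ end ∷ []
  columnWord (just end)   = one ∷ one ∷ one ∷ one ∷ one ∷ one ∷ one ∷ one ∷ end ∷ []
  columnWord nothing      = one ∷ one ∷ one ∷ one ∷ one ∷ one ∷ one ∷ one ∷ one ∷ one ∷ end ∷ []

  Action : Set
  Action = (Q ⊎ Bool) × Γ × Direction

  δ : Q → Γ → Action
  δ (seek copying) (item new (just ℓ))      = inj₁ (emit copying (ℓ ∷ [])) , item copied (just ℓ) , right
  δ (seek copying) (item new nothing)       = inj₁ (emit entering bootWord) , item copied nothing , right
  δ (seek entering) (item copied s)         = inj₁ (emit counting (columnWord s)) , item idle s , right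
  δ (seek entering) (item idle nothing)     = inj₁ erase , □ , right
  δ (seek counting) (item idle s)           = inj₁ (emit counting fourWord) , item counted s , right
  δ (seek counting) (item copied s)         = inj₁ reset , item copied s , right
  δ (seek counting) (item counted nothing)  = inj₁ reset , item idle nothing , right
  δ (seek p) a                              = inj₁ (seek p) , a , left
  δ reset (item counted s)                  = inj₁ reset , item idle s , right
  -- The first `end` is written on the spot and closes the y-coordinate. The word that follows codes
  -- z = 0 and one chip.
  δ reset (symb blank)                       = inj₁ (emit entering (end ∷ one ∷ end ∷ [])) , symb (input end) , right
  δ reset a                                 = inj₁ reset , a , right
  δ erase home                              = embed startᴹ , □ , right
  δ erase a                                 = inj₁ erase , □ , right
  δ (emit p (ℓ ∷ []))      (symb blank)      = inj₁ (seek p) , symb (input ℓ) , left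
  δ (emit p (ℓ ∷ ℓ′ ∷ w)) (symb blank)      = inj₁ (emit p (weaken (ℓ′ ∷ w))) , symb (input ℓ) , right
  δ (emit p [])            (symb blank)      = inj₂ true , □ , right
  δ (emit p w) a                            = inj₁ (emit p w) , a , right
  δ (sim q) (symb a)                         = let c , a′ , d = δᴹ q a in embed c , symb a′ , d
  δ (sim q) a                               = inj₂ true , a , right

  open Machine Γ Q □ δ

  finiteΓ : Finite Γ
  finiteΓ = record
    { elements = filler ∷ home ∷ map (uncurry item) (cartesianProduct marks wordSymbols) ++ map symb symbols
    ; complete = λ
      { filler → here refl
      ; home → there (here refl)
      ; (item m s) → there (there (∈ₚ.∈-++⁺ˡ (∈ₚ.∈-map⁺ (uncurry item) (∈ₚ.∈-cartesianProduct⁺ (mark m) (wordSymbol s)))))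
      ; (symb a) → there (there (∈ₚ.∈-++⁺ʳ (map (uncurry item) (cartesianProduct marks wordSymbols)) (∈ₚ.∈-map⁺ symb (symbol a))))
      }
    }
    where
    marks : List Mark
    marks = new ∷ copied ∷ idle ∷ counted ∷ []
    mark : ∀ m → m ∈ marks
    mark new     = here refl
    mark copied  = there (here refl)
    mark idle    = there (there (here refl))
    mark counted = there (there (there (here refl)))
    wordSymbols : List (Maybe Letter)
    wordSymbols = nothing ∷ map just (elements finiteLetter)
    wordSymbol : ∀ s → s ∈ wordSymbols
    wordSymbol nothing  = here refl
    wordSymbol (just ℓ) = there (∈ₚ.∈-map⁺ just (complete finiteLetter ℓ))
    symbols : List (Symbol Letter #work-symbols)
    symbols = blank ∷ map input (elements finiteLetter) ++ map work (allFin _)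
    symbol : ∀ a → a ∈ symbols
    symbol blank     = here refl
    symbol (input ℓ) = there (∈ₚ.∈-++⁺ˡ (∈ₚ.∈-map⁺ input (complete finiteLetter ℓ)))
    symbol (work i)  = there (∈ₚ.∈-++⁺ʳ (map input (elements finiteLetter)) (∈ₚ.∈-map⁺ work (∈ₚ.∈-allFin i)))

  finiteQ : Finite Q
  finiteQ = record
    { elements = reset ∷ erase ∷ map seek phases ++ (map (uncurry emit) (cartesianProduct phases (elements (finiteWord 11))) ++
        map sim (allFin _))
    ; complete = λ
      { reset → here refl
      ; erase → there (here refl)
      ; (seek p) → there (there (∈ₚ.∈-++⁺ˡ (∈ₚ.∈-map⁺ seek (phase p))))
      ; (emit p w) → there (there (∈ₚ.∈-++⁺ʳ (map seek phases) (∈ₚ.∈-++⁺ˡ (∈ₚ.∈-map⁺ (uncurry emit)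
          (∈ₚ.∈-cartesianProduct⁺ (phase p) (complete (finiteWord 11) w))))))
      ; (sim q) → there (there (∈ₚ.∈-++⁺ʳ (map seek phases)
          (∈ₚ.∈-++⁺ʳ (map (uncurry emit) (cartesianProduct phases (elements (finiteWord 11)))) (∈ₚ.∈-map⁺ sim (∈ₚ.∈-allFin q)))))
      }
    }
    where
    phases : List Phase
    phases = copying ∷ entering ∷ counting ∷ []
    phase : ∀ p → p ∈ phases
    phase copying  = here refl
    phase entering = there (here refl)
    phase counting = there (there (here refl))

  -- Sweeps and loops of the machine

  infix 4 _⟶*_
  _⟶*_ : Config → Config → Set
  c ⟶* c′ = ∃[ n ] iterate n c ≡ c′

  iterate-+ : ∀ m n c → iterate (m + n) c ≡ iterate m (iterate n c)
  iterate-+ zero    n c = refl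
  iterate-+ (suc m) n c = cong next (iterate-+ m n c)

  infixr 3 _⨾_
  _⨾_ : ∀ {c c′ c″} → c ⟶* c′ → c′ ⟶* c″ → c ⟶* c″
  _⨾_ {c} (n , refl) (m , e) = m + n , trans (iterate-+ m n c) e

  ε : ∀ {c c′} → c ≡ c′ → c ⟶* c′
  ε e = 0 , e

  front back : List Γ → List Γ → Strip
  front ls []       = ls , □ , []
  front ls (a ∷ rs) = ls , a , rs
  back []       rs  = [] , □ , rs
  back (a ∷ ls) rs  = ls , a , rs

  shift-right : ∀ ls a rs → shift right (ls , a , rs) ≡ front (a ∷ ls) rs
  shift-right ls a []      = refl
  shift-right ls a (_ ∷ _) = refl

  shift-left : ∀ ls a rs → shift left (ls , a , rs) ≡ back ls (a ∷ rs)
  shift-left []      a rs = refl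
  shift-left (_ ∷ _) a rs = refl

  step-right : ∀ {q ls a rs c a′} → δ q a ≡ (c , a′ , right) → (inj₁ q , ls , a , rs) ⟶* (c , front (a′ ∷ ls) rs)
  step-right {ls = ls} {rs = rs} {c} {a′} e =
    1 , trans (cong (λ (c , a , d) → c , shift d (ls , a , rs)) e) (cong (c ,_) (shift-right ls a′ rs))

  step-left : ∀ {q ls a rs c a′} → δ q a ≡ (c , a′ , left) → (inj₁ q , ls , a , rs) ⟶* (c , back ls (a′ ∷ rs))
  step-left {ls = ls} {rs = rs} {c} {a′} e =
    1 , trans (cong (λ (c , a , d) → c , shift d (ls , a , rs)) e) (cong (c ,_) (shift-left ls a′ rs))

  run-right : ∀ q f ls bs rs → All (λ a → δ q a ≡ (inj₁ q , f a , right)) bs →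
    (inj₁ q , front ls (bs ++ rs)) ⟶* (inj₁ q , front (map f bs ʳ++ ls) rs)
  run-right q f ls []       rs []       = ε refl
  run-right q f ls (b ∷ bs) rs (e ∷ es) = step-right e ⨾ run-right q f (f b ∷ ls) bs rs es

  run-left : ∀ q as ls rs → All (λ a → δ q a ≡ (inj₁ q , a , left)) as →
    (inj₁ q , back (as ++ ls) rs) ⟶* (inj₁ q , back ls (as ʳ++ rs))
  run-left q []       ls rs []       = ε refl
  run-left q (a ∷ as) ls rs (e ∷ es) = step-left e ⨾ run-left q as ls (a ∷ rs) es

  outputs : List Letter → List Γ
  outputs = map (symb ∘ input)

  -- Outputs are listed backwards, from the right end of the tape.
  turn : List Letter → List Γ → Strip
  turn []       ls = back ls []
  turn (ℓ ∷ os) ls = back (outputs os ++ ls) (symb (input ℓ) ∷ [])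

  emission : ∀ p (w : Word 11) {ℓ l} os ls → letters w ≡ ℓ ∷ l →
    (inj₁ (emit p w) , outputs os ++ ls , □ , []) ⟶* (inj₁ (seek p) , turn ((ℓ ∷ l) ʳ++ os) ls)
  emission p w {ℓ} {l} os ls e = go l w os e
    where
    go : ∀ l {ℓ} (w : Word 11) os → letters w ≡ ℓ ∷ l →
      (inj₁ (emit p w) , outputs os ++ ls , □ , []) ⟶* (inj₁ (seek p) , turn (l ʳ++ (ℓ ∷ os)) ls)
    go []       (ℓ ∷ [])     os refl = step-left refl
    go (_ ∷ l) (ℓ ∷ ℓ′ ∷ w) os refl = step-right refl ⨾ go l (weaken (ℓ′ ∷ w)) (ℓ ∷ os) (letters-weaken (ℓ′ ∷ w))

  Item : Set
  Item = Mark × Maybe Letter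

  cells : List Item → List Γ
  cells []             = []
  cells ((m , s) ∷ xs) = filler ∷ item m s ∷ cells xs

  prefix : List Item → List Γ
  prefix pre = home ∷ cells pre ++ filler ∷ []

  cells-split : ∀ pre m s post →
    home ∷ cells (pre ++ (m , s) ∷ post) ≡ prefix pre ++ item m s ∷ cells post
  cells-split pre m s post = cong (home ∷_) (go pre)
    where
    go : ∀ pre → cells (pre ++ (m , s) ∷ post) ≡ (cells pre ++ filler ∷ []) ++ item m s ∷ cells post
    go []        = refl
    go (_ ∷ pre) = cong (λ as → filler ∷ item _ _ ∷ as) (go pre)

  -- What a sweep across the tape has to check, shared by the states that seek, emit and reset:
  -- nothing but marks may change.
  record Passes (q : Q) (d : Direction) (remark : Mark → Mark) (pre : List Item) : Set where
    field
      at-home   : δ q home ≡ (inj₁ q , home , d)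
      at-filler : δ q filler ≡ (inj₁ q , filler , d)
      at-input  : ∀ ℓ → δ q (symb (input ℓ)) ≡ (inj₁ q , symb (input ℓ) , d)
      at-item   : All (λ (m , s) → δ q (item m s) ≡ (inj₁ q , item (remark m) s , d)) pre

  open Passes

  relabel : (Mark → Mark) → Γ → Γ
  relabel remark (item m s) = item (remark m) s
  relabel remark a          = a

  remarked : (Mark → Mark) → List Item → List Item
  remarked remark = map λ (m , s) → remark m , s

  passes-outputs : ∀ {q d remark pre} → Passes q d remark pre → ∀ os →
    All (λ a → δ q a ≡ (inj₁ q , relabel remark a , d)) (outputs os)
  passes-outputs P []       = []
  passes-outputs P (ℓ ∷ os) = at-input P ℓ ∷ passes-outputs P os

  passes-prefix : ∀ {q d remark pre} → Passes q d remark pre →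
    All (λ a → δ q a ≡ (inj₁ q , relabel remark a , d)) (prefix pre)
  passes-prefix {q} {d} {remark} P = at-home P ∷ go (at-item P)
    where
    go : ∀ {pre} → All (λ (m , s) → δ q (item m s) ≡ (inj₁ q , item (remark m) s , d)) pre →
      All (λ a → δ q a ≡ (inj₁ q , relabel remark a , d)) (cells pre ++ filler ∷ [])
    go []       = at-filler P ∷ []
    go (e ∷ es) = at-filler P ∷ e ∷ go es

  relabel-outputs : ∀ remark os → map (relabel remark) (outputs os) ≡ outputs os
  relabel-outputs remark []       = refl
  relabel-outputs remark (ℓ ∷ os) = cong (_ ∷_) (relabel-outputs remark os)

  relabel-prefix : ∀ remark pre → map (relabel remark) (prefix pre) ≡ prefix (remarked remark pre)
  relabel-prefix remark pre = cong (home ∷_) (go pre)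
    where
    go : ∀ pre → map (relabel remark) (cells pre ++ filler ∷ []) ≡ cells (remarked remark pre) ++ filler ∷ []
    go []        = refl
    go (_ ∷ pre) = cong (λ as → filler ∷ item _ _ ∷ as) (go pre)

  private
    unrelabel : ∀ {q d as} → All (λ a → δ q a ≡ (inj₁ q , relabel id a , d)) as →
      All (λ a → δ q a ≡ (inj₁ q , a , d)) as
    unrelabel = All.map λ {a} e → trans e (cong (λ a → inj₁ _ , a , _) (relabel-id a))
      where
      relabel-id : ∀ a → relabel id a ≡ a
      relabel-id filler     = refl
      relabel-id home       = refl
      relabel-id (item _ _) = refl
      relabel-id (symb _)   = refl

    all-ʳ++ : ∀ {P : Γ → Set} {as bs} → All P as → All P bs → All P (as ʳ++ bs)
    all-ʳ++ []       qs = qs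
    all-ʳ++ (p ∷ ps) qs = all-ʳ++ ps (p ∷ qs)

  seeking : Phase → List Letter → List Item → Config
  seeking p os xs = inj₁ (seek p) , turn os (home ∷ cells xs)

  go-left : ∀ p os pre m s post → Passes (seek p) left id pre →
    seeking p os (pre ++ (m , s) ∷ post) ⟶*
    (inj₁ (seek p) , back (item m s ∷ cells post) ((outputs os ++ prefix pre) ʳ++ []))
  go-left p os pre m s post P =
    ε (cong (λ ls → inj₁ (seek p) , turn os ls) (cells-split pre m s post)) ⨾ go os
    where
    ls = item m s ∷ cells post
    go : ∀ os → (inj₁ (seek p) , turn os (prefix pre ++ ls)) ⟶*
      (inj₁ (seek p) , back ls ((outputs os ++ prefix pre) ʳ++ []))
    go []       = run-left (seek p) (prefix pre) ls [] (unrelabel (passes-prefix P))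
    go (ℓ ∷ os) =
      ε (cong (λ ls → inj₁ (seek p) , back ls (symb (input ℓ) ∷ [])) (sym (Lₚ.++-assoc (outputs os) (prefix pre) ls))) ⨾
      run-left (seek p) (outputs os ++ prefix pre) ls (symb (input ℓ) ∷ [])
        (Allₚ.++⁺ (unrelabel (passes-outputs P os)) (unrelabel (passes-prefix P)))

  -- The unit of the loops below: from the end of the output left to one item, and back. The list of
  -- crossed cells is reversed on the way out and reversed again on the way back.
  round : ∀ p q remark os pre m m′ s post → Passes (seek p) left id pre → Passes q right remark pre →
    δ (seek p) (item m s) ≡ (inj₁ q , item m′ s , right) →
    seeking p os (pre ++ (m , s) ∷ post) ⟶*
    (inj₁ q , outputs os ++ home ∷ cells (remarked remark pre ++ (m′ , s) ∷ post) , □ , [])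
  round p q remark os pre m m′ s post P P′ e =
    go-left p os pre m s post P ⨾ step-right e ⨾
    ε (cong (λ rs → inj₁ q , front L rs) (sym (Lₚ.++-identityʳ (as ʳ++ [])))) ⨾
    run-right q f L (as ʳ++ []) [] (all-ʳ++ (Allₚ.++⁺ (passes-outputs P′ os) (passes-prefix P′)) []) ⨾
    ε (cong (λ ls → inj₁ q , ls , □ , []) eq)
    where
    open ≡-Reasoning
    f = relabel remark
    L = item m′ s ∷ cells post
    as = outputs os ++ prefix pre
    eq : map f (as ʳ++ []) ʳ++ L ≡ outputs os ++ home ∷ cells (remarked remark pre ++ (m′ , s) ∷ post)
    eq = begin
      map f (as ʳ++ []) ʳ++ L                               ≡⟨ cong (_ʳ++ L) (Lₚ.map-ʳ++ f as) ⟩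
      (map f as ʳ++ []) ʳ++ L                               ≡⟨ Lₚ.ʳ++-ʳ++ (map f as) ⟩
      map f as ++ L                                         ≡⟨ cong (_++ L) (Lₚ.map-++ f (outputs os) (prefix pre)) ⟩
      (map f (outputs os) ++ map f (prefix pre)) ++ L       ≡⟨ cong (_++ L) (cong₂ _++_ (relabel-outputs remark os) (relabel-prefix remark pre)) ⟩
      (outputs os ++ prefix (remarked remark pre)) ++ L     ≡⟨ Lₚ.++-assoc (outputs os) _ L ⟩
      outputs os ++ prefix (remarked remark pre) ++ L       ≡⟨ cong (outputs os ++_) (cells-split (remarked remark pre) m′ s post) ⟨
      outputs os ++ home ∷ cells (remarked remark pre ++ (m′ , s) ∷ post) ∎

  marked : Mark → List Letter → List Item
  marked m = map λ ℓ → m , just ℓ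

  all-marked : ∀ {P : Item → Set} m ds → (∀ ℓ → P (m , just ℓ)) → All P (marked m ds)
  all-marked m []       p = []
  all-marked m (d ∷ ds) p = p d ∷ all-marked m ds p

  marked-snoc : ∀ m ds ℓ xs → marked m (ds ++ ℓ ∷ []) ++ xs ≡ marked m ds ++ (m , just ℓ) ∷ xs
  marked-snoc m []       ℓ xs = refl
  marked-snoc m (_ ∷ ds) ℓ xs = cong (_ ∷_) (marked-snoc m ds ℓ xs)

  remarked-id : ∀ pre → remarked id pre ≡ pre
  remarked-id = Lₚ.map-id

  toIdle : Mark → Mark
  toIdle counted = idle
  toIdle m       = m

  remarked-marked : ∀ ds → remarked toIdle (marked counted ds) ≡ marked idle ds
  remarked-marked ds = sym (Lₚ.map-∘ ds)

  private
    emit-item : ∀ p w m s → δ (emit p w) (item m s) ≡ (inj₁ (emit p w) , item m s , right)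
    emit-item p []          m s = refl
    emit-item p (_ ∷ [])    m s = refl
    emit-item p (_ ∷ _ ∷ _) m s = refl

    emit-passes : ∀ p w pre → Passes (emit p w) right id pre
    emit-passes p w pre = record
      { at-home = home-skip w ; at-filler = filler-skip w ; at-input = input-skip w
      ; at-item = All.universal (λ (m , s) → emit-item p w m s) pre }
      where
      home-skip : ∀ w → δ (emit p w) home ≡ (inj₁ (emit p w) , home , right)
      home-skip [] = refl
      home-skip (_ ∷ []) = refl
      home-skip (_ ∷ _ ∷ _) = refl
      filler-skip : ∀ w → δ (emit p w) filler ≡ (inj₁ (emit p w) , filler , right)
      filler-skip [] = refl
      filler-skip (_ ∷ []) = refl
      filler-skip (_ ∷ _ ∷ _) = refl
      input-skip : ∀ w ℓ → δ (emit p w) (symb (input ℓ)) ≡ (inj₁ (emit p w) , symb (input ℓ) , right)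
      input-skip [] ℓ = refl
      input-skip (_ ∷ []) ℓ = refl
      input-skip (_ ∷ _ ∷ _) ℓ = refl

    copying-passes : ∀ ds → Passes (seek copying) left id (marked copied ds)
    copying-passes ds = record
      { at-home = refl ; at-filler = refl ; at-input = λ _ → refl ; at-item = all-marked copied ds λ _ → refl }

    entering-passes : ∀ ds → Passes (seek entering) left id (marked idle ds)
    entering-passes ds = record
      { at-home = refl ; at-filler = refl ; at-input = λ _ → refl ; at-item = all-marked idle ds λ _ → refl }

    counting-passes : ∀ ds → Passes (seek counting) left id (marked counted ds)
    counting-passes ds = record
      { at-home = refl ; at-filler = refl ; at-input = λ _ → refl ; at-item = all-marked counted ds λ _ → refl }

    reset-passes : ∀ ds → Passes reset right toIdle (marked counted ds)
    reset-passes ds = record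
      { at-home = refl ; at-filler = refl ; at-input = λ _ → refl ; at-item = all-marked counted ds λ _ → refl }

  visit : ∀ p p′ (w : Word 11) {ℓ l} os pre m m′ s post → Passes (seek p) left id pre →
    δ (seek p) (item m s) ≡ (inj₁ (emit p′ w) , item m′ s , right) → letters w ≡ ℓ ∷ l →
    seeking p os (pre ++ (m , s) ∷ post) ⟶* seeking p′ ((ℓ ∷ l) ʳ++ os) (pre ++ (m′ , s) ∷ post)
  visit p p′ w os pre m m′ s post P e ew =
    round p (emit p′ w) id os pre m m′ s post P (emit-passes p′ w pre) e ⨾
    ε (cong (λ pre → inj₁ (emit p′ w) , outputs os ++ home ∷ cells (pre ++ (m′ , s) ∷ post) , □ , []) (remarked-id pre)) ⨾
    emission p′ w os _ ew

  copy-loop : ∀ ds h os →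
    seeking copying os (marked copied ds ++ marked new h ++ (new , nothing) ∷ []) ⟶*
    seeking entering (letters bootWord ʳ++ (h ʳ++ os)) (marked copied (ds ++ h) ++ (copied , nothing) ∷ [])
  copy-loop ds [] os =
    visit copying entering bootWord os (marked copied ds) new copied nothing [] (copying-passes ds) refl refl ⨾
    ε (cong (λ ds → seeking entering (letters bootWord ʳ++ os) (marked copied ds ++ (copied , nothing) ∷ []))
      (sym (Lₚ.++-identityʳ ds)))
  copy-loop ds (ℓ ∷ h) os =
    visit copying copying (ℓ ∷ []) os (marked copied ds) new copied (just ℓ) xs (copying-passes ds) refl refl ⨾
    ε (cong (seeking copying (ℓ ∷ os)) (sym (marked-snoc copied ds ℓ xs))) ⨾
    copy-loop (ds ++ ℓ ∷ []) h (ℓ ∷ os) ⨾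
    ε (cong (λ ds → seeking entering (letters bootWord ʳ++ (h ʳ++ (ℓ ∷ os))) (marked copied ds ++ (copied , nothing) ∷ []))
      (Lₚ.++-assoc ds (ℓ ∷ []) h))
    where
    xs : List Item
    xs = marked new h ++ (new , nothing) ∷ []

  fours : ℕ → List Letter → List Letter
  fours zero    os = os
  fours (suc k) os = fours k (one ∷ one ∷ one ∷ one ∷ os)

  -- The index of an item is unbounded, so it is counted in marks on the tape: each item up to the
  -- current one contributes one step of the y-coordinate.
  count-loop : ∀ cs ds os s post →
    seeking counting os (marked counted cs ++ marked idle ds ++ (idle , s) ∷ post) ⟶*
    seeking counting (fours (suc (length ds)) os) (marked counted (cs ++ ds) ++ (counted , s) ∷ post)
  count-loop cs [] os s post =
    visit counting counting fourWord os (marked counted cs) idle counted s post (counting-passes cs) refl refl ⨾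
    ε (cong (λ ds → seeking counting (fours 1 os) (marked counted ds ++ (counted , s) ∷ post)) (sym (Lₚ.++-identityʳ cs)))
  count-loop cs (d ∷ ds) os s post =
    visit counting counting fourWord os (marked counted cs) idle counted (just d) xs (counting-passes cs) refl refl ⨾
    ε (cong (seeking counting (fours 1 os)) (sym (marked-snoc counted cs d xs))) ⨾
    count-loop (cs ++ d ∷ []) ds (fours 1 os) s post ⨾
    ε (cong (λ ds′ → seeking counting (fours (suc (length ds)) (fours 1 os)) (marked counted ds′ ++ (counted , s) ∷ post))
      (Lₚ.++-assoc cs (d ∷ []) ds))
    where
    xs : List Item
    xs = marked idle ds ++ (idle , s) ∷ post

  column-word : ∀ s → ∃[ l ] letters (columnWord s) ≡ one ∷ l
  column-word (just one)   = _ , refl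
  column-word (just minus) = _ , refl
  column-word (just end)   = _ , refl
  column-word nothing      = _ , refl

  entry-start : ∀ ds os s post →
    seeking entering os (marked idle ds ++ (copied , s) ∷ post) ⟶*
    seeking counting (fours (suc (length ds)) (letters (columnWord s) ʳ++ os)) (marked counted ds ++ (counted , s) ∷ post)
  entry-start ds os s post with l , e ← column-word s =
    visit entering counting (columnWord s) os (marked idle ds) copied idle s post (entering-passes ds) refl e ⨾
    ε (cong (λ l → seeking counting (l ʳ++ os) (marked idle ds ++ (idle , s) ∷ post)) (sym e)) ⨾
    count-loop [] ds (letters (columnWord s) ʳ++ os) s post

  entry-end : ∀ ds os m m′ s post → δ (seek counting) (item m s) ≡ (inj₁ reset , item m′ s , right) →
    seeking counting os (marked counted ds ++ (m , s) ∷ post) ⟶*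
    seeking entering (end ∷ one ∷ end ∷ end ∷ os) (marked idle ds ++ (m′ , s) ∷ post)
  entry-end ds os m m′ s post e =
    round counting reset toIdle os (marked counted ds) m m′ s post (counting-passes ds) (reset-passes ds) e ⨾
    step-right refl ⨾
    emission entering (end ∷ one ∷ end ∷ []) (end ∷ os)
      (home ∷ cells (remarked toIdle (marked counted ds) ++ (m′ , s) ∷ post)) refl ⨾
    ε (cong (λ pre → seeking entering (end ∷ one ∷ end ∷ end ∷ os) (pre ++ (m′ , s) ∷ post)) (remarked-marked ds))

  entry : ℕ → Maybe Letter → List Letter → List Letter
  entry i s os = end ∷ one ∷ end ∷ end ∷ fours (suc i) (letters (columnWord s) ʳ++ os)

  entries : ℕ → List Letter → List Letter → List Letter
  entries i []      os = entry i nothing os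
  entries i (ℓ ∷ h) os = entries (suc i) h (entry i (just ℓ) os)

  entry-loop : ∀ ds h os →
    seeking entering os (marked idle ds ++ marked copied h ++ (copied , nothing) ∷ []) ⟶*
    seeking entering (entries (length ds) h os) (marked idle (ds ++ h) ++ (idle , nothing) ∷ [])
  entry-loop ds [] os =
    entry-start ds os nothing [] ⨾
    entry-end ds (fours (suc (length ds)) (letters (columnWord nothing) ʳ++ os)) counted idle nothing [] refl ⨾
    ε (cong (λ ds′ → seeking entering (entry (length ds) nothing os) (marked idle ds′ ++ (idle , nothing) ∷ []))
      (sym (Lₚ.++-identityʳ ds)))
  entry-loop ds (ℓ ∷ h) os =
    entry-start ds os (just ℓ) xs ⨾
    ε (cong (seeking counting os₁) (sym (marked-snoc counted ds ℓ xs))) ⨾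
    next-item h ⨾
    entry-loop (ds ++ ℓ ∷ []) h (entry (length ds) (just ℓ) os) ⨾
    ε (cong₂ (λ i ds′ → seeking entering (entries i h (entry (length ds) (just ℓ) os)) (marked idle ds′ ++ (idle , nothing) ∷ []))
      (trans (Lₚ.length-++ ds) (ℕₚ.+-comm (length ds) 1)) (Lₚ.++-assoc ds (ℓ ∷ []) h))
    where
    xs : List Item
    xs = marked copied h ++ (copied , nothing) ∷ []
    os₁ : List Letter
    os₁ = fours (suc (length ds)) (letters (columnWord (just ℓ)) ʳ++ os)
    next-item : ∀ h →
      seeking counting os₁ (marked counted (ds ++ ℓ ∷ []) ++ marked copied h ++ (copied , nothing) ∷ []) ⟶*
      seeking entering (end ∷ one ∷ end ∷ end ∷ os₁) (marked idle (ds ++ ℓ ∷ []) ++ marked copied h ++ (copied , nothing) ∷ [])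
    next-item []       = entry-end (ds ++ ℓ ∷ []) os₁ copied copied nothing [] refl
    next-item (ℓ′ ∷ h) = entry-end (ds ++ ℓ ∷ []) os₁ copied copied (just ℓ′) (marked copied h ++ (copied , nothing) ∷ []) refl

  blanks : ∀ bs k → map (λ _ → □) (bs ʳ++ []) ʳ++ replicate k □ ≡ replicate (length bs + k) □
  blanks bs k = trans (cong (_ʳ++ replicate k □) (Lₚ.map-ʳ++ (λ _ → □) bs))
    (trans (Lₚ.ʳ++-ʳ++ (map (λ _ → □) bs)) (go bs))
    where
    go : ∀ (bs : List Γ) → map (λ _ → □) bs ++ replicate k □ ≡ replicate (length bs + k) □
    go []       = refl
    go (_ ∷ bs) = cong (□ ∷_) (go bs)

  erasing : ∀ ds os → ∃[ k ] seeking entering os (marked idle ds ++ (idle , nothing) ∷ []) ⟶*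
    (embed startᴹ , front (replicate k □) (outputs (os ʳ++ [])))
  erasing ds os = suc (length bs + 1) ,
    (go-left entering os (marked idle ds) idle nothing [] (entering-passes ds) ⨾ step-right refl ⨾
     ε (cong (λ rs → inj₁ erase , front (□ ∷ []) rs) eq) ⨾
     run-right erase (λ _ → □) (□ ∷ []) (bs ʳ++ []) (home ∷ outputs (os ʳ++ []))
       (all-ʳ++ (erases (marked idle ds)) []) ⨾
     step-right refl ⨾
     ε (cong (λ ls → embed startᴹ , front (□ ∷ ls) (outputs (os ʳ++ []))) (blanks bs 1)))
    where
    open ≡-Reasoning
    bs = cells (marked idle ds) ++ filler ∷ []
    erases : ∀ xs → All (λ a → δ erase a ≡ (inj₁ erase , □ , right)) (cells xs ++ filler ∷ [])
    erases []       = refl ∷ []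
    erases (_ ∷ xs) = refl ∷ refl ∷ erases xs
    eq : (outputs os ++ home ∷ bs) ʳ++ [] ≡ (bs ʳ++ []) ++ home ∷ outputs (os ʳ++ [])
    eq = begin
      (outputs os ++ home ∷ bs) ʳ++ []           ≡⟨ Lₚ.++-ʳ++ (outputs os) ⟩
      bs ʳ++ (home ∷ outputs os ʳ++ [])          ≡⟨ cong (λ rs → bs ʳ++ (home ∷ rs)) (Lₚ.map-ʳ++ (symb ∘ input) os) ⟨
      bs ʳ++ (home ∷ outputs (os ʳ++ []))        ≡⟨ Lₚ.ʳ++-defn bs ⟩
      reverse′ bs ++ home ∷ outputs (os ʳ++ [])  ∎
      where reverse′ = λ (bs : List Γ) → bs ʳ++ []

  -- Erasing leaves explicit blanks on the left, where the initial tape of `M` lists nothing. `k`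
  -- counts those that `M` has not yet consumed.
  image : ℕ → Configuration M → Config
  image k (c , ⟨ ls , a , rs ⟩) = embed c , map symb ls ++ replicate k □ , symb a , map symb rs

  image-step : ∀ k c → ∃[ k′ ] next (image k c) ≡ image k′ (step M c)
  image-step k (halted b , ⟨ ls , a , rs ⟩) = k , refl
  image-step k (state q , ⟨ ls , a , rs ⟩) with δᴹ q a
  image-step zero    (state q , ⟨ [] , a , rs ⟩)     | c , a′ , left = 0 , refl
  image-step (suc k) (state q , ⟨ [] , a , rs ⟩)     | c , a′ , left = k , refl
  image-step k       (state q , ⟨ _ ∷ _ , a , rs ⟩)  | c , a′ , left = k , refl
  image-step k       (state q , ⟨ ls , a , [] ⟩)     | c , a′ , right = k , refl
  image-step k       (state q , ⟨ ls , a , _ ∷ _ ⟩)  | c , a′ , right = k , refl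

  image-run : ∀ k w t → ∃[ k′ ] iterate t (image k (initial M w)) ≡ image k′ (run M w t)
  image-run k w zero = k , refl
  image-run k w (suc t) with k′ , e ← image-run k w t with k″ , e′ ← image-step k′ (run M w t) =
    k″ , trans (cong next e) e′

  image-initial : ∀ k w → (embed startᴹ , front (replicate k □) (outputs w)) ≡ image k (initial M w)
  image-initial k []      = refl
  image-initial k (ℓ ∷ w) = cong (λ rs → embed startᴹ , replicate k □ , symb (input ℓ) , rs) (Lₚ.map-∘ w)

  -- The word on which `M` is run

  fours-ʳ++ : ∀ k os zs → fours k os ʳ++ zs ≡ os ʳ++ (replicate (k * 4) one ++ zs)
  fours-ʳ++ zero    os zs = refl
  fours-ʳ++ (suc k) os zs = fours-ʳ++ k (one ∷ one ∷ one ∷ one ∷ os) zs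

  entryCode : ℕ → Maybe Letter → List Letter
  entryCode i s = letters (columnWord s) ++ replicate (suc i * 4) one ++ end ∷ end ∷ one ∷ end ∷ []

  entriesCode : ℕ → List Letter → List Letter
  entriesCode i []      = entryCode i nothing
  entriesCode i (ℓ ∷ h) = entryCode i (just ℓ) ++ entriesCode (suc i) h

  entry-ʳ++ : ∀ i s os zs → entry i s os ʳ++ zs ≡ os ʳ++ (entryCode i s ++ zs)
  entry-ʳ++ i s os zs = begin
    fours (suc i) (c ʳ++ os) ʳ++ z                     ≡⟨ fours-ʳ++ (suc i) (c ʳ++ os) z ⟩
    (c ʳ++ os) ʳ++ (r ++ z)                            ≡⟨ Lₚ.ʳ++-ʳ++ c ⟩
    os ʳ++ (c ++ r ++ z)                               ≡⟨ cong (os ʳ++_) (trans (cong (c ++_) (sym (Lₚ.++-assoc r _ zs))) (sym (Lₚ.++-assoc c _ zs))) ⟩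
    os ʳ++ (entryCode i s ++ zs)                       ∎
    where
    open ≡-Reasoning
    c = letters (columnWord s)
    r = replicate (suc i * 4) one
    z = end ∷ end ∷ one ∷ end ∷ zs

  entries-ʳ++ : ∀ i h os zs → entries i h os ʳ++ zs ≡ os ʳ++ (entriesCode i h ++ zs)
  entries-ʳ++ i []      os zs = entry-ʳ++ i nothing os zs
  entries-ʳ++ i (ℓ ∷ h) os zs = trans (entries-ʳ++ (suc i) h _ zs)
    (trans (entry-ʳ++ i (just ℓ) os _) (cong (os ʳ++_) (sym (Lₚ.++-assoc (entryCode i (just ℓ)) _ zs))))

  seedCode : List Letter → List Letter
  seedCode h = letters bootWord ++ entriesCode 0 h

  -- `seedCode h` is computed from the letters of `h` alone. If `h` is the code of the background
  -- that simulates this machine, then `M` is run on the code of the whole pile.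
  quine : ∀ h b → HaltsWith M (h ++ seedCode h) b →
    ∃[ n ] proj₁ (iterate n (inj₁ (seek copying) , cells (marked new h ++ (new , nothing) ∷ []) , home , [])) ≡ inj₂ b
  quine h b (t , tape , e) with k , erase-run ← erasing h (entries 0 h (letters bootWord ʳ++ (h ʳ++ [])))
    with n , e₁ ← copy-loop [] h [] ⨾ entry-loop [] h _ ⨾ erase-run
    with k′ , e₂ ← image-run k (h ++ seedCode h) t =
    t + n , trans (cong proj₁ (trans (iterate-+ t n _)
      (trans (cong (iterate t) (trans e₁ (trans (cong (λ w → embed startᴹ , front (replicate k □) (outputs w)) word)
        (image-initial k (h ++ seedCode h))))) (trans e₂ (cong (image k′) e))))) refl
    where
    open ≡-Reasoning
    word : entries 0 h (letters bootWord ʳ++ (h ʳ++ [])) ʳ++ [] ≡ h ++ seedCode h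
    word = begin
      entries 0 h (letters bootWord ʳ++ (h ʳ++ [])) ʳ++ []       ≡⟨ entries-ʳ++ 0 h _ [] ⟩
      (letters bootWord ʳ++ (h ʳ++ [])) ʳ++ (entriesCode 0 h ++ [])  ≡⟨ Lₚ.ʳ++-ʳ++ (letters bootWord) {h ʳ++ []} {entriesCode 0 h ++ []} ⟩
      (h ʳ++ []) ʳ++ (letters bootWord ++ entriesCode 0 h ++ []) ≡⟨ Lₚ.ʳ++-ʳ++ h {[]} ⟩
      h ++ letters bootWord ++ entriesCode 0 h ++ []             ≡⟨ cong (λ l → h ++ letters bootWord ++ l) (Lₚ.++-identityʳ (entriesCode 0 h)) ⟩
      h ++ seedCode h                                          ∎

-- The periodic+finite pile

periodic-≡ : ∀ {A : Set} (f : ℤ → A) n → (∀ i → f (i ℤ.+ + n) ≡ f i) → ∀ x x′ → x ≡ x′ mod n → f x ≡ f x′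
periodic-≡ f n period x x′ n∣ with divides q e ← ∣ᵤ⇒∣ {i = x ℤ.- x′} n∣ = trans (cong f (begin
    x                      ≡⟨ lemma x x′ ⟩
    (x ℤ.- x′) ℤ.+ x′      ≡⟨ cong (ℤ._+ x′) e ⟩
    q ℤ.* + n ℤ.+ x′       ∎)) (multiple q)
  where
  open ≡-Reasoning
  lemma : ∀ x x′ → x ≡ (x ℤ.- x′) ℤ.+ x′
  lemma = ℤ-solver.solve-∀
  lemma⁺ : ∀ q n x → (+ 1 ℤ.+ q) ℤ.* n ℤ.+ x ≡ (q ℤ.* n ℤ.+ x) ℤ.+ n
  lemma⁺ = ℤ-solver.solve-∀
  lemma⁻ : ∀ q n x → q ℤ.* n ℤ.+ x ≡ ((-[1+ 0 ] ℤ.+ q) ℤ.* n ℤ.+ x) ℤ.+ n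
  lemma⁻ = ℤ-solver.solve-∀
  multiple : ∀ q → f (q ℤ.* + n ℤ.+ x′) ≡ f x′
  multiple = ℤ-induction _ (cong f (trans (cong (ℤ._+ x′) (ℤₚ.*-zeroˡ (+ n))) (ℤₚ.+-identityˡ x′)))
    (λ q ih → trans (cong f (lemma⁺ q (+ n) x′)) (trans (period (q ℤ.* + n ℤ.+ x′)) ih))
    (λ q ih → trans (sym (period (ℤ.pred q ℤ.* + n ℤ.+ x′))) (trans (cong f (sym (lemma⁻ q (+ n) x′))) ih))

%ℕ-+ : ∀ i n .{{_ : NonZero n}} → (i ℤ.+ + n) %ℕ n ≡ i %ℕ n
%ℕ-+ i n = proj₁ (%ℕ-/ℕ-unique n {q = ℤ.suc (i /ℕ n)} (i ℤ.+ + n) (n%ℕd<d i n)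
  (trans (cong (ℤ._+ + n) (a≡a%ℕn+[a/ℕn]*n i n)) (lemma (+ (i %ℕ n)) (i /ℕ n) (+ n))))
  where
  lemma : ∀ r q n → (r ℤ.+ q ℤ.* n) ℤ.+ n ≡ r ℤ.+ (+ 1 ℤ.+ q) ℤ.* n
  lemma = ℤ-solver.solve-∀

orbit₂-+ : ∀ m x → O₂.orbit (x ℤ.+ + (m * 2)) ≡ (proj₁ (O₂.orbit x) ℤ.+ + m , proj₂ (O₂.orbit x))
orbit₂-+ zero x = trans (cong O₂.orbit (ℤₚ.+-identityʳ x))
  (cong (_, proj₂ (O₂.orbit x)) (sym (ℤₚ.+-identityʳ (proj₁ (O₂.orbit x)))))
orbit₂-+ (suc m) x = begin
  O₂.orbit (x ℤ.+ + (2 + m * 2))                   ≡⟨ cong O₂.orbit (lemma x (+ (m * 2))) ⟩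
  O₂.orbit (ℤ.suc (ℤ.suc (x ℤ.+ + (m * 2))))       ≡⟨ trans (O₂.orbit-suc (ℤ.suc (x ℤ.+ + (m * 2)))) (cong next₂ (O₂.orbit-suc (x ℤ.+ + (m * 2)))) ⟩
  next₂ (next₂ (O₂.orbit (x ℤ.+ + (m * 2))))       ≡⟨ cong (next₂ ∘ next₂) (orbit₂-+ m x) ⟩
  next₂ (next₂ (q ℤ.+ + m , b))                    ≡⟨ twice (q ℤ.+ + m) b ⟩
  (ℤ.suc (q ℤ.+ + m) , b)                          ≡⟨ cong (_, b) (lemma′ q (+ m)) ⟩
  (q ℤ.+ + suc m , b)                              ∎
  where
  open ≡-Reasoning
  q = proj₁ (O₂.orbit x)
  b = proj₂ (O₂.orbit x)
  lemma : ∀ x m → x ℤ.+ (+ 2 ℤ.+ m) ≡ + 1 ℤ.+ (+ 1 ℤ.+ (x ℤ.+ m))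
  lemma = ℤ-solver.solve-∀
  lemma′ : ∀ q m → + 1 ℤ.+ (q ℤ.+ m) ≡ q ℤ.+ (+ 1 ℤ.+ m)
  lemma′ = ℤ-solver.solve-∀
  twice : ∀ q b → next₂ (next₂ (q , b)) ≡ (ℤ.suc q , b)
  twice q false = refl
  twice q true  = refl

orbit₄-+ : ∀ y → O₄.orbit (y ℤ.+ + 4) ≡ (ℤ.suc (proj₁ (O₄.orbit y)) , proj₂ (O₄.orbit y))
orbit₄-+ y = trans (cong O₄.orbit (lemma y)) (trans (four y) (around (O₄.orbit y)))
  where
  lemma : ∀ y → y ℤ.+ + 4 ≡ + 1 ℤ.+ (+ 1 ℤ.+ (+ 1 ℤ.+ (+ 1 ℤ.+ y)))
  lemma = ℤ-solver.solve-∀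
  four : ∀ y → O₄.orbit (ℤ.suc (ℤ.suc (ℤ.suc (ℤ.suc y)))) ≡ next₄ (next₄ (next₄ (next₄ (O₄.orbit y))))
  four y = trans (O₄.orbit-suc (ℤ.suc (ℤ.suc (ℤ.suc y)))) (cong next₄ (trans (O₄.orbit-suc (ℤ.suc (ℤ.suc y)))
    (cong next₄ (trans (O₄.orbit-suc (ℤ.suc y)) (cong next₄ (O₄.orbit-suc y))))))
  around : ∀ q → next₄ (next₄ (next₄ (next₄ q))) ≡ (ℤ.suc (proj₁ q) , proj₂ q)
  around (q , β₀) = refl
  around (q , β₁) = refl
  around (q , β₂) = refl
  around (q , β₃) = refl

module Pile (M : TuringMachine Letter) where
  open Quine M
  open Machine Γ Q □ δ using (iterate; verdict-unique)
  open Automaton finiteΓ finiteQ □ filler home (item new) δ (seek copying) refl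

  cls-+W : ∀ Z X → cls Z (X ℤ.+ + W) ≡ cls Z X
  cls-+W Z X = cong (λ u → proj₁ (view hubs p u)) (trans
    (cong (_%ℕ W) (lemma X (+ W) (+ (m * w)))) (%ℕ-+ (X ℤ.- + (m * w)) W))
    where
    p = proj₁ (slot Z)
    m = proj₂ (slot Z)
    lemma : ∀ x w a → (x ℤ.+ w) ℤ.- a ≡ (x ℤ.- a) ℤ.+ w
    lemma = ℤ-solver.solve-∀

  cls-+R : ∀ Z X → cls (Z ℤ.+ + R) X ≡ cls Z X
  cls-+R Z X = cong (λ n → classˢ (nth (bus , 0) table n) X) (%ℕ-+ Z R)

  cls-suc-+W : ∀ Z X → cls Z (ℤ.suc (X ℤ.+ + W)) ≡ cls Z (ℤ.suc X)
  cls-suc-+W Z X = trans (cong (cls Z) (sym (ℤₚ.+-assoc (+ 1) X (+ W)))) (cls-+W Z (ℤ.suc X))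

  kind-+x : ∀ X b y z → kindˢ ((X ℤ.+ + W , b) , y , z) ≡ kindˢ ((X , b) , y , z)
  kind-+x X b (t , β) (Z , true)  = refl
  kind-+x X b (t , β) (Z , false) = cong₂ (circuit b β) (cls-+W Z X) (cls-suc-+W Z X)

  kind-+y : ∀ x t β z → kindˢ (x , (ℤ.suc t , β) , z) ≡ kindˢ (x , (t , β) , z)
  kind-+y x t β (Z , true)  = refl
  kind-+y x t β (Z , false) = refl

  kind-+z : ∀ x y Z b → kindˢ (x , y , (Z ℤ.+ + R , b)) ≡ kindˢ (x , y , (Z , b))
  kind-+z x       y       Z true  = refl
  kind-+z (X , b) (t , β) Z false = cong₂ (circuit b β) (cls-+R Z X) (cls-+R Z (ℤ.suc X))

  background : Vertex → ℤ
  background v = chips (kindˢ (site v))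

  background-periodic : ∀ x y z x′ y′ z′ → x ≡ x′ mod (W * 2) → y ≡ y′ mod 4 → z ≡ z′ mod (R * 2) →
    background (x , y , z) ≡ background (x′ , y′ , z′)
  background-periodic x y z x′ y′ z′ ex ey ez = cong chips (begin
    kindˢ (site (x , y , z))     ≡⟨ periodic-≡ (λ x → kindˢ (site (x , y , z))) (W * 2)
                                      (λ i → trans (cong (λ a → kindˢ (a , O₄.orbit y , O₂.orbit z)) (orbit₂-+ W i))
                                        (kind-+x (proj₁ (O₂.orbit i)) (proj₂ (O₂.orbit i)) (O₄.orbit y) (O₂.orbit z))) x x′ ex ⟩
    kindˢ (site (x′ , y , z))    ≡⟨ periodic-≡ (λ y → kindˢ (site (x′ , y , z))) 4
                                      (λ i → trans (cong (λ a → kindˢ (O₂.orbit x′ , a , O₂.orbit z)) (orbit₄-+ i))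
                                        (kind-+y (O₂.orbit x′) (proj₁ (O₄.orbit i)) (proj₂ (O₄.orbit i)) (O₂.orbit z))) y y′ ey ⟩
    kindˢ (site (x′ , y′ , z))   ≡⟨ periodic-≡ (λ z → kindˢ (site (x′ , y′ , z))) (R * 2)
                                      (λ i → trans (cong (λ a → kindˢ (O₂.orbit x′ , O₄.orbit y′ , a)) (orbit₂-+ R i))
                                        (kind-+z (O₂.orbit x′) (O₄.orbit y′) (proj₁ (O₂.orbit i)) (proj₂ (O₂.orbit i)))) z z′ ez ⟩
    kindˢ (site (x′ , y′ , z′))  ∎)
    where open ≡-Reasoning

  -- Every item enters in block 0, so that the code of the seeds does not depend
  -- on the width of a block and the machine can write it without knowing its own
  -- size.
  seed : ℕ → Maybe Letter → Vertex
  seed i s = + (2 * col (Inj s)) , + (suc i * 4) , + 0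

  injections : ℕ → List Letter → List Vertex
  injections i []      = seed i nothing ∷ []
  injections i (ℓ ∷ h) = seed i (just ℓ) ∷ injections (suc i) h

  seeds : List Letter → List Vertex
  seeds h = (+ 2 , + 0 , + 0) ∷ injections 0 h

  private
    later : ∀ {y} i h → y < suc i * 4 → All (λ v → + y ≢ proj₁ (proj₂ v)) (injections i h)
    later i [] y< = (λ e → ℕₚ.<-irrefl (ℤₚ.+-injective e) y<) ∷ []
    later i (ℓ ∷ h) y< = (λ e → ℕₚ.<-irrefl (ℤₚ.+-injective e) y<) ∷
      later (suc i) h (ℕₚ.<-trans y< (ℕₚ.m<n+m _ {4} (s≤s z≤n)))

    distinct : ∀ {v : Vertex} {vs} → All (λ w → proj₁ (proj₂ v) ≢ proj₁ (proj₂ w)) vs → All (v ≢_) vs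
    distinct = All.map λ ¬e e → ¬e (cong (proj₁ ∘ proj₂) e)

    injections-unique : ∀ i h → Unique (injections i h)
    injections-unique i [] = [] ∷ []
    injections-unique i (ℓ ∷ h) = distinct (later (suc i) h (ℕₚ.m<n+m (suc i * 4) {4} (s≤s z≤n))) ∷ injections-unique (suc i) h

  seeds-unique : ∀ h → Unique (seeds h)
  seeds-unique h = distinct (later 0 h (s≤s z≤n)) ∷ injections-unique 0 h

  grains : List Letter → Vertex → ℕ
  grains h v = if does (v ∈? seeds h) then 1 else 0

  grains-∈ : ∀ h {v} → v ∈ seeds h → grains h v ≡ 1
  grains-∈ h {v} v∈ = cong (λ b → if b then 1 else 0) (dec-true (v ∈? seeds h) v∈)

  grains-∉ : ∀ h {v} → v ∉ seeds h → grains h v ≡ 0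
  grains-∉ h {v} v∉ = cong (λ b → if b then 1 else 0) (dec-false (v ∈? seeds h) v∉)

  pile : List Letter → PeriodicFinite
  pile h = record
    { nx = W * 2 ; ny = 4 ; nz = R * 2
    ; 1≤nx = s≤s z≤n ; 1≤ny = s≤s z≤n ; 1≤nz = s≤s z≤n
    ; P = background ; periodic = background-periodic
    ; F = grains h
    ; support = seeds h
    ; unique = seeds-unique h
    ; supports = λ v → mk⇔ (λ v∈ e → contradiction (trans (sym (grains-∈ h v∈)) e) λ ())
        λ ¬0 → nonzero⇒∈ v ¬0
    }
    where
    nonzero⇒∈ : ∀ v → grains h v ≢ 0 → v ∈ seeds h
    nonzero⇒∈ v ¬0 = go (v ∈? seeds h)
      where
      go : Dec (v ∈ seeds h) → v ∈ seeds h
      go (yes v∈) = v∈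
      go (no v∉)  = contradiction (grains-∉ h v∉) ¬0

  -- Taken from `pile []`, since the background and its box are the same for every word; the
  -- diagonal word is thereby defined without circularity.
  header : List Letter
  header = encodeℕ (W * 2) ++ encodeℕ 4 ++ encodeℕ (R * 2) ++
    concatMap (λ v → encodeℤ (background v)) (PeriodicFinite.box (pile []))

  encodeSeed : Vertex → List Letter
  encodeSeed v = encodeVertex v ++ encodeℕ 1

  -- Computation suffices because the injected states stand near the front of `states`, so that
  -- their columns are numerals whatever `M` is.
  column-code : ∀ s → encodeℕ (2 * col (Inj s)) ≡ letters (columnWord s)
  column-code (just one)   = refl
  column-code (just minus) = refl
  column-code (just end)   = refl
  column-code nothing      = refl

  seed-code : ∀ i s → encodeSeed (seed i s) ≡ entryCode i s
  seed-code i s = begin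
    (encodeℕ (2 * col (Inj s)) ++ (r ++ end ∷ []) ++ end ∷ []) ++ one ∷ end ∷ []
      ≡⟨ Lₚ.++-assoc (encodeℕ (2 * col (Inj s))) _ _ ⟩
    encodeℕ (2 * col (Inj s)) ++ ((r ++ end ∷ []) ++ end ∷ []) ++ one ∷ end ∷ []
      ≡⟨ cong₂ _++_ (column-code s) (trans (Lₚ.++-assoc (r ++ end ∷ []) _ _) (Lₚ.++-assoc r _ _)) ⟩
    entryCode i s ∎
    where
    open ≡-Reasoning
    r = replicate (suc i * 4) one

  injections-code : ∀ i h → concatMap encodeSeed (injections i h) ≡ entriesCode i h
  injections-code i []      = trans (Lₚ.++-identityʳ _) (seed-code i nothing)
  injections-code i (ℓ ∷ h) = cong₂ _++_ (seed-code i (just ℓ)) (injections-code (suc i) h)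

  concatMap-cong-∈ : ∀ {A B : Set} {f g : A → List B} xs → (∀ {x} → x ∈ xs → f x ≡ g x) → concatMap f xs ≡ concatMap g xs
  concatMap-cong-∈ []       e = refl
  concatMap-cong-∈ (x ∷ xs) e = cong₂ _++_ (e (here refl)) (concatMap-cong-∈ xs (e ∘ there))

  -- At `h = header` this is `header ++ seedCode header`, the word on which `quine` runs `M`.
  encode-pile : ∀ h → encode (pile h) ≡ header ++ seedCode h
  encode-pile h = begin
    a ++ b ++ c ++ d ++ concatMap (λ v → encodeVertex v ++ encodeℕ (grains h v)) (seeds h)
      ≡⟨ cong (λ e → a ++ b ++ c ++ d ++ e) (trans
           (concatMap-cong-∈ (seeds h) λ {v} v∈ → cong (λ n → encodeVertex v ++ encodeℕ n) (grains-∈ h v∈))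
           (cong (letters bootWord ++_) (injections-code 0 h))) ⟩
    a ++ b ++ c ++ d ++ seedCode h
      ≡⟨ cong (λ e → a ++ b ++ e) (Lₚ.++-assoc c d _) ⟨
    a ++ b ++ (c ++ d) ++ seedCode h
      ≡⟨ cong (a ++_) (Lₚ.++-assoc b (c ++ d) _) ⟨
    a ++ (b ++ c ++ d) ++ seedCode h
      ≡⟨ Lₚ.++-assoc a _ _ ⟨
    header ++ seedCode h ∎
    where
    open ≡-Reasoning
    a = encodeℕ (W * 2)
    b = encodeℕ 4
    c = encodeℕ (R * 2)
    d = concatMap (λ v → encodeℤ (background v)) (PeriodicFinite.box (pile []))

  leftTape-cells : ∀ h → leftTape h ≡ cells (marked new h ++ (new , nothing) ∷ [])
  leftTape-cells []      = refl
  leftTape-cells (ℓ ∷ h) = cong (λ ls → filler ∷ item new (just ℓ) ∷ ls) (leftTape-cells h)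

  private
    orbit₄-multiple : ∀ i → O₄.orbit (+ (i * 4)) ≡ (+ i , β₀)
    orbit₄-multiple zero    = refl
    orbit₄-multiple (suc i) = cong (next₄ ∘ next₄ ∘ next₄ ∘ next₄) (orbit₄-multiple i)

    orbit₂-even : ∀ s → O₂.orbit (+ (2 * col (Inj s))) ≡ (+ col (Inj s) , false)
    orbit₂-even (just one)   = refl
    orbit₂-even (just minus) = refl
    orbit₂-even (just end)   = refl
    orbit₂-even nothing      = refl

    orbit₂-odd : ∀ k → O₂.orbit (+ suc (k * 2)) ≡ (+ k , true)
    orbit₂-odd zero    = refl
    orbit₂-odd (suc k) = cong (next₂ ∘ next₂) (orbit₂-odd k)

  seed-site : ∀ i s → site (seed i s) ≡ ((+ col (Inj s) , false) , (+ suc i , β₀) , (+ 0 , false))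
  seed-site i s = cong₂ (λ x y → x , y , (+ 0 , false)) (orbit₂-even s) (orbit₄-multiple (suc i))

  injections-∈⁻ : ∀ i h {v} → v ∈ injections i h → ∃[ n ] ∃[ s ] v ≡ seed (n + i) s × leftState h n ≡ Inj s
  injections-∈⁻ i []      (here refl) = 0 , nothing , refl , refl
  injections-∈⁻ i (ℓ ∷ h) (here refl) = 0 , just ℓ , refl , refl
  injections-∈⁻ i (ℓ ∷ h) {v} (there v∈) = go (injections-∈⁻ (suc i) h v∈)
    where
    go : ∃[ n ] ∃[ s ] v ≡ seed (n + suc i) s × leftState h n ≡ Inj s →
      ∃[ n ] ∃[ s ] v ≡ seed (n + i) s × leftState (ℓ ∷ h) n ≡ Inj s
    go (n , s , e , e′) = suc n , s , trans e (cong (λ j → seed j s) (ℕₚ.+-suc n i)) , e′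

  injections-∈⁺ : ∀ i h n {s} → leftState h n ≡ Inj s → seed (n + i) s ∈ injections i h
  injections-∈⁺ i []      zero    refl = here refl
  injections-∈⁺ i (ℓ ∷ h) zero    refl = here refl
  injections-∈⁺ i (ℓ ∷ h) (suc n) {s} e = there (subst (λ j → seed j s ∈ injections (suc i) h) (ℕₚ.+-suc n i)
    (injections-∈⁺ (suc i) h n e))

  module Run (h : List Letter) where
    open Input h
    open PeriodicFinite (pile h) using (S₀)

    -- A seed is a wire of the background, with five chips; the added chip makes it a source.
    kind : Vertex → Kind
    kind v = if does (v ∈? seeds h) then source else kindˢ (site v)

    kind-∈ : ∀ v → v ∈ seeds h → kind v ≡ source
    kind-∈ v v∈ = cong (λ b → if b then source else kindˢ (site v)) (dec-true (v ∈? seeds h) v∈)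

    kind-∉ : ∀ v → v ∉ seeds h → kind v ≡ kindˢ (site v)
    kind-∉ v v∉ = cong (λ b → if b then source else kindˢ (site v)) (dec-false (v ∈? seeds h) v∉)

    data SeedView : Vertex → Set where
      boots   : SeedView (+ 2 , + 0 , + 0)
      injects : ∀ n s → leftState h n ≡ Inj s → SeedView (seed n s)

    seed-view : ∀ {v} → v ∈ seeds h → SeedView v
    seed-view (here refl) = boots
    seed-view {v} (there v∈) = go (injections-∈⁻ 0 h v∈)
      where
      go : ∃[ n ] ∃[ s ] v ≡ seed (n + 0) s × leftState h n ≡ Inj s → SeedView v
      go (n , s , e , e′) = subst SeedView (sym (trans e (cong (λ j → seed j s) (ℕₚ.+-identityʳ n)))) (injects n s e′)

    seed-∈ : ∀ n {s} → leftState h n ≡ Inj s → seed n s ∈ seeds h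
    seed-∈ n {s} e = there (subst (λ j → seed j s ∈ injections 0 h) (ℕₚ.+-identityʳ n) (injections-∈⁺ 0 h n e))

    view-wire : ∀ {v} → SeedView v → kindˢ (site v) ≡ wire
    view-wire boots = refl
    view-wire (injects n s e) = cong kindˢ (seed-site n s)

    view-wall : ∀ {v} → SeedView v → kindˢ (stepˢ x⁺ (site v)) ≡ wall
    view-wall boots = refl
    view-wall (injects n s e) = cong (λ σ → kindˢ (stepˢ x⁺ σ)) (seed-site n s)

    non-wire-∉ : ∀ v → kindˢ (site v) ≢ wire → v ∉ seeds h
    non-wire-∉ v ¬wire v∈ = ¬wire (view-wire (seed-view v∈))

    wall-kind : ∀ v → kindˢ (site v) ≡ wall → kind v ≡ wall
    wall-kind v e = trans (kind-∉ v (non-wire-∉ v λ e′ → contradiction (trans (sym e) e′) λ ())) e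

    kind-cases : ∀ v → (v ∈ seeds h × kind v ≡ source) ⊎ kind v ≡ kindˢ (site v)
    kind-cases v = go (v ∈? seeds h)
      where
      go : Dec (v ∈ seeds h) → (v ∈ seeds h × kind v ≡ source) ⊎ kind v ≡ kindˢ (site v)
      go (yes v∈) = inj₁ (v∈ , kind-∈ v v∈)
      go (no v∉)  = inj₂ (kind-∉ v v∉)

    S₀≡chips : ∀ v → S₀ v ≡ chips (kind v)
    S₀≡chips v = go (v ∈? seeds h)
      where
      go : Dec (v ∈ seeds h) → S₀ v ≡ chips (kind v)
      go (yes v∈) = trans (cong₂ (λ k n → chips k ℤ.+ + n) (view-wire (seed-view v∈)) (grains-∈ h v∈))
        (cong chips (sym (kind-∈ v v∈)))
      go (no v∉) = trans (trans (cong (λ n → background v ℤ.+ + n) (grains-∉ h v∉)) (ℤₚ.+-identityʳ (background v)))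
        (cong chips (sym (kind-∉ v v∉)))

    -- A bound on the x-coordinates of a list. A dummy farther out is a source that the list cannot
    -- contain, as `Existence` requires.
    distant : List Vertex → ℕ
    distant []             = 0
    distant ((x , _) ∷ vs) = ℤ.∣ x ∣ + distant vs

    dummy : ℕ → Vertex
    dummy k = + suc (k * 2) , + 1 , + 1

    dummy-source : ∀ k → kind (dummy k) ≡ source
    dummy-source k = trans (kind-∉ (dummy k) (non-wire-∉ (dummy k) λ e → contradiction (trans (sym e) is-source) λ ())) is-source
      where
      is-source : kindˢ (site (dummy k)) ≡ source
      is-source = cong (λ x → kindˢ (x , (+ 0 , β₁) , (+ 0 , true))) (orbit₂-odd k)

    dummy-∉ : ∀ k vs → distant vs ≤ k → dummy k ∉ vs
    dummy-∉ k (v ∷ vs) ≤k (here refl) = ℕₚ.<⇒≱ (s≤s (ℕₚ.m≤m*n k 2)) (ℕₚ.≤-trans (ℕₚ.m≤m+n _ (distant vs)) ≤k)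
    dummy-∉ k ((x , _) ∷ vs) ≤k (there v∈) = dummy-∉ k vs (ℕₚ.≤-trans (ℕₚ.m≤n+m _ ℤ.∣ x ∣) ≤k) v∈

    open Percolation S₀ kind S₀≡chips

    -- The run of the machine interprets the circuit with the bus false. The origin lies in a hub
    -- column, so its toppling would make the bus true.
    silent : (∀ n → ctl n ≢ inj₂ false) → ¬ (1 ≤Odometer[ S₀ , origin ])
    silent never (s , legal , _ , toppled) = Semantics.hub⇒G S (+ 0) (sound toppled)
      where
      S : Semantics
      S = semantics never
      𝕄 : Model
      𝕄 = model S
      F : Vertex → Set
      F v = Fired 𝕄 (site v)

      seed-fired : ∀ {v} → SeedView v → F v
      seed-fired boots = atom 0 (+ 0) Boot refl boot
      seed-fired (injects n s e) = subst (Fired 𝕄) (sym (seed-site n s))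
        (atom (suc n) -[1+ reach h n ] (Inj s)
          (trans (sym (ℤₚ.+-identityʳ (+ col (Inj s)))) (cong (λ B → column B (col (Inj s))) (sym (seed-block n e))))
          (subst (Cell (suc n) -[1+ reach h n ]) e (edgeˡ n)))

      dummy-fired : ∀ σ → kindˢ σ ≡ source → Fired 𝕄 σ
      dummy-fired σ e = subst (λ k → guard 𝕄 k (value 𝕄 σ)) (sym e) _

      source-fired : ∀ v → kind v ≡ source → F v
      source-fired v e = go (kind-cases v)
        where
        go : (v ∈ seeds h × kind v ≡ source) ⊎ kind v ≡ kindˢ (site v) → F v
        go (inj₁ (v∈ , _)) = seed-fired (seed-view v∈)
        go (inj₂ e′)       = dummy-fired (site v) (trans (sym e′) e)

      site-kind : ∀ v {k} → kind v ≡ k → k ≢ source → kindˢ (site v) ≡ k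
      site-kind v {k} e ¬source = go (kind-cases v)
        where
        go : (v ∈ seeds h × kind v ≡ source) ⊎ kind v ≡ kindˢ (site v) → kindˢ (site v) ≡ k
        go (inj₁ (_ , e′)) = contradiction (trans (sym e) e′) ¬source
        go (inj₂ e′)       = trans (sym e′) e

      wire-fired : ∀ v d → kind v ≡ wire → F (nbr d v) → F v
      wire-fired v d e f = subst (λ k → guard 𝕄 k (value 𝕄 (site v))) (sym e′)
        (wire-value 𝕄 (site v) d e′ (subst (Fired 𝕄) (site-nbr d v) f))
        where
        e′ : kindˢ (site v) ≡ wire
        e′ = site-kind v e λ ()

      gate-fired : ∀ v d d′ → kind v ≡ gate → d ≢ d′ → F (nbr d v) → F (nbr d′ v) → F v
      gate-fired v d d′ e d≢d′ f f′ = subst (λ k → guard 𝕄 k (value 𝕄 (site v))) (sym e′)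
        (gate-value 𝕄 (site v) d d′ e′ d≢d′ (subst (Fired 𝕄) (site-nbr d v) f) (subst (Fired 𝕄) (site-nbr d′ v) f′))
        where
        e′ : kindˢ (site v) ≡ gate
        e′ = site-kind v e λ ()

      source-wall : ∀ v → kind v ≡ source → ∃[ d ] kind (nbr d v) ≡ wall
      source-wall v e = x⁺ , wall-kind (nbr x⁺ v) (trans (cong kindˢ (site-nbr x⁺ v)) (go (kind-cases v)))
        where
        beside : ∀ σ → kindˢ σ ≡ source → kindˢ (stepˢ x⁺ σ) ≡ wall
        beside ((X , true)  , (t , β₁) , (Z , true))  _ = refl
        beside ((X , true)  , (t , β₀) , (Z , true))  ()
        beside ((X , true)  , (t , β₂) , (Z , true))  ()
        beside ((X , true)  , (t , β₃) , (Z , true))  ()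
        beside ((X , false) , (t , β₀) , (Z , true))  ()
        beside ((X , false) , (t , β₁) , (Z , true))  ()
        beside ((X , false) , (t , β₂) , (Z , true))  ()
        beside ((X , false) , (t , β₃) , (Z , true))  ()
        beside ((X , b)     , (t , β)  , (Z , false)) e = ⊥-elim (circuit≢source b β (cls Z X) (cls Z (ℤ.suc X)) e)
        go : (v ∈ seeds h × kind v ≡ source) ⊎ kind v ≡ kindˢ (site v) → kindˢ (stepˢ x⁺ (site v)) ≡ wall
        go (inj₁ (v∈ , _)) = view-wall (seed-view v∈)
        go (inj₂ e′)       = beside (site v) (trans (sym e′) e)

      open Sound F source-fired wire-fired gate-fired source-wall s legal

    topples-if : ∀ n → ctl n ≡ inj₂ false → 1 ≤Odometer[ S₀ , origin ]
    topples-if n e = greedily , greedily-legal , greedily-complete , reached origin refl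
      where
      open Existence S₀ kind S₀≡chips (λ vs → dummy (distant vs) , dummy-source (distant vs) , dummy-∉ (distant vs) vs ℕₚ.≤-refl)
      open Completion greedily greedily-complete

      -- Quantifying over the vertices at a site carries `Topples` over to sites without an inverse
      -- of `site`.
      T : Site → Set
      T σ = ∀ v → site v ≡ σ → Topples v

      wire-closed : ∀ σ d → kindˢ σ ≡ wire → T (stepˢ d σ) → T σ
      wire-closed σ d k τ v refl = go (kind-cases v)
        where
        go : (v ∈ seeds h × kind v ≡ source) ⊎ kind v ≡ kindˢ (site v) → Topples v
        go (inj₁ (_ , e)) = source-topples v e
        go (inj₂ e)       = wire-topples v d (trans e k) (τ (nbr d v) (site-nbr d v))

      gate-closed : ∀ σ d d′ → kindˢ σ ≡ gate → d ≢ d′ → T (stepˢ d σ) → T (stepˢ d′ σ) → T σ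
      gate-closed σ d d′ k d≢d′ τ τ′ v refl = go (kind-cases v)
        where
        go : (v ∈ seeds h × kind v ≡ source) ⊎ kind v ≡ kindˢ (site v) → Topples v
        go (inj₁ (_ , e)) = source-topples v e
        go (inj₂ e)       = gate-topples v d d′ (trans e k) d≢d′ (τ (nbr d v) (site-nbr d v)) (τ′ (nbr d′ v) (site-nbr d′ v))

      open Closed T wire-closed gate-closed using (Line; line)
      open Derivation T wire-closed gate-closed

      seed-topples : ∀ {v} → v ∈ seeds h → T (site v)
      seed-topples {v} v∈ w e = subst Topples (sym (site-injective e)) (source-topples v (kind-∈ v v∈))

      boot-line : Line (column (+ 0) (col Boot)) (+ 0)
      boot-line = line (+ 0) (seed-topples (here refl))

      inj-line : ∀ n s → leftState h n ≡ Inj s → Line (column (+ 0) (col (Inj s))) (+ suc n)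
      inj-line n s e = subst (λ X → Line X (+ suc n)) (sym (ℤₚ.+-identityʳ (+ col (Inj s))))
        (line (+ 0) (subst T (seed-site n s) (seed-topples (seed-∈ n e))))

      reached : T (site origin)
      reached = reject-line boot-line inj-line n e (+ 0)

    verdict : ∀ b → HaltsWith M (h ++ seedCode h) b → ∃[ n ] ctl n ≡ inj₂ b
    verdict b H = proj₁ (quine h b H) , trans
      (cong (λ ls → proj₁ (iterate (proj₁ (quine h b H)) (inj₁ (seek copying) , ls , home , []))) (leftTape-cells h))
      (proj₂ (quine h b H))

    -- `silent` asks that the machine reject at no time at all, and two verdicts of one run agree.
    unique-verdict : ∀ n → ctl n ≡ inj₂ true → ∀ m → ctl m ≢ inj₂ false
    unique-verdict n e m e′ = contradiction (verdict-unique n m e e′) λ ()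

  undecided : ¬ Decides M encode (λ c → 1 ≤Odometer[ PeriodicFinite.S₀ c , origin ])
  undecided decides = go (decides (pile header))
    where
    open Run header
    halts : ∀ {b} → HaltsWith M (encode (pile header)) b → ∃[ n ] Input.ctl header n ≡ inj₂ b
    halts {b} H = verdict b (subst (λ w → HaltsWith M w b) (encode-pile header) H)
    go : ∃[ b ] HaltsWith M (encode (pile header)) b ×
        (b ≡ true ⇔ 1 ≤Odometer[ PeriodicFinite.S₀ (pile header) , origin ]) → ⊥
    go (true , H , iff)  = silent (unique-verdict (proj₁ (halts H)) (proj₂ (halts H))) (Equivalence.to iff refl)
    go (false , H , iff) = contradiction
      (Equivalence.from iff (topples-if (proj₁ (halts H)) (proj₂ (halts H)))) λ ()

theorem2 : ¬ (∃[ M ] Decides {A = Letter} M encode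
    (λ c → 1 ≤Odometer[ PeriodicFinite.S₀ c , origin ]))
theorem2 (M , decides) = Pile.undecided M decides
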